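{- For every integer $k\ge 3$, every integer $\ell$ with $1\le \ell<k/2$ and every $\gamma>0$ there exist $c>0$ and $n_0>0$ such that the following holds. If $(\mathcal H,\phi)$ is an $n$-vertex colored $k$-graph with $(k-\ell)\mid n$, $n\ge n_0$, $\delta_{k-1}(\mathcal H)\ge\left(\frac{1}{2(k-\ell)}+\gamma\right)n$ and $\Delta_{\ell}(\mathcal H_i)\le cn^{k-\ell}$ for every $i\in\mathbb N$, then $(\mathcal H,\phi)$ contains a properly colored Hamilton $(k,\ell)$-cycle $C_n^{(k)}(\ell)$.
   Context: A $k$-graph is a $k$-uniform hypergraph. A colored hypergraph is a pair $(\mathcal H,\phi)$ where $\phi:\mathcal H\to\mathbb N$ colors the edges; $\mathcal H_i=\{e\in\mathcal H:\phi(e)=i\}$. For $S\subseteq V(\mathcal H)$, $\deg(S)$ is the number of edges containing $S$; $\delta_s(\mathcal H)=\min\{\deg(S):|S|=s\}$ and $\Delta_s(\mathcal H)=\max\{\deg(S):|S|=s\}$. A $(k,\ell)$-cycle $C_n^{(k)}(\ell)$ is an $n$-vertex $k$-graph whose vertices can be cyclically ordered so that every edge consists of $k$ consecutive vertices and every two consecutive edges share exactly $\ell$ vertices. A Hamilton $(k,\ell)$-cycle in $\mathcal H$ is a spanning subhypergraph that is a $(k,\ell)$-cycle. A hypergraph is properly colored if every two intersecting edges receive different colors. -}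

module Defs where

open import Data.Nat as ℕ using (ℕ; zero; suc; _*_; _+_; _∸_; _<_; _^_)
open import Data.Nat.DivMod using (_mod_)
open import Data.Integer using (+_)
open import Data.Rational using (ℚ; _/_; 0ℚ)
open import Data.Fin using (Fin; toℕ)
open import Data.Fin.Subset using (Subset; _∈_; _∩_; _⊆_; Nonempty; ∣_∣)
open import Data.Fin.Subset.Properties using (_⊆?_)
open import Data.List using (List; length; filter)
open import Data.List.Relation.Unary.All using (All)
open import Data.List.Relation.Unary.Unique.Propositional using (Unique)
import Data.List.Membership.Propositional as L
open import Data.Product using (Σ; ∃; ∃-syntax; _×_)
open import Data.Empty using (⊥)
open import Relation.Binary.PropositionalEquality using (_≡_; _≢_)
open import Relation.Nullary.Decidable using (_×-dec_)
open import Function.Bundles using (_↔_; _⇔_; Inverse)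

ℕtoℚ : ℕ → ℚ
ℕtoℚ n = + n / 1

-- the rational 1 / (2 d)  (with the junk value 0 for d = 0, never used)
invTwice : ℕ → ℚ
invTwice zero    = 0ℚ
invTwice (suc d) = + 1 / (2 * suc d)

record ColoredKGraph (k n : ℕ) : Set where
  field
    edges   : List (Subset n)
    unique  : Unique edges
    uniform : All (λ e → ∣ e ∣ ≡ k) edges
    colour  : Subset n → ℕ
open ColoredKGraph public

deg : ∀ {k n} → ColoredKGraph k n → Subset n → ℕ
deg H S = length (filter (λ e → S ⊆? e) (edges H))

degCol : ∀ {k n} → ColoredKGraph k n → ℕ → Subset n → ℕ
degCol H i S = length (filter (λ e → (S ⊆? e) ×-dec (colour H e ℕ.≟ i)) (edges H))

-- A properly colored Hamilton (k,ℓ)-cycle in H on n = suc n' vertices: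
-- a cyclic ordering σ of the vertices, m = n/(k-ℓ) edges e_0,…,e_{m-1},
-- e_j consisting of the k consecutive vertices σ(j(k-ℓ)), …, σ(j(k-ℓ)+k-1)
-- (indices mod n), all edges of H, and any two distinct intersecting
-- edges of the cycle receive different colours.
record ProperHamCycle (k ℓ n' : ℕ) (H : ColoredKGraph k (suc n')) : Set where
  field
    σ        : Fin (suc n') ↔ Fin (suc n')
    m        : ℕ
    m-def    : m * (k ∸ ℓ) ≡ suc n'
    edge     : Fin m → Subset (suc n')
    edge-def : ∀ j v → (v ∈ edge j) ⇔
                 (∃[ t ] (t < k × v ≡ Inverse.to σ ((toℕ j * (k ∸ ℓ) + t) mod (suc n'))))
    edge-in  : ∀ j → edge j L.∈ edges H
    proper   : ∀ j j' → j ≢ j' → Nonempty (edge j ∩ edge j') →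
                 colour H (edge j) ≢ colour H (edge j')

HasProperHamCycle : (k ℓ n : ℕ) → ColoredKGraph k n → Set
HasProperHamCycle k ℓ zero    H = ⊥
HasProperHamCycle k ℓ (suc n) H = ProperHamCycle k ℓ n H

{-# OPTIONS --safe #-}
module Submission where

-- Write d = k - ℓ and h = k - 2ℓ. A Hamilton (k,ℓ)-cycle is a cyclic sequence of blocks
-- (S , M) with |S| = ℓ and |M| = h, the edge of a block being S ∪ M ∪ S′ with S′ the ℓ-set of
-- the preceding block; only consecutive edges meet, and they meet in ℓ vertices. So if an edge
-- is fixed, few choices of the d other vertices of a neighbouring edge repeat its colour, and
-- every configuration occurring with positive density also occurs properly coloured.
--
-- The proof is by absorption. Any two ends are joined by a positive proportion of all triples
-- of blocks. A d-tuple x is absorbed by inserting a block t chosen together with the absorber,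
-- after each vertex of t has been released by a gadget that exchanges it for a vertex of x.
-- Such absorbers, and a reservoir of connectors, are sampled greedily: a potential that halves
-- the weight of a tuple whenever it is served shows that linearly many samples serve every
-- tuple linearly often.
--
-- The remaining vertices are covered by long paths (tiles). If a set U of linear size stays
-- uncovered, either U spans a positive density of edges and contains a new tile, or almost all
-- of the degree of (k-1)-tuples in U goes to the tiles; as it exceeds n/2d, many tuples have
-- more than half a vertex per block in many tiles. By supersaturation, q tiles and vertices of
-- U then form a zigzag path which has one tile-vertex in every second block and is long enough
-- for q+1 tiles.

-- The threshold n/2d is the exchange rate of the zigzag path: a tile vertex placed in the overlap
-- of two consecutive edges serves both, so N tile vertices carry 2N edges, and replacing a tile of
-- τ blocks pays off once slightly more than τ/2 of its vertices are usable. T tiles have Tτd ≤ n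
-- vertices, so degree beyond n/2d forces such tiles to exist. The colours shape every gadget. A
-- bound for ℓ-sets controls a conflict only if ℓ vertices of an edge are held, its other d vertices
-- are resampled, and the edge it is compared with stays untouched. This decides the length of
-- connectors, the form of the exchange gadget and the alternation of tiles in the zigzag. All
-- probabilities are counts in natural numbers over lists of tuples, which may repeat entries;
-- repetition is one more rare event to discard. The constants are not circular: sizes and densities
-- of absorbers and connectors depend on k and ℓ alone; they fix G′, such that the absorbers and the
-- reservoir meant for w = n/(G′ + 1) demands fill only a small part of the graph; then C and n₀
-- follow.

module Prelude where

  open import Data.Nat hiding (_/_; _%_) public
  open import Data.Nat.Properties public
  open import Data.Nat.Tactic.RingSolver using (solve-∀) public
  open import Data.Fin using (Fin; zero; suc) public
  open import Data.List using (List; []; _∷_; length; map; _++_; allFin; filter) public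
  open import Data.List.Properties using (length-++; ++-assoc; ++-identityʳ) public
  open import Data.List.Membership.Propositional using (_∈_; _∉_; lose) public
  open import Data.List.Membership.Propositional.Properties using (∈-++⁺ˡ; ∈-++⁺ʳ; ∈-++⁻; ∈-map⁺; ∈-map⁻; ∈-allFin; ∈-filter⁺; ∈-filter⁻) public
  open import Data.List.Relation.Unary.Any using (Any; here; there; any?) public
  open import Data.List.Relation.Unary.All using (All; []; _∷_) public
  open import Data.List.Relation.Unary.AllPairs using ([]; _∷_) public
  open import Data.List.Relation.Unary.Unique.Propositional using (Unique) public
  open import Data.List.Relation.Binary.Permutation.Propositional using (_↭_; prep; ↭-refl; ↭-sym; ↭-trans; ↭-reflexive; ↭⇒↭ₛ) public
  open import Data.List.Relation.Binary.Permutation.Propositional.Properties using (∈-resp-↭; All-resp-↭; ++⁺; ++⁺ˡ; ++⁺ʳ; ++-comm; ↭-length; shift) public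
  open import Data.Vec using (Vec; []; _∷_; toList; lookup) public
  open import Data.Vec.Properties using (length-toList; toList-++) public
  open import Data.Vec.Relation.Unary.All using ([]; _∷_) renaming (All to VAll) public
  open import Data.Product using (∃; ∃-syntax; _×_; _,_; proj₁; proj₂; uncurry) public
  open import Data.Sum using (_⊎_; inj₁; inj₂; [_,_]′) public
  open import Data.Unit using (⊤; tt) public
  open import Data.Empty using (⊥-elim) public
  open import Function using (_∘_) public
  open import Relation.Nullary using (Dec; yes; no; ¬_; ¬?; contradiction) public
  open import Relation.Nullary.Decidable using (_×-dec_; _⊎-dec_; decidable-stable) public
  open import Relation.Unary using (Decidable) public
  open import Relation.Binary.PropositionalEquality hiding ([_]) public

  import Data.Fin
  import Data.List.Relation.Unary.All
  import Data.List.Relation.Unary.All.Properties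
  import Data.List.Relation.Unary.AllPairs
  import Data.List.Relation.Unary.Unique.Propositional.Properties
  import Data.List.Relation.Binary.Permutation.Propositional
  import Data.Vec
  import Data.Vec.Relation.Unary.All
  import Data.Vec.Membership.Propositional.Properties

  module FinB      = Data.Fin
  module AllB      = Data.List.Relation.Unary.All
  module AllP     = Data.List.Relation.Unary.All.Properties
  module AllPairs = Data.List.Relation.Unary.AllPairs
  module UniqueP  = Data.List.Relation.Unary.Unique.Propositional.Properties
  module P        = Data.List.Relation.Binary.Permutation.Propositional
  module VecB      = Data.Vec
  module VAllB     = Data.Vec.Relation.Unary.All
  module VMem     = Data.Vec.Membership.Propositional.Properties

-- Finite sums, densities, and resampling of single coordinates.

module Counting where

  open Prelude
  open import Data.List.Properties using (length-map)

  private variable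
    A B C I : Set
    P Q R : A → Set

  ∑ : List A → (A → ℕ) → ℕ
  ∑ []       f = 0
  ∑ (x ∷ xs) f = f x + ∑ xs f

  ∑-mono-∈ : (xs : List A) {f g : A → ℕ} → (∀ x → x ∈ xs → f x ≤ g x) → ∑ xs f ≤ ∑ xs g
  ∑-mono-∈ []       p = z≤n
  ∑-mono-∈ (x ∷ xs) p = +-mono-≤ (p x (here refl)) (∑-mono-∈ xs (λ y i → p y (there i)))

  ∑-mono : (xs : List A) {f g : A → ℕ} → (∀ x → f x ≤ g x) → ∑ xs f ≤ ∑ xs g
  ∑-mono xs p = ∑-mono-∈ xs (λ x _ → p x)

  ∑-cong : (xs : List A) {f g : A → ℕ} → (∀ x → f x ≡ g x) → ∑ xs f ≡ ∑ xs g
  ∑-cong []       p = refl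
  ∑-cong (x ∷ xs) p = cong₂ _+_ (p x) (∑-cong xs p)

  ∑-+ : (xs : List A) (f g : A → ℕ) → ∑ xs (λ x → f x + g x) ≡ ∑ xs f + ∑ xs g
  ∑-+ []       f g = refl
  ∑-+ (x ∷ xs) f g = trans (cong (f x + g x +_) (∑-+ xs f g)) (lem (f x) (g x) (∑ xs f) (∑ xs g))
    where lem : ∀ a b c e → a + b + (c + e) ≡ a + c + (b + e)
          lem = solve-∀

  ∑-*ˡ : (c : ℕ) (xs : List A) (f : A → ℕ) → ∑ xs (λ x → c * f x) ≡ c * ∑ xs f
  ∑-*ˡ c []       f = sym (*-zeroʳ c)
  ∑-*ˡ c (x ∷ xs) f = trans (cong (c * f x +_) (∑-*ˡ c xs f)) (sym (*-distribˡ-+ c (f x) (∑ xs f)))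

  ∑-*ʳ : (c : ℕ) (xs : List A) (f : A → ℕ) → ∑ xs (λ x → f x * c) ≡ ∑ xs f * c
  ∑-*ʳ c xs f = trans (∑-cong xs (λ x → *-comm (f x) c)) (trans (∑-*ˡ c xs f) (*-comm c (∑ xs f)))

  ∑-const : (c : ℕ) (xs : List A) → ∑ xs (λ _ → c) ≡ length xs * c
  ∑-const c []       = refl
  ∑-const c (x ∷ xs) = cong (c +_) (∑-const c xs)

  ∑-++ : (xs ys : List A) (f : A → ℕ) → ∑ (xs ++ ys) f ≡ ∑ xs f + ∑ ys f
  ∑-++ []       ys f = refl
  ∑-++ (x ∷ xs) ys f = trans (cong (f x +_) (∑-++ xs ys f)) (sym (+-assoc (f x) _ _))

  ∑-map : (g : A → B) (xs : List A) (f : B → ℕ) → ∑ (map g xs) f ≡ ∑ xs (f ∘ g)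
  ∑-map g []       f = refl
  ∑-map g (x ∷ xs) f = cong (f (g x) +_) (∑-map g xs f)

  ∑-swap : (xs : List A) (ys : List B) (f : A → B → ℕ) →
           ∑ xs (λ x → ∑ ys (f x)) ≡ ∑ ys (λ y → ∑ xs (λ x → f x y))
  ∑-swap []       ys f = sym (trans (∑-const 0 ys) (*-zeroʳ (length ys)))
  ∑-swap (x ∷ xs) ys f = trans (cong (∑ ys (f x) +_) (∑-swap xs ys f))
                               (sym (∑-+ ys (f x) (λ y → ∑ xs (λ x′ → f x′ y))))

  ∑-∈ : {xs : List A} {x : A} (f : A → ℕ) → x ∈ xs → f x ≤ ∑ xs f
  ∑-∈ f (here refl) = m≤m+n _ _
  ∑-∈ f (there i)   = ≤-trans (∑-∈ f i) (m≤n+m _ _)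

  ∑-average : (xs : List A) (f : A → ℕ) (m : ℕ) → 0 < length xs → m ≤ ∑ xs f →
              ∃ λ x → x ∈ xs × m ≤ length xs * f x
  ∑-average (x ∷ xs) f m _ le = search (x ∷ xs) (λ i → i) (λ all → <-irrefl refl (bound all))
    where
    open ≤-Reasoning
    N = length (x ∷ xs)
    bound : (∀ y → y ∈ (x ∷ xs) → N * f y < m) → m * N < m * N
    bound all = begin-strict
      m * N                        ≤⟨ *-monoˡ-≤ N le ⟩
      ∑ (x ∷ xs) f * N             ≡⟨ *-comm _ N ⟩
      N * ∑ (x ∷ xs) f             ≡⟨ ∑-*ˡ N (x ∷ xs) f ⟨
      ∑ (x ∷ xs) (λ y → N * f y)   <⟨ +-mono-<-≤ (all x (here refl)) (∑-mono-∈ xs (λ y i → <⇒≤ (all y (there i)))) ⟩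
      m + ∑ xs (λ _ → m)           ≡⟨ cong (m +_) (∑-const m xs) ⟩
      m + length xs * m            ≡⟨ *-comm N m ⟩
      m * N                        ∎
    search : ∀ ws → (∀ {y} → y ∈ ws → y ∈ (x ∷ xs)) → ¬ (∀ y → y ∈ ws → N * f y < m) →
             ∃ λ y → y ∈ (x ∷ xs) × m ≤ N * f y
    search []       sub ¬all = ⊥-elim (¬all λ _ ())
    search (w ∷ ws) sub ¬all with m ≤? N * f w
    ... | yes p = w , sub (here refl) , p
    ... | no ¬p = search ws (sub ∘ there)
                    (λ all → ¬all λ { y (here refl) → ≰⇒> ¬p ; y (there i) → all y i })

  ind : {X : Set} → Dec X → ℕ
  ind (yes _) = 1
  ind (no _)  = 0

  ind-mono : {X Y : Set} (p : Dec X) (q : Dec Y) → (X → Y) → ind p ≤ ind q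
  ind-mono (yes x) (yes y) f = ≤-refl
  ind-mono (yes x) (no ¬y) f = contradiction (f x) ¬y
  ind-mono (no ¬x) q       f = z≤n

  ind-≤1 : {X : Set} (p : Dec X) → ind p ≤ 1
  ind-≤1 (yes _) = ≤-refl
  ind-≤1 (no _)  = z≤n

  ind-yes : {X : Set} (p : Dec X) → X → ind p ≡ 1
  ind-yes (yes _) x = refl
  ind-yes (no ¬x) x = contradiction x ¬x

  ind-no : {X : Set} (p : Dec X) → ¬ X → ind p ≡ 0
  ind-no (yes x) ¬x = contradiction x ¬x
  ind-no (no _)  ¬x = refl

  ind-cover : {X Y Z : Set} (p : Dec X) (q : Dec Y) (r : Dec Z) → (Z → X ⊎ Y) → ind r ≤ ind p + ind q
  ind-cover p q (no _)  f = z≤n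
  ind-cover p q (yes z) f with f z
  ... | inj₁ x rewrite ind-yes p x = s≤s z≤n
  ... | inj₂ y rewrite ind-yes q y = m≤n+m 1 (ind p)

  dec-⊎ : {X Y : Set} → Dec X → (¬ X → Y) → X ⊎ Y
  dec-⊎ (yes x) f = inj₁ x
  dec-⊎ (no ¬x) f = inj₂ (f ¬x)

  cnt : (xs : List A) {P : A → Set} → Decidable P → ℕ
  cnt xs P? = ∑ xs (λ x → ind (P? x))

  cnt≤length : (xs : List A) (P? : Decidable P) → cnt xs P? ≤ length xs
  cnt≤length xs P? = ≤-trans (∑-mono xs (λ x → ind-≤1 (P? x))) (≤-reflexive (trans (∑-const 1 xs) (*-identityʳ _)))

  cnt-mono : (xs : List A) (P? : Decidable P) (Q? : Decidable Q) → (∀ x → x ∈ xs → P x → Q x) →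
             cnt xs P? ≤ cnt xs Q?
  cnt-mono xs P? Q? f = ∑-mono-∈ xs (λ x i → ind-mono (P? x) (Q? x) (f x i))

  cnt-find : (xs : List A) (P? : Decidable P) → 0 < cnt xs P? → ∃ λ x → x ∈ xs × P x
  cnt-find (x ∷ xs) P? pos with P? x
  ... | yes p = x , here refl , p
  ... | no _  with cnt-find xs P? pos
  ...   | y , i , p = y , there i , p

  -- Probability at least 1/D for a uniformly chosen entry, cleared of fractions.
  record Dense (D : ℕ) (xs : List A) {P : A → Set} (P? : Decidable P) : Set where
    constructor mkDense
    field dense : length xs ≤ D * cnt xs P?
  open Dense public

  -- Probability at most s/N. The numerator counts elementary events, so a union adds numerators
  -- over one common N.
  record Rare (s N : ℕ) (xs : List A) {P : A → Set} (P? : Decidable P) : Set where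
    constructor mkRare
    field rare : N * cnt xs P? ≤ s * length xs
  open Rare public

  dense? : (D : ℕ) (xs : List A) (P? : Decidable P) → Dec (Dense D xs P?)
  dense? D xs P? with length xs ≤? D * cnt xs P?
  ... | yes p = yes (mkDense p)
  ... | no ¬p = no λ where (mkDense p) → ¬p p

  module _ {A : Set} {P : A → Set} {xs : List A} {P? : Decidable P} where

    dense-find : ∀ {D} → Dense D xs P? → 0 < length xs → ∃ λ x → x ∈ xs × P x
    dense-find {D} (mkDense p) pos = cnt-find xs P? (n≢0⇒n>0 λ e →
      <⇒≱ pos (≤-trans p (≤-reflexive (trans (cong (D *_) e) (*-zeroʳ D)))))

    dense-≤ : ∀ {D D′} → D ≤ D′ → Dense D xs P? → Dense D′ xs P?
    dense-≤ le (mkDense p) = mkDense (≤-trans p (*-monoˡ-≤ _ le))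

    dense-mono : ∀ {D} {Q? : Decidable Q} → (∀ x → x ∈ xs → P x → Q x) → Dense D xs P? → Dense D xs Q?
    dense-mono {D = D} {Q? = Q?} f (mkDense p) = mkDense (≤-trans p (*-monoʳ-≤ D (cnt-mono xs P? Q? f)))

    rare-mono : ∀ {s N} {Q? : Decidable Q} → (∀ x → x ∈ xs → Q x → P x) → Rare s N xs P? → Rare s N xs Q?
    rare-mono {N = N} {Q? = Q?} f (mkRare p) = mkRare (≤-trans (*-monoʳ-≤ N (cnt-mono xs Q? P? f)) p)

    rare-⊎ : ∀ {s t N} {Q? : Decidable Q} {R? : Decidable R} → (∀ x → R x → P x ⊎ Q x) →
             Rare s N xs P? → Rare t N xs Q? → Rare (s + t) N xs R?
    rare-⊎ {s = s} {t} {N} {Q?} {R?} f (mkRare p) (mkRare q) = mkRare (begin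
      N * cnt xs R?                   ≤⟨ *-monoʳ-≤ N (∑-mono xs λ x → ind-cover (P? x) (Q? x) (R? x) (f x)) ⟩
      N * ∑ xs (λ x → ind (P? x) + ind (Q? x)) ≡⟨ cong (N *_) (∑-+ xs _ _) ⟩
      N * (cnt xs P? + cnt xs Q?)     ≡⟨ *-distribˡ-+ N _ _ ⟩
      N * cnt xs P? + N * cnt xs Q?   ≤⟨ +-mono-≤ p q ⟩
      s * length xs + t * length xs   ≡⟨ *-distribʳ-+ (length xs) s t ⟨
      (s + t) * length xs             ∎)
      where open ≤-Reasoning

    -- The condition `2 * D * s ≤ N` says that Q takes at most 1/2D, half of what P guarantees, so
    -- the other half survives. Discarding forbidden vertices or colour conflicts costs this factor
    -- 2.
    dense-diff : ∀ {D s N} {Q? : Decidable Q} {R? : Decidable R} → 2 * D * s ≤ N →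
                 (∀ x → P x → ¬ Q x → R x) → Dense D xs P? → Rare s N xs Q? → 0 < s → Dense (2 * D) xs R?
    dense-diff {D = D} {s} {N} {Q?} {R?} le f (mkDense p) (mkRare q) 0<s = mkDense
      (+-cancelˡ-≤ L _ _ (*-cancelˡ-≤ s {{>-nonZero 0<s}} (begin
        s * (L + L)                       ≤⟨ *-monoʳ-≤ s (+-mono-≤ p p) ⟩
        s * (D * cP + D * cP)             ≡⟨ e₁ s D cP ⟩
        2 * D * s * cP                    ≤⟨ *-monoʳ-≤ (2 * D * s) (≤-trans cover (≤-reflexive (∑-+ xs _ _))) ⟩
        2 * D * s * (cQ + cR)             ≡⟨ *-distribˡ-+ (2 * D * s) cQ cR ⟩
        2 * D * s * cQ + 2 * D * s * cR   ≤⟨ +-monoˡ-≤ _ (≤-trans (*-monoˡ-≤ cQ le) q) ⟩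
        s * L + 2 * D * s * cR            ≡⟨ e₂ s L D cR ⟩
        s * (L + 2 * D * cR)              ∎)))
      where
      open ≤-Reasoning
      L = length xs
      cP = cnt xs P?
      cQ = cnt xs Q?
      cR = cnt xs R?
      cover : cP ≤ ∑ xs (λ x → ind (Q? x) + ind (R? x))
      cover = ∑-mono xs (λ x → ind-cover (Q? x) (R? x) (P? x) (λ px → dec-⊎ (Q? x) (f x px)))
      e₁ : ∀ s D c → s * (D * c + D * c) ≡ 2 * D * s * c
      e₁ = solve-∀
      e₂ : ∀ s L D c → s * L + 2 * D * s * c ≡ s * (L + 2 * D * c)
      e₂ = solve-∀

  -- Union bound over a list of events.
  rare-any : ∀ {s N} {xs : List A} (is : List I) {Q : I → A → Set} (Q? : ∀ i → Decidable (Q i)) (R? : Decidable R) →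
             (∀ x → R x → Any (λ i → Q i x) is) → (∀ i → i ∈ is → Rare s N xs (Q? i)) →
             Rare (length is * s) N xs R?
  rare-any {s = s} {N} {xs} is Q? R? f q = mkRare (begin
    N * cnt xs R?                                     ≤⟨ *-monoʳ-≤ N (∑-mono xs bound) ⟩
    N * ∑ xs (λ x → ∑ is (λ i → ind (Q? i x)))        ≡⟨ cong (N *_) (∑-swap xs is _) ⟩
    N * ∑ is (λ i → cnt xs (Q? i))                    ≡⟨ ∑-*ˡ N is _ ⟨
    ∑ is (λ i → N * cnt xs (Q? i))                    ≤⟨ ∑-mono-∈ is (λ i m → rare (q i m)) ⟩
    ∑ is (λ _ → s * length xs)                        ≡⟨ ∑-const _ is ⟩
    length is * (s * length xs)                       ≡⟨ *-assoc (length is) s _ ⟨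
    length is * s * length xs                         ∎)
    where
    open ≤-Reasoning
    hit : ∀ x js → Any (λ i → _) js → 1 ≤ ∑ js (λ i → ind (Q? i x))
    hit x (j ∷ js) (here p)  = ≤-trans (≤-reflexive (sym (ind-yes (Q? j x) p))) (m≤m+n _ _)
    hit x (j ∷ js) (there p) = ≤-trans (hit x js p) (m≤n+m _ _)
    bound : ∀ x → ind (R? x) ≤ ∑ is (λ i → ind (Q? i x))
    bound x with R? x
    ... | yes r = hit x is (f x r)
    ... | no _  = z≤n

  -- Products and powers are opaque from here on: only their sums, lengths and members are used, and
  -- large tuple spaces never unfold.
  abstract
    infixr 5 _⊗_
    _⊗_ : List A → List B → List (A × B)
    []       ⊗ ys = []
    (x ∷ xs) ⊗ ys = map (x ,_) ys ++ (xs ⊗ ys)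

    ∑-⊗ : (xs : List A) (ys : List B) (f : A × B → ℕ) → ∑ (xs ⊗ ys) f ≡ ∑ xs (λ x → ∑ ys (λ y → f (x , y)))
    ∑-⊗ []       ys f = refl
    ∑-⊗ (x ∷ xs) ys f = trans (∑-++ (map (x ,_) ys) _ f) (cong₂ _+_ (∑-map (x ,_) ys f) (∑-⊗ xs ys f))

    length-⊗ : (xs : List A) (ys : List B) → length (xs ⊗ ys) ≡ length xs * length ys
    length-⊗ []       ys = refl
    length-⊗ (x ∷ xs) ys = trans (length-++ (map (x ,_) ys)) (cong₂ _+_ (length-map (x ,_) ys) (length-⊗ xs ys))

    ∈-⊗⁺ : {xs : List A} {ys : List B} {x : A} {y : B} → x ∈ xs → y ∈ ys → (x , y) ∈ xs ⊗ ys
    ∈-⊗⁺ (here refl) j = ∈-++⁺ˡ (∈-map⁺ _ j)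
    ∈-⊗⁺ {xs = x ∷ xs} {ys} (there i) j = ∈-++⁺ʳ (map (x ,_) ys) (∈-⊗⁺ i j)

    ∈-⊗⁻ : (xs : List A) {ys : List B} {p : A × B} → p ∈ xs ⊗ ys → proj₁ p ∈ xs × proj₂ p ∈ ys
    ∈-⊗⁻ (x ∷ xs) {ys} i with ∈-++⁻ (map (x ,_) ys) i
    ... | inj₂ j = let a , b = ∈-⊗⁻ xs j in there a , b
    ... | inj₁ j with ∈-map⁻ (x ,_) j
    ...   | y , y∈ , refl = here refl , y∈

    pow : (N : ℕ) → List A → List (Vec A N)
    pow zero    xs = [] ∷ []
    pow (suc N) xs = map (uncurry _∷_) (xs ⊗ pow N xs)

    ∑-pow-0 : (xs : List A) (f : Vec A 0 → ℕ) → ∑ (pow 0 xs) f ≡ f []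
    ∑-pow-0 xs f = +-identityʳ (f [])

    ∑-pow-suc : (N : ℕ) (xs : List A) (f : Vec A (suc N) → ℕ) →
                ∑ (pow (suc N) xs) f ≡ ∑ xs (λ x → ∑ (pow N xs) (λ w → f (x ∷ w)))
    ∑-pow-suc N xs f = trans (∑-map (uncurry _∷_) (xs ⊗ pow N xs) f) (∑-⊗ xs (pow N xs) (f ∘ uncurry _∷_))

    length-pow : (N : ℕ) (xs : List A) → length (pow N xs) ≡ length xs ^ N
    length-pow zero    xs = refl
    length-pow (suc N) xs = trans (length-map (uncurry _∷_) (xs ⊗ pow N xs))
      (trans (length-⊗ xs (pow N xs)) (cong (length xs *_) (length-pow N xs)))

    ∈-pow⁺ : {xs : List A} {N : ℕ} {w : Vec A N} → (∀ i → VecB.lookup w i ∈ xs) → w ∈ pow N xs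
    ∈-pow⁺ {w = []}    p = here refl
    ∈-pow⁺ {w = v ∷ w} p = ∈-map⁺ (uncurry _∷_) (∈-⊗⁺ (p zero) (∈-pow⁺ (λ i → p (suc i))))

    ∈-pow⁻ : {xs : List A} {N : ℕ} {w : Vec A N} → w ∈ pow N xs → ∀ i → VecB.lookup w i ∈ xs
    ∈-pow⁻ {xs = xs} {N = suc N} p i with ∈-map⁻ (uncurry _∷_) p
    ∈-pow⁻ {xs = xs} {N = suc N} p zero    | (x , w) , q , refl = proj₁ (∈-⊗⁻ xs q)
    ∈-pow⁻ {xs = xs} {N = suc N} p (suc i) | (x , w) , q , refl = ∈-pow⁻ (proj₂ (∈-⊗⁻ xs q)) i

  ∑-pow-+ : (M N : ℕ) (xs : List A) (f : Vec A (M + N) → ℕ) →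
            ∑ (pow (M + N) xs) f ≡ ∑ (pow M xs) (λ u → ∑ (pow N xs) (λ w → f (u VecB.++ w)))
  ∑-pow-+ zero    N xs f = sym (∑-pow-0 xs _)
  ∑-pow-+ (suc M) N xs f = trans (∑-pow-suc (M + N) xs f)
    (trans (∑-cong xs (λ x → ∑-pow-+ M N xs (λ w → f (x ∷ w)))) (sym (∑-pow-suc M xs _)))

  pow-nonempty : (N : ℕ) {xs : List A} → 0 < length xs → 0 < length (pow N xs)
  pow-nonempty N {xs} pos rewrite length-pow N xs = m^n>0 (length xs) {{>-nonZero pos}} N

  -- Sequential choice: a good x has probability 1/D, and then a good y has probability 1/D′. All
  -- gadgets are built in this way, one tuple after another.
  dense-⊗ : ∀ {D D′} {xs : List A} {ys : List B} {P? : Decidable P} {R : A × B → Set} {R? : Decidable R} →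
            Dense D xs P? → (∀ x → P x → Dense D′ ys (λ y → R? (x , y))) → Dense (D * D′) (xs ⊗ ys) R?
  dense-⊗ {D = D} {D′} {xs} {ys} {P?} {R? = R?} (mkDense p) q = mkDense (begin
    length (xs ⊗ ys)                                       ≡⟨ length-⊗ xs ys ⟩
    length xs * length ys                                  ≤⟨ *-monoˡ-≤ (length ys) p ⟩
    D * cnt xs P? * length ys                              ≡⟨ *-assoc D _ _ ⟩
    D * (cnt xs P? * length ys)                            ≡⟨ cong (D *_) (∑-*ʳ (length ys) xs _) ⟨
    D * ∑ xs (λ x → ind (P? x) * length ys)                ≤⟨ *-monoʳ-≤ D (∑-mono xs bound) ⟩
    D * ∑ xs (λ x → D′ * cnt ys (λ y → R? (x , y)))        ≡⟨ cong (D *_) (∑-*ˡ D′ xs _) ⟩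
    D * (D′ * ∑ xs (λ x → cnt ys (λ y → R? (x , y))))      ≡⟨ cong (λ z → D * (D′ * z)) (∑-⊗ xs ys _) ⟨
    D * (D′ * cnt (xs ⊗ ys) R?)                            ≡⟨ *-assoc D D′ _ ⟨
    D * D′ * cnt (xs ⊗ ys) R?                              ∎)
    where
    open ≤-Reasoning
    bound : ∀ x → ind (P? x) * length ys ≤ D′ * cnt ys (λ y → R? (x , y))
    bound x with P? x
    ... | yes px = ≤-trans (≤-reflexive (*-identityˡ _)) (dense (q x px))
    ... | no _   = z≤n

  dense-pow-0 : {xs : List A} {R : Vec A 0 → Set} {R? : Decidable R} → R [] → Dense 1 (pow 0 xs) R?
  dense-pow-0 {xs = xs} {R? = R?} r = mkDense (≤-reflexive
    (trans (length-pow 0 xs) (sym (trans (*-identityˡ _) (trans (∑-pow-0 xs _) (ind-yes (R? []) r))))))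

  dense-pow-suc : ∀ {D D′ N} {xs : List A} {P? : Decidable P} {R : Vec A (suc N) → Set} {R? : Decidable R} →
                  Dense D xs P? → (∀ x → P x → Dense D′ (pow N xs) (λ w → R? (x ∷ w))) →
                  Dense (D * D′) (pow (suc N) xs) R?
  dense-pow-suc {D = D} {D′} {N} {xs} {P?} {R? = R?} p q = mkDense (begin
    length (pow (suc N) xs)                ≡⟨ length-pow (suc N) xs ⟩
    length xs * length xs ^ N              ≡⟨ cong (length xs *_) (length-pow N xs) ⟨
    length xs * length (pow N xs)          ≡⟨ length-⊗ xs (pow N xs) ⟨
    length (xs ⊗ pow N xs)                 ≤⟨ dense (dense-⊗ {R? = λ (x , w) → R? (x ∷ w)} p q) ⟩
    D * D′ * cnt (xs ⊗ pow N xs) (λ (x , w) → R? (x ∷ w)) ≡⟨ cong (D * D′ *_) (trans (∑-⊗ xs _ _) (sym (∑-pow-suc N xs _))) ⟩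
    D * D′ * cnt (pow (suc N) xs) R?       ∎)
    where open ≤-Reasoning

  -- put lets one coordinate of y vary over ws with the others fixed; avg is the Fubini law it satisfies.
  record Slot (ys : List A) (ws : List B) : Set where
    constructor mkSlot
    field
      put : A → B → A
      avg : ∀ f → length ws * ∑ ys f ≡ ∑ ys (λ y → ∑ ws (λ w → f (put y w)))
  open Slot public

  slot-id : (ws : List A) → Slot ws ws
  slot-id ws = mkSlot (λ _ w → w) (λ f → sym (∑-const (∑ ws f) ws))

  slot-fst : {xs : List A} {ys : List B} {ws : List C} → Slot xs ws → Slot (xs ⊗ ys) ws
  slot-fst {xs = xs} {ys} {ws} sl = mkSlot (λ (x , y) w → put sl x w , y) λ f → begin
    length ws * ∑ (xs ⊗ ys) f                                        ≡⟨ cong (length ws *_) (∑-⊗ xs ys f) ⟩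
    length ws * ∑ xs (λ x → ∑ ys (λ y → f (x , y)))                  ≡⟨ avg sl _ ⟩
    ∑ xs (λ x → ∑ ws (λ w → ∑ ys (λ y → f (put sl x w , y))))        ≡⟨ ∑-cong xs (λ x → ∑-swap ws ys _) ⟩
    ∑ xs (λ x → ∑ ys (λ y → ∑ ws (λ w → f (put sl x w , y))))        ≡⟨ ∑-⊗ xs ys _ ⟨
    ∑ (xs ⊗ ys) (λ (x , y) → ∑ ws (λ w → f (put sl x w , y)))        ∎
    where open ≡-Reasoning

  slot-snd : {xs : List A} {ys : List B} {ws : List C} → Slot ys ws → Slot (xs ⊗ ys) ws
  slot-snd {xs = xs} {ys} {ws} sl = mkSlot (λ (x , y) w → x , put sl y w) λ f → begin
    length ws * ∑ (xs ⊗ ys) f                                        ≡⟨ cong (length ws *_) (∑-⊗ xs ys f) ⟩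
    length ws * ∑ xs (λ x → ∑ ys (λ y → f (x , y)))                  ≡⟨ ∑-*ˡ (length ws) xs _ ⟨
    ∑ xs (λ x → length ws * ∑ ys (λ y → f (x , y)))                  ≡⟨ ∑-cong xs (λ x → avg sl _) ⟩
    ∑ xs (λ x → ∑ ys (λ y → ∑ ws (λ w → f (x , put sl y w))))        ≡⟨ ∑-⊗ xs ys _ ⟨
    ∑ (xs ⊗ ys) (λ (x , y) → ∑ ws (λ w → f (x , put sl y w)))        ∎
    where open ≡-Reasoning

  slot-pair : {xs : List A} {ys : List B} {ws : List C} → Slot xs ys → Slot xs ws → Slot xs (ys ⊗ ws)
  slot-pair {xs = xs} {ys} {ws} p q = mkSlot (λ x (y , w) → put p (put q x w) y) λ f → begin
    length (ys ⊗ ws) * ∑ xs f                                        ≡⟨ cong (_* ∑ xs f) (trans (length-⊗ ys ws) (*-comm (length ys) _)) ⟩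
    length ws * length ys * ∑ xs f                                   ≡⟨ *-assoc (length ws) _ _ ⟩
    length ws * (length ys * ∑ xs f)                                 ≡⟨ cong (length ws *_) (avg p f) ⟩
    length ws * ∑ xs (λ x → ∑ ys (λ y → f (put p x y)))              ≡⟨ avg q _ ⟩
    ∑ xs (λ x → ∑ ws (λ w → ∑ ys (λ y → f (put p (put q x w) y))))   ≡⟨ ∑-cong xs (λ x → ∑-swap ws ys _) ⟩
    ∑ xs (λ x → ∑ ys (λ y → ∑ ws (λ w → f (put p (put q x w) y))))   ≡⟨ ∑-cong xs (λ x → ∑-⊗ ys ws _) ⟨
    ∑ xs (λ x → ∑ (ys ⊗ ws) (λ (y , w) → f (put p (put q x w) y)))   ∎
    where open ≡-Reasoning

  slot-pow : {N : ℕ} {xs : List A} → Fin N → Slot (pow N xs) xs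
  slot-pow {xs = xs} i = mkSlot (λ w x → w VecB.[ i ]≔ x) (law i)
    where
    open ≡-Reasoning
    law : ∀ {N} (i : Fin N) f → length xs * ∑ (pow N xs) f ≡ ∑ (pow N xs) (λ w → ∑ xs (λ x → f (w VecB.[ i ]≔ x)))
    law {suc N} zero f = begin
      length xs * ∑ (pow (suc N) xs) f                                   ≡⟨ ∑-const _ xs ⟨
      ∑ xs (λ _ → ∑ (pow (suc N) xs) f)                                  ≡⟨ ∑-cong xs (λ _ → trans (∑-pow-suc N xs f) (∑-swap xs (pow N xs) _)) ⟩
      ∑ xs (λ _ → ∑ (pow N xs) (λ w → ∑ xs (λ x → f (x ∷ w))))           ≡⟨ ∑-pow-suc N xs _ ⟨
      ∑ (pow (suc N) xs) (λ w → ∑ xs (λ x → f (x ∷ VecB.tail w)))         ≡⟨ ∑-cong (pow (suc N) xs) (λ { (y ∷ w) → refl }) ⟩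
      ∑ (pow (suc N) xs) (λ w → ∑ xs (λ x → f (w VecB.[ zero ]≔ x)))      ∎
    law {suc N} (suc i) f = begin
      length xs * ∑ (pow (suc N) xs) f                                   ≡⟨ cong (length xs *_) (∑-pow-suc N xs f) ⟩
      length xs * ∑ xs (λ y → ∑ (pow N xs) (λ w → f (y ∷ w)))            ≡⟨ ∑-*ˡ (length xs) xs _ ⟨
      ∑ xs (λ y → length xs * ∑ (pow N xs) (λ w → f (y ∷ w)))            ≡⟨ ∑-cong xs (λ y → law i _) ⟩
      ∑ xs (λ y → ∑ (pow N xs) (λ w → ∑ xs (λ x → f (y ∷ w VecB.[ i ]≔ x)))) ≡⟨ ∑-pow-suc N xs _ ⟨
      ∑ (pow (suc N) xs) (λ w → ∑ xs (λ x → f (w VecB.[ suc i ]≔ x)))     ∎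

  -- By the averaging law of the slot it suffices to bound Q when one slot is resampled and the rest
  -- of y is frozen. This turns the colour bound for d free vertices of one edge into a bound over
  -- whole configurations.
  rare-slot : ∀ {s N} {ys : List A} {ws : List B} {Q? : Decidable Q} (sl : Slot ys ws) → 0 < length ws →
              (∀ y → y ∈ ys → Rare s N ws (λ w → Q? (put sl y w))) → Rare s N ys Q?
  rare-slot {s = s} {N} {ys} {ws} {Q?} sl pos q = mkRare (*-cancelˡ-≤ (length ws) {{>-nonZero pos}} (begin
    length ws * (N * cnt ys Q?)                             ≡⟨ e (length ws) N _ ⟩
    N * (length ws * cnt ys Q?)                             ≡⟨ cong (N *_) (avg sl _) ⟩
    N * ∑ ys (λ y → cnt ws (λ w → Q? (put sl y w)))         ≡⟨ ∑-*ˡ N ys _ ⟨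
    ∑ ys (λ y → N * cnt ws (λ w → Q? (put sl y w)))         ≤⟨ ∑-mono-∈ ys (λ y i → rare (q y i)) ⟩
    ∑ ys (λ _ → s * length ws)                              ≡⟨ ∑-const _ ys ⟩
    length ys * (s * length ws)                             ≡⟨ e′ (length ys) s _ ⟩
    length ws * (s * length ys)                             ∎))
    where
    open ≤-Reasoning
    e : ∀ a b c → a * (b * c) ≡ b * (a * c)
    e = solve-∀
    e′ : ∀ a b c → a * (b * c) ≡ c * (b * a)
    e′ = solve-∀

-- Greedy sampling with an exponential potential.

module Greedy where

  open Prelude
  open Counting
  open import Data.List.Membership.Propositional using (find)
  open import Data.List.Membership.Propositional.Properties using (∈-∃++)

  ∈-pick : ∀ {A : Set} {x : A} {xs} → x ∈ xs → ∃ λ ys → xs ↭ x ∷ ys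
  ∈-pick {x = x} i with ∈-∃++ i
  ... | as , bs , refl = as ++ bs , shift x as bs

  -- Bernoulli's inequality (1 + 1/N)^j ≥ 1 + j/N, cleared of denominators.
  bernoulli : ∀ N j → (N + j) * N ^ j ≤ N * suc N ^ j
  bernoulli N zero    = ≤-reflexive (cong (_* 1) (+-identityʳ N))
  bernoulli N (suc j) = begin
    (N + suc j) * (N * N ^ j)        ≤⟨ m≤m+n _ (j * N ^ j) ⟩
    (N + suc j) * (N * N ^ j) + j * N ^ j ≡⟨ e₁ N j (N ^ j) ⟩
    suc N * ((N + j) * N ^ j)        ≤⟨ *-monoʳ-≤ (suc N) (bernoulli N j) ⟩
    suc N * (N * suc N ^ j)          ≡⟨ e₂ N (suc N ^ j) ⟩
    N * (suc N * suc N ^ j)          ∎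
    where
    open ≤-Reasoning
    e₁ : ∀ N j x → (N + suc j) * (N * x) + j * x ≡ suc N * ((N + j) * x)
    e₁ = solve-∀
    e₂ : ∀ N y → suc N * (N * y) ≡ N * (suc N * y)
    e₂ = solve-∀

  twice-power : ∀ N → .{{NonZero N}} → 2 * N ^ N ≤ suc N ^ N
  twice-power N = *-cancelˡ-≤ N (≤-trans (≤-reflexive (e N (N ^ N))) (bernoulli N N))
    where e : ∀ N x → N * (2 * x) ≡ (N + N) * x
          e = solve-∀

  ^-distribʳ-* : ∀ r x y → (x * y) ^ r ≡ x ^ r * y ^ r
  ^-distribʳ-* zero    x y = refl
  ^-distribʳ-* (suc r) x y = trans (cong (x * y *_) (^-distribʳ-* r x y)) (e x y (x ^ r) (y ^ r))
    where e : ∀ a b c e → a * b * (c * e) ≡ a * c * (b * e)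
          e = solve-∀

  double-power : ∀ N → .{{NonZero N}} → ∀ r → 2 ^ r * N ^ (N * r) ≤ suc N ^ (N * r)
  double-power N r = begin
    2 ^ r * N ^ (N * r)      ≡⟨ cong (2 ^ r *_) (^-*-assoc N N r) ⟨
    2 ^ r * (N ^ N) ^ r      ≡⟨ ^-distribʳ-* r 2 (N ^ N) ⟨
    (2 * N ^ N) ^ r          ≤⟨ ^-monoˡ-≤ r (twice-power N) ⟩
    (suc N ^ N) ^ r          ≡⟨ ^-*-assoc (suc N) N r ⟩
    suc N ^ (N * r)          ∎
    where open ≤-Reasoning

  grow : ∀ D Dᵐ Φ′ N Φ Nᵐ l → D * Φ′ ≤ N * Φ → Dᵐ * Φ ≤ Nᵐ * l → D * Dᵐ * Φ′ ≤ N * Nᵐ * l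
  grow D Dᵐ Φ′ N Φ Nᵐ l bd le = begin
    D * Dᵐ * Φ′       ≡⟨ e₁ D Dᵐ Φ′ ⟩
    Dᵐ * (D * Φ′)     ≤⟨ *-monoʳ-≤ Dᵐ bd ⟩
    Dᵐ * (N * Φ)      ≡⟨ e₂ Dᵐ N Φ ⟩
    N * (Dᵐ * Φ)      ≤⟨ *-monoʳ-≤ N le ⟩
    N * (Nᵐ * l)      ≡⟨ *-assoc N Nᵐ l ⟨
    N * Nᵐ * l        ∎
    where
    open ≤-Reasoning
    e₁ : ∀ a b c → a * b * c ≡ b * (a * c)
    e₁ = solve-∀
    e₂ : ∀ a b c → a * (b * c) ≡ b * (a * c)
    e₂ = solve-∀

  module Sampling {X Y : Set} (xs : List X) (ys : List Y)
                  (Good : List Y → X → Y → Set) (Good? : ∀ us x y → Dec (Good us x y)) where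

    -- Every sample served some x when it was added. In the instances below this already makes it
    -- disjoint from the earlier samples, whichever x it serves in the end.
    data Chain : List Y → Set where
      []  : Chain []
      _∷_ : ∀ {us x y} → Good us x y → Chain us → Chain (y ∷ us)

    hits : X → List Y → ℕ
    hits x []       = 0
    hits x (y ∷ us) = ind (Good? us x y) + hits x us

    -- Doubling at a miss replaces halving at a hit and keeps the weight integral; `weight-hits` is
    -- the rescaling by 2 ^ length.
    weight : X → List Y → ℕ
    weight x []       = 1
    weight x (y ∷ us) = (2 ∸ ind (Good? us x y)) * weight x us

    Φ : List Y → ℕ
    Φ us = ∑ xs (λ x → weight x us)

    weight-hits : ∀ x us → weight x us * 2 ^ hits x us ≡ 2 ^ length us
    weight-hits x []       = refl
    weight-hits x (y ∷ us) with Good? us x y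
    ... | yes _ = trans (e (weight x us) (2 ^ hits x us)) (cong (2 *_) (weight-hits x us))
      where e : ∀ w z → 1 * w * (2 * z) ≡ 2 * (w * z)
            e = solve-∀
    ... | no _  = trans (*-assoc 2 (weight x us) _) (cong (2 *_) (weight-hits x us))

    weight>0 : ∀ x us → 0 < weight x us
    weight>0 x []       = s≤s z≤n
    weight>0 x (y ∷ us) with Good? us x y
    ... | yes _ = ≤-trans (weight>0 x us) (m≤m+n _ _)
    ... | no _  = ≤-trans (weight>0 x us) (m≤m+n _ _)

    module Run {D′ : ℕ} (pos : 0 < length ys) where

      private
        D = suc D′
        N = D′ + suc D′

      -- An average y serves 1/D of the total weight, so some y serves weight H ≥ Φ/D. The new
      -- potential is 2Φ - H, at most (2D - 1)/D times the old one, and N is 2D - 1.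
      step : ∀ us → 0 < length xs → (∀ x → x ∈ xs → Dense D ys (Good? us x)) →
             ∃ λ y → (∃ λ x → Good us x y) × D * Φ (y ∷ us) ≤ N * Φ us
      step us xpos dn with ∑-average ys (λ y → D * H y) (length ys * Φ us) pos total
        where
        H : Y → ℕ
        H y = ∑ xs (λ x → ind (Good? us x y) * weight x us)
        open ≤-Reasoning
        total : length ys * Φ us ≤ ∑ ys (λ y → D * H y)
        total = begin
          length ys * Φ us                                                    ≡⟨ ∑-*ˡ (length ys) xs _ ⟨
          ∑ xs (λ x → length ys * weight x us)                                ≤⟨ ∑-mono-∈ xs (λ x i → *-monoˡ-≤ (weight x us) (dense (dn x i))) ⟩
          ∑ xs (λ x → D * cnt ys (Good? us x) * weight x us)                  ≡⟨ ∑-cong xs (λ x → trans (*-assoc D (cnt ys (Good? us x)) (weight x us)) (cong (D *_) (sym (∑-*ʳ (weight x us) ys (λ y → ind (Good? us x y)))))) ⟩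
          ∑ xs (λ x → D * ∑ ys (λ y → ind (Good? us x y) * weight x us))      ≡⟨ ∑-*ˡ D xs _ ⟩
          D * ∑ xs (λ x → ∑ ys (λ y → ind (Good? us x y) * weight x us))      ≡⟨ cong (D *_) (∑-swap xs ys _) ⟩
          D * ∑ ys H                                                          ≡⟨ ∑-*ˡ D ys H ⟨
          ∑ ys (λ y → D * H y)                                                ∎
      ... | y , _ , big = y , found , bound
        where
        open ≤-Reasoning
        H : ℕ
        H = ∑ xs (λ x → ind (Good? us x y) * weight x us)
        Φ≤DH : Φ us ≤ D * H
        Φ≤DH = *-cancelˡ-≤ (length ys) {{>-nonZero pos}} big
        Φ>0 : 0 < Φ us
        Φ>0 = begin
          1                  ≤⟨ xpos ⟩
          length xs          ≡⟨ trans (∑-const 1 xs) (*-identityʳ _) ⟨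
          ∑ xs (λ _ → 1)     ≤⟨ ∑-mono xs (λ x → weight>0 x us) ⟩
          Φ us               ∎
        search : ∀ zs → 0 < ∑ zs (λ x → ind (Good? us x y) * weight x us) → ∃ λ x → Good us x y
        search (z ∷ zs) p with Good? us z y
        ... | yes g = z , g
        ... | no _  = search zs p
        found : ∃ λ x → Good us x y
        found = search xs (n≢0⇒n>0 λ e → <⇒≱ Φ>0 (≤-trans Φ≤DH (≤-reflexive (trans (cong (D *_) e) (*-zeroʳ D)))))
        two : ∀ {Z : Set} (g : Dec Z) w → (2 ∸ ind g) * w + ind g * w ≡ 2 * w
        two (yes _) w = e w
          where e : ∀ w → 1 * w + 1 * w ≡ 2 * w
                e = solve-∀
        two (no _) w = +-identityʳ _
        balance : Φ (y ∷ us) + H ≡ 2 * Φ us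
        balance = trans (sym (∑-+ xs _ _)) (trans (∑-cong xs (λ x → two (Good? us x y) (weight x us))) (∑-*ˡ 2 xs _))
        bound : D * Φ (y ∷ us) ≤ N * Φ us
        bound = +-cancelʳ-≤ (Φ us) _ _ (begin
          D * Φ (y ∷ us) + Φ us        ≤⟨ +-monoʳ-≤ _ Φ≤DH ⟩
          D * Φ (y ∷ us) + D * H       ≡⟨ *-distribˡ-+ D _ H ⟨
          D * (Φ (y ∷ us) + H)         ≡⟨ cong (D *_) balance ⟩
          D * (2 * Φ us)               ≡⟨ e D′ (Φ us) ⟩
          N * Φ us + Φ us              ∎)
          where e : ∀ D′ w → suc D′ * (2 * w) ≡ (D′ + suc D′) * w + w
                e = solve-∀

      iterate : ∀ m → 0 < length xs →
                (∀ us → Chain us → length us < m → ∀ x → x ∈ xs → Dense D ys (Good? us x)) →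
                ∃ λ us → Chain us × length us ≡ m × D ^ m * Φ us ≤ N ^ m * length xs
      iterate zero    xpos dn = [] , [] , refl , ≤-reflexive (cong (λ z → z + 0) (trans (∑-const 1 xs) (*-identityʳ _)))
      iterate (suc m) xpos dn = extend (iterate m xpos (λ us c lt → dn us c (m<n⇒m<1+n lt)))
        where
        Goal : ℕ → Set
        Goal m = ∃ λ us → Chain us × length us ≡ m × D ^ m * Φ us ≤ N ^ m * length xs
        add : ∀ us → Chain us → length us ≡ m → D ^ m * Φ us ≤ N ^ m * length xs →
              (∃ λ y → (∃ λ x → Good us x y) × D * Φ (y ∷ us) ≤ N * Φ us) → Goal (suc m)
        add us c len le (y , (x , g) , bd) = y ∷ us , g ∷ c , cong suc len , grow D (D ^ m) (Φ (y ∷ us)) N (Φ us) (N ^ m) (length xs) bd le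
        extend : Goal m → Goal (suc m)
        extend (us , c , len , le) = add us c len le (step us xpos (dn us c (s≤s (≤-reflexive len))))

      -- After m = N(q + q) steps the potential is below (N/D)^m 2^q, whereas an x with at most q
      -- hits has weight at least 2^(m - q). As 2D = N + 1, this would contradict (1 + 1/N)^m ≥ 2^(q
      -- + q).
      greedy : ∀ q → length xs < 2 ^ q →
               (∀ us → Chain us → length us < N * (q + q) → ∀ x → x ∈ xs → Dense D ys (Good? us x)) →
               ∃ λ us → Chain us × length us ≤ N * (q + q) × (∀ x → x ∈ xs → q < hits x us)
      greedy q small dn with length xs in eq
      ... | zero  = [] , [] , z≤n , λ x i → empty xs eq i
        where empty : ∀ {Z : Set} {z : X} zs → length zs ≡ 0 → z ∈ zs → Z
              empty (_ ∷ _) () _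
      ... | suc l with iterate (N * (q + q)) (subst (0 <_) (sym eq) (s≤s z≤n)) dn
      ...   | us , c , len , le = us , c , ≤-reflexive len , λ x i → ≰⇒> λ few → <-irrefl refl (begin-strict
        suc N ^ m                            ≡⟨ cong (_^ m) (e D′) ⟩
        (D * 2) ^ m                          ≡⟨ ^-distribʳ-* m D 2 ⟩
        D ^ m * 2 ^ m                        ≡⟨ cong (λ z → D ^ m * 2 ^ z) len ⟨
        D ^ m * 2 ^ length us                ≡⟨ cong (D ^ m *_) (weight-hits x us) ⟨
        D ^ m * (weight x us * 2 ^ hits x us) ≤⟨ *-monoʳ-≤ (D ^ m) (*-mono-≤ (∑-∈ (λ x → weight x us) i) (^-monoʳ-≤ 2 few)) ⟩
        D ^ m * (Φ us * 2 ^ q)               ≡⟨ *-assoc (D ^ m) _ _ ⟨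
        D ^ m * Φ us * 2 ^ q                 ≤⟨ *-monoˡ-≤ (2 ^ q) le ⟩
        N ^ m * length xs * 2 ^ q            ≡⟨ cong (λ z → N ^ m * z * 2 ^ q) eq ⟩
        N ^ m * suc l * 2 ^ q                <⟨ *-monoˡ-< (2 ^ q) {{m^n≢0 2 q}} (*-monoʳ-< (N ^ m) {{m^n≢0 N m}} small) ⟩
        N ^ m * 2 ^ q * 2 ^ q                ≡⟨ trans (*-assoc (N ^ m) _ _) (trans (*-comm (N ^ m) _) (cong (_* N ^ m) (sym (^-distribˡ-+-* 2 q q)))) ⟩
        2 ^ (q + q) * N ^ m                  ≤⟨ double-power N (q + q) ⟩
        suc N ^ m                            ∎)
        where
        open ≤-Reasoning
        m = N * (q + q)
        instance
          N≢0 : NonZero N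
          N≢0 = ≢-nonZero λ z → contradiction (m+n≡0⇒n≡0 D′ z) λ ()
        e : ∀ D′ → suc (D′ + suc D′) ≡ suc D′ * 2
        e = solve-∀

    private
      reduce : ∀ {X : Set} {g : Dec X} {m h} → m ≤ ind g + h → ¬ X → m ≤ h
      reduce {g = yes x} p ¬x = contradiction x ¬x
      reduce {g = no _}  p ¬x = p

    -- Serving x shortens the list of demands by one, and losing y lowers a hit count by at most
    -- one, so the invariant survives. If y serves no demand on the list, no hit count on the list
    -- changes.
    choose : ∀ y us (zs : List X) → (∀ x → x ∈ zs → length zs ≤ hits x (y ∷ us)) →
             (∃ λ x → ∃ λ zs′ → zs ↭ x ∷ zs′ × Good us x y × (∀ z → z ∈ zs′ → length zs′ ≤ hits z us))
             ⊎ (∀ x → x ∈ zs → length zs ≤ hits x us)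
    choose y us zs dem = by (any? (λ x → Good? us x y) zs)
      where
      by : Dec (Any (λ x → Good us x y) zs) → _
      by (no ¬a) = inj₂ λ x i → reduce {g = Good? us x y} (dem x i) (λ g → ¬a (lose i g))
      by (yes a) =
        let x , i , g = find a
            zs′ , p   = ∈-pick i
        in inj₁ (x , zs′ , p , g , λ z j → s≤s⁻¹ (≤-trans (≤-reflexive (sym (↭-length p)))
             (≤-trans (dem z (∈-resp-↭ (↭-sym p) (there j))) (+-monoˡ-≤ (hits z us) (ind-≤1 (Good? us z y))))))

    -- Each demand has as many hits as there are demands, so a greedy matching cannot fail. The
    -- unmatched samples are kept in `rest`, since their vertices must still be absorbed.
    assign : ∀ us (zs : List X) → (∀ x → x ∈ zs → length zs ≤ hits x us) →
             ∃ λ ps → ∃ λ rest → zs ↭ map proj₁ ps × us ↭ map proj₂ ps ++ rest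
                      × All (λ p → ∃ λ vs → Good vs (proj₁ p) (proj₂ p)) ps
    assign [] []       dem = [] , [] , ↭-refl , ↭-refl , []
    assign [] (z ∷ zs) dem = contradiction (dem z (here refl)) λ ()
    assign (y ∷ us) zs dem with choose y us zs dem
    ... | inj₁ (x , zs′ , p , g , dem′) with assign us zs′ dem′
    ...   | ps , rest , p₁ , p₂ , ok = (x , y) ∷ ps , rest , ↭-trans p (prep x p₁) , prep y p₂ , (us , g) ∷ ok
    assign (y ∷ us) zs dem | inj₂ dem′ with assign us zs dem′
    ... | ps , rest , p₁ , p₂ , ok = ps , y ∷ rest , p₁ , ↭-trans (prep y p₂) (↭-sym (shift y (map proj₂ ps) rest)) , ok

-- Supersaturation of four-partite relations.

module Blowup where

  open Prelude
  open Counting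
  open import Data.Product using (swap)

  length-∑ : {A : Set} (xs : List A) → length xs ≡ ∑ xs (λ _ → 1)
  length-∑ xs = sym (trans (∑-const 1 xs) (*-identityʳ _))

  dense-reindex : {A B : Set} {xs : List A} {ys : List B} {D : ℕ} {R : B → Set} {R? : Decidable R} (g : A → B) →
                  (∀ f → ∑ xs (f ∘ g) ≡ ∑ ys f) → Dense D xs (λ x → R? (g x)) → Dense D ys R?
  dense-reindex {xs = xs} {ys} {D} {R? = R?} g e (mkDense p) = mkDense (begin
    length ys                        ≡⟨ trans (length-∑ ys) (trans (sym (e _)) (sym (length-∑ xs))) ⟩
    length xs                        ≤⟨ p ⟩
    D * cnt xs (λ x → R? (g x))      ≡⟨ cong (D *_) (e _) ⟩
    D * cnt ys R?                    ∎)
    where open ≤-Reasoning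

  ∑-⊗-swap : {A B : Set} (xs : List A) (ys : List B) (f : B × A → ℕ) → ∑ (xs ⊗ ys) (f ∘ swap) ≡ ∑ (ys ⊗ xs) f
  ∑-⊗-swap xs ys f = trans (∑-⊗ xs ys _) (trans (∑-swap xs ys _) (sym (∑-⊗ ys xs f)))

  ∑-⊗-assoc : {A B C : Set} (xs : List A) (ys : List B) (zs : List C) (f : A × (B × C) → ℕ) →
              ∑ ((xs ⊗ ys) ⊗ zs) (λ ((x , y) , z) → f (x , y , z)) ≡ ∑ (xs ⊗ (ys ⊗ zs)) f
  ∑-⊗-assoc xs ys zs f = trans (∑-⊗ (xs ⊗ ys) zs _) (trans (∑-⊗ xs ys _)
    (trans (∑-cong xs (λ x → sym (∑-⊗ ys zs _))) (sym (∑-⊗ xs (ys ⊗ zs) f))))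

  dense-assoc : {A B C : Set} (xs : List A) (ys : List B) (zs : List C) {D : ℕ} {R : A × (B × C) → Set} {R? : Decidable R} →
                Dense D ((xs ⊗ ys) ⊗ zs) (λ ((x , y) , z) → R? (x , y , z)) → Dense D (xs ⊗ (ys ⊗ zs)) R?
  dense-assoc xs ys zs {R? = R?} p = dense-reindex {xs = (xs ⊗ ys) ⊗ zs} {R? = R?} _ (∑-⊗-assoc xs ys zs) p

  ⊗-nonempty : {A B : Set} {xs : List A} {ys : List B} → 0 < length xs → 0 < length ys → 0 < length (xs ⊗ ys)
  ⊗-nonempty {xs = xs} {ys} p q rewrite length-⊗ xs ys = *-mono-≤ p q

  -- Unpopular x account for less than 1/2D of all pairs, so popular ones must account for the other
  -- 1/2D, and each contributes at most its full fibre.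
  popular : {A B : Set} {xs : List A} {ys : List B} {D : ℕ} {R : A × B → Set} {R? : Decidable R} → 0 < length ys →
            Dense D (xs ⊗ ys) R? → Dense (2 * D) xs (λ x → dense? (2 * D) ys (λ y → R? (x , y)))
  popular {xs = xs} {ys} {D} {R? = R?} pos (mkDense p) = mkDense (*-cancelʳ-≤ _ _ (length ys) {{>-nonZero pos}}
    (+-cancelˡ-≤ (length xs * length ys) _ _ (begin
      length xs * length ys + length xs * length ys     ≡⟨ e₁ (length xs * length ys) ⟩
      2 * (length xs * length ys)                       ≡⟨ cong (2 *_) (length-⊗ xs ys) ⟨
      2 * length (xs ⊗ ys)                              ≤⟨ *-monoʳ-≤ 2 p ⟩
      2 * (D * cnt (xs ⊗ ys) R?)                        ≡⟨ trans (sym (*-assoc 2 D _)) (cong (2 * D *_) (∑-⊗ xs ys _)) ⟩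
      2 * D * ∑ xs c                                    ≡⟨ ∑-*ˡ (2 * D) xs c ⟨
      ∑ xs (λ x → 2 * D * c x)                          ≤⟨ ∑-mono xs bound ⟩
      ∑ xs (λ x → length ys + 2 * D * length ys * ind (pop? x)) ≡⟨ ∑-+ xs _ _ ⟩
      ∑ xs (λ _ → length ys) + ∑ xs (λ x → 2 * D * length ys * ind (pop? x))
        ≡⟨ cong₂ _+_ (∑-const _ xs) (∑-*ˡ (2 * D * length ys) xs _) ⟩
      length xs * length ys + 2 * D * length ys * cnt xs pop?  ≡⟨ cong (length xs * length ys +_) (e₂ (2 * D) (length ys) _) ⟩
      length xs * length ys + 2 * D * cnt xs pop? * length ys  ∎)))
    where
    open ≤-Reasoning
    c = λ x → cnt ys (λ y → R? (x , y))
    pop? = λ x → dense? (2 * D) ys (λ y → R? (x , y))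
    e₁ : ∀ a → a + a ≡ 2 * a
    e₁ = solve-∀
    e₂ : ∀ a b c → a * b * c ≡ a * c * b
    e₂ = solve-∀
    bound : ∀ x → 2 * D * c x ≤ length ys + 2 * D * length ys * ind (pop? x)
    bound x with length ys ≤? 2 * D * c x
    ... | yes _ = ≤-trans (*-monoʳ-≤ (2 * D) (cnt≤length ys _)) (≤-trans (≤-reflexive (sym (*-identityʳ _))) (m≤n+m _ (length ys)))
    ... | no ¬p = ≤-trans (<⇒≤ (≰⇒> ¬p)) (m≤m+n _ _)

  dense-pow-all : {A : Set} {xs : List A} {D : ℕ} {Q : A → Set} {Q? : Decidable Q} (N : ℕ) →
                  Dense D xs Q? → Dense (D ^ N) (pow N xs) (VAllB.all? Q?)
  dense-pow-all         zero    q = dense-pow-0 []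
  dense-pow-all {Q? = Q?} (suc N) q = dense-pow-suc {R? = VAllB.all? Q?} q λ x qx →
    dense-mono {Q? = λ w → VAllB.all? Q? (x ∷ w)} (λ w _ qs → qx ∷ qs) (dense-pow-all N q)

  VAll-lookup : {A : Set} {P : A → Set} {N : ℕ} {w : Vec A N} → VAll P w → ∀ i → P (lookup w i)
  VAll-lookup (p ∷ ps) zero    = p
  VAll-lookup (p ∷ ps) (suc i) = VAll-lookup ps i

  blowD : ℕ → ℕ → ℕ
  blowD N D = 2 * D * (2 * D) ^ N

  -- For a proportion 1/2D of the y, a random x is related to y with probability 1/2D, and N
  -- independent ones with probability (1/2D)^N. The treated factor moves to the back, so that four
  -- rounds treat all four factors.
  blow : {A B : Set} {xs : List A} {ys : List B} {D : ℕ} {R : A × B → Set} {R? : Decidable R} (N : ℕ) → 0 < length xs →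
         Dense D (xs ⊗ ys) R? → Dense (blowD N D) (ys ⊗ pow N xs) (λ (y , w) → VAllB.all? (λ x → R? (x , y)) w)
  blow {xs = xs} {ys} {D} {R? = R?} N pos p =
    dense-⊗ {R? = λ (y , w) → VAllB.all? (λ x → R? (x , y)) w}
      (popular pos (dense-reindex {R? = λ (y , x) → R? (x , y)} swap (∑-⊗-swap xs ys) p))
      (λ y q → dense-pow-all N q)

  -- The counting form of Erdős's theorem on complete four-partite subhypergraphs, with repeated
  -- entries allowed in each part.
  blowup₄ : {A B C E : Set} {as : List A} {bs : List B} {cs : List C} {es : List E} {D : ℕ}
            {R : A × (B × (C × E)) → Set} {R? : Decidable R} (i j k l : ℕ) →
            0 < length as → 0 < length bs → 0 < length cs → 0 < length es →
            {T : ((Vec A i × Vec B j) × Vec C k) × Vec E l → Set} {T? : Decidable T} →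
            (∀ xs ys zs ws → (∀ p q r s → R (lookup xs p , lookup ys q , lookup zs r , lookup ws s)) → T (((xs , ys) , zs) , ws)) →
            Dense D (as ⊗ (bs ⊗ (cs ⊗ es))) R? →
            Dense (blowD l (blowD k (blowD j (blowD i D)))) (((pow i as ⊗ pow j bs) ⊗ pow k cs) ⊗ pow l es) T?
  blowup₄ {as = as} {bs} {cs} {es} {R? = R?} i j k l pa pb pc pe {T? = T?} f p₀ =
    dense-mono (λ (((xs , ys) , zs) , ws) _ a → f xs ys zs ws λ p q r s →
      VAll-lookup (VAll-lookup (VAll-lookup (VAll-lookup a s) r) q) p) p₄
    where
    p₁ = dense-assoc bs (cs ⊗ es) (pow i as)
           {R? = λ (b , ((c , e) , xs)) → VAllB.all? (λ a → R? (a , b , c , e)) xs} (blow i pa p₀)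
    p₂ = dense-assoc cs es (pow i as ⊗ pow j bs)
           {R? = λ (c , (e , (xs , ys))) → VAllB.all? (λ b → VAllB.all? (λ a → R? (a , b , c , e)) xs) ys}
           (dense-assoc (cs ⊗ es) (pow i as) (pow j bs)
             {R? = λ ((c , e) , (xs , ys)) → VAllB.all? (λ b → VAllB.all? (λ a → R? (a , b , c , e)) xs) ys} (blow j pb p₁))
    p₃ = dense-assoc es (pow i as ⊗ pow j bs) (pow k cs)
           {R? = λ (e , ((xs , ys) , zs)) → VAllB.all? (λ c → VAllB.all? (λ b → VAllB.all? (λ a → R? (a , b , c , e)) xs) ys) zs}
           (blow k pc p₂)
    p₄ = blow l pe p₃

  dense-pigeonhole : {A I : Set} {xs : List A} {D : ℕ} {P : A → Set} {P? : Decidable P} (is : List I)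
                     {Q : I → A → Set} (Q? : ∀ i → Decidable (Q i)) → 0 < length is →
                     (∀ x → x ∈ xs → P x → Any (λ i → Q i x) is) → Dense D xs P? →
                     ∃ λ i → i ∈ is × Dense (D * length is) xs (Q? i)
  dense-pigeonhole {xs = xs} {D} {P? = P?} is Q? pos f (mkDense p) =
    let i , i∈ , q = ∑-average is (λ i → cnt xs (Q? i)) (cnt xs P?) pos total
    in i , i∈ , mkDense (≤-trans p (≤-trans (*-monoʳ-≤ D q) (≤-reflexive (sym (*-assoc D _ _)))))
    where
    hit : ∀ x js → Any (λ i → _) js → 1 ≤ ∑ js (λ i → ind (Q? i x))
    hit x (j ∷ js) (here q)  = ≤-trans (≤-reflexive (sym (ind-yes (Q? j x) q))) (m≤m+n _ _)
    hit x (j ∷ js) (there q) = ≤-trans (hit x js q) (m≤n+m _ _)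
    bound : ∀ x → x ∈ xs → ind (P? x) ≤ ∑ is (λ i → ind (Q? i x))
    bound x m with P? x
    ... | yes px = hit x is (f x m px)
    ... | no _   = z≤n
    total : cnt xs P? ≤ ∑ is (λ i → cnt xs (Q? i))
    total = ≤-trans (∑-mono-∈ xs bound) (≤-reflexive (∑-swap xs is _))

-- Repetition-free lists avoiding a forbidden list.

module Freshness where

  open Prelude
  open Counting
  import Data.List.Relation.Binary.Permutation.Setoid.Properties as PermS
  import Data.List.Membership.DecPropositional as DecMem

  Unique-resp-↭ : {A : Set} {xs ys : List A} → xs ↭ ys → Unique xs → Unique ys
  Unique-resp-↭ {A} p = PermS.Unique-resp-↭ (setoid A) (↭⇒↭ₛ p)

  unique-++⁻ˡ : {A : Set} (xs : List A) {ys : List A} → Unique (xs ++ ys) → Unique xs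
  unique-++⁻ˡ []       u       = []
  unique-++⁻ˡ (x ∷ xs) (a ∷ u) = AllP.++⁻ˡ xs a ∷ unique-++⁻ˡ xs u

  unique-++⁻ʳ : {A : Set} (xs : List A) {ys : List A} → Unique (xs ++ ys) → Unique ys
  unique-++⁻ʳ []       u       = u
  unique-++⁻ʳ (x ∷ xs) (a ∷ u) = unique-++⁻ʳ xs u

  unique-++-disjoint : {A : Set} (xs : List A) {ys : List A} {v : A} → Unique (xs ++ ys) → v ∈ xs → v ∉ ys
  unique-++-disjoint (x ∷ xs) (a ∷ u) (here refl) j = AllB.lookup (AllP.++⁻ʳ xs a) j refl
  unique-++-disjoint (x ∷ xs) (a ∷ u) (there i)   j = unique-++-disjoint xs u i j

  module _ {n : ℕ} where

    private V = Fin n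

    open DecMem (FinB._≟_ {n}) using (_∈?_) public

    unique? : (xs : List V) → Dec (Unique xs)
    unique? = AllPairs.allPairs? (λ x y → ¬? (x FinB.≟ y))

    Fresh : List V → List V → Set
    Fresh F xs = Unique xs × All (_∉ F) xs

    fresh? : ∀ F xs → Dec (Fresh F xs)
    fresh? F xs = unique? xs ×-dec AllB.all? (λ v → ¬? (v ∈? F)) xs

    fresh-[] : ∀ {F} → Fresh F []
    fresh-[] = [] , []

    fresh-++ : ∀ {F xs ys} → Fresh F xs → Fresh (xs ++ F) ys → Fresh F (xs ++ ys)
    fresh-++ {F} {xs} (u , p) (w , q) =
      UniqueP.++⁺ u w (λ { (i , j) → AllB.lookup q j (∈-++⁺ˡ i) }) ,
      AllP.++⁺ p (AllB.map (λ ∉ i → ∉ (∈-++⁺ʳ xs i)) q)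

    fresh-∷ : ∀ {F v ys} → v ∉ F → Fresh (v ∷ F) ys → Fresh F (v ∷ ys)
    fresh-∷ v∉ f = fresh-++ {xs = _ ∷ []} ([] ∷ [] , v∉ ∷ []) f

    fresh-⊆ : ∀ {F F′ xs} → (∀ {v} → v ∈ F′ → v ∈ F) → Fresh F xs → Fresh F′ xs
    fresh-⊆ sub (u , p) = u , AllB.map (λ ∉ i → ∉ (sub i)) p

    fresh-resp : ∀ {F xs ys} → xs ↭ ys → Fresh F xs → Fresh F ys
    fresh-resp p (u , a) = Unique-resp-↭ p u , All-resp-↭ p a

    fresh-unique : ∀ {F xs} → Unique F → Fresh F xs → Unique (xs ++ F)
    fresh-unique uF (u , p) = UniqueP.++⁺ u uF (λ (i , j) → AllB.lookup p i j)

    fresh-disjoint : ∀ {F xs v} → Fresh F xs → v ∈ xs → v ∉ F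
    fresh-disjoint (_ , p) i = AllB.lookup p i

    cnt-∈ : ∀ (F : List V) {us : List V} → Unique us → cnt us (_∈? F) ≤ length F
    cnt-∈ F {us} uu = ≤-trans (∑-mono us (λ v → bound v F)) (≤-trans (≤-reflexive (∑-swap us F _))
      (≤-trans (∑-mono F (λ f → once f uu)) (≤-reflexive (trans (∑-const 1 F) (*-identityʳ _)))))
      where
      bound : ∀ v F → ind (v ∈? F) ≤ ∑ F (λ f → ind (v FinB.≟ f))
      bound v F with v ∈? F
      ... | no _  = z≤n
      ... | yes i = ≤-trans (≤-reflexive (sym (ind-yes (v FinB.≟ v) refl))) (∑-∈ (λ f → ind (v FinB.≟ f)) i)
      zeroes : ∀ f {us} → All (f ≢_) us → ∑ us (λ v → ind (v FinB.≟ f)) ≡ 0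
      zeroes f []       = refl
      zeroes f {u ∷ us} (p ∷ ps) rewrite ind-no (u FinB.≟ f) (p ∘ sym) = zeroes f ps
      once : ∀ f {us} → Unique us → ∑ us (λ v → ind (v FinB.≟ f)) ≤ 1
      once f []      = z≤n
      once f {u ∷ us} (p ∷ uu) with u FinB.≟ f
      ... | yes refl = s≤s (≤-reflexive (zeroes f p))
      ... | no _     = once f uu

-- Hypergraphs, blocks, runs, and the basic densities.

module Graph where

  open Prelude
  open Counting
  import Algebra.Solver.CommutativeMonoid
  open Blowup using (length-∑)
  open Freshness
  open import Data.List.Properties using (length-tabulate)
  open import Data.List.Relation.Binary.Permutation.Propositional.Properties using (++-commutativeMonoid)

  rare-reindex : {A B : Set} {xs : List A} {ys : List B} {s N : ℕ} {P : A → Set} {P? : Decidable P} {R : B → Set} {R? : Decidable R}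
                 (g : A → B) → (∀ f → ∑ xs (f ∘ g) ≡ ∑ ys f) → (∀ x → P x → R (g x)) → Rare s N ys R? → Rare s N xs P?
  rare-reindex {xs = xs} {ys} {s} {N} {P? = P?} {R? = R?} g e f (mkRare p) = mkRare (begin
    N * cnt xs P?                    ≤⟨ *-monoʳ-≤ N (∑-mono xs (λ x → ind-mono (P? x) (R? (g x)) (f x))) ⟩
    N * ∑ xs (λ x → ind (R? (g x)))  ≡⟨ cong (N *_) (e _) ⟩
    N * cnt ys R?                    ≤⟨ p ⟩
    s * length ys                    ≡⟨ cong (s *_) (trans (length-∑ ys) (trans (sym (e _)) (sym (length-∑ xs)))) ⟩
    s * length xs                    ∎)
    where open ≤-Reasoning

  length-allFin : ∀ n → length (allFin n) ≡ n
  length-allFin n = length-tabulate (λ i → i)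

  -- The parameters encode 1 ≤ ℓ and 2ℓ < k: ℓ = a + 1 and h = k - 2ℓ = b + 1. `D₀` doubles the 2d
  -- of the degree condition to leave room for forbidden vertices. Each vertex of a gadget costs one
  -- factor `D₀`, and the leading 2 pays for the colour conflicts.
  module Sizes (a b : ℕ) where
    ℓ h d k D₀ : ℕ
    ℓ = suc a
    h = suc b
    d = ℓ + h
    k = ℓ + d
    D₀ = 2 * (2 * d)

    connSize connD : ℕ
    connSize = ℓ + (h + (ℓ + (h + h)))
    connD    = 2 * (D₀ ^ ℓ * (D₀ ^ h * (D₀ ^ ℓ * (D₀ ^ h * D₀ ^ h))))

    exSize exD mainSize mainD : ℕ
    exSize   = ℓ + (a + (b + (1 + (1 + (b + ℓ)))))
    exD      = 2 * (D₀ ^ ℓ * (D₀ ^ a * (D₀ ^ b * (D₀ * (D₀ * (D₀ ^ b * D₀ ^ ℓ))))))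
    mainSize = ℓ + (ℓ + (h + (ℓ + (h + (ℓ + h)))))
    mainD    = 2 * (D₀ ^ ℓ * (D₀ ^ ℓ * (D₀ ^ h * (D₀ ^ ℓ * (D₀ ^ h * (D₀ ^ ℓ * D₀ ^ h))))))

    linkSize absSize absD : ℕ
    linkSize = exSize + connSize
    absSize  = mainSize + (d * linkSize + connSize)
    absD     = mainD * ((exD * connD) ^ d * connD)

  -- The edges of a hypergraph, seen as the repetition-free lists enumerating them.
  record System (n : ℕ) : Set₁ where
    field
      E        : List (Fin n) → Set
      E?       : ∀ xs → Dec (E xs)
      E-unique : ∀ {xs} → E xs → Unique xs
      E-resp   : ∀ {xs ys} → xs ↭ ys → E xs → E ys
      col      : List (Fin n) → ℕ
      col-resp : ∀ {xs ys} → xs ↭ ys → col xs ≡ col ys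

  module Graphs (a b : ℕ) {n : ℕ} (S : System n) where

    open Sizes a b public
    open System S public

    V : Set
    V = Fin n

    Mono : ℕ → List V → Set
    Mono i xs = E xs × col xs ≡ i

    Mono? : ∀ i xs → Dec (Mono i xs)
    Mono? i xs = E? xs ×-dec (col xs ≟ i)

    Mono-resp : ∀ {i xs ys} → xs ↭ ys → Mono i xs → Mono i ys
    Mono-resp p (e , c) = E-resp p e , trans (sym (col-resp p)) c

    module Perm = Algebra.Solver.CommutativeMonoid (++-commutativeMonoid {A = V})

    tup : ∀ r → List (Vec V r)
    tup r = pow r (allFin n)

    length-tup : ∀ r → length (tup r) ≡ n ^ r
    length-tup r = trans (length-pow r (allFin n)) (cong (_^ r) (length-allFin n))

    tup-nonempty : ∀ r → 0 < n → 0 < length (tup r)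
    tup-nonempty r pos = pow-nonempty r (subst (0 <_) (sym (length-allFin n)) pos)

    ∈-tup : ∀ {r} (w : Vec V r) → w ∈ tup r
    ∈-tup w = ∈-pow⁺ (λ i → ∈-allFin _)

    Degrees : Set
    Degrees = ∀ L → Unique L → length L ≡ a + d → Dense (2 * d) (allFin n) (λ v → E? (v ∷ L))

    -- The bound on Δ_ℓ of a colour class as a probability: given ℓ vertices, d random ones complete
    -- an edge of colour i with probability at most 1/C.
    Sparse : ℕ → Set
    Sparse C = ∀ i (s : Vec V ℓ) → Rare 1 C (tup d) (λ w → Mono? i (toList s ++ toList w))

    -- In the block (S , M), S is the overlap with the next edge; its own edge is S ∪ M with the overlap S′ of the previous block.
    Block : Set
    Block = Vec V ℓ × Vec V h

    site : Block → Vec V ℓ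
    site = proj₁

    ed : Block → Vec V ℓ → List V
    ed (s , m) p = toList p ++ toList s ++ toList m

    -- What the next block has to know: nothing (it only sets the first overlap), the overlap, or
    -- also the last edge and thereby its colour. Gadgets start from `at`, so the colour of their
    -- first edge is compared only when they are attached to a path.
    data St : Set where
      none : St
      at   : Vec V ℓ → St
      on   : Block → Vec V ℓ → St

    OK : St → Block → Set
    OK none     b = ⊤
    OK (at s)   b = E (ed b s)
    OK (on c p) b = E (ed b (site c)) × col (ed b (site c)) ≢ col (ed c p)

    step : St → Block → St
    step none     b = at (site b)
    step (at s)   b = on b s
    step (on c p) b = on b (site c)

    OK? : ∀ st b → Dec (OK st b)
    OK? none     b = yes tt
    OK? (at s)   b = E? (ed b s)
    OK? (on c p) b = E? (ed b (site c)) ×-dec ¬? (col (ed b (site c)) ≟ col (ed c p))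

    Run : St → List Block → Set
    Run st []       = ⊤
    Run st (b ∷ bs) = OK st b × Run (step st b) bs

    Run? : ∀ st bs → Dec (Run st bs)
    Run? st []       = yes tt
    Run? st (b ∷ bs) = OK? st b ×-dec Run? (step st b) bs

    end : St → List Block → St
    end st []       = st
    end st (b ∷ bs) = end (step st b) bs

    run-++⁺ : ∀ {st} xs {ys} → Run st xs → Run (end st xs) ys → Run st (xs ++ ys)
    run-++⁺ []       _       q = q
    run-++⁺ (x ∷ xs) (o , p) q = o , run-++⁺ xs p q

    run-++⁻ʳ : ∀ {st} xs {ys} → Run st (xs ++ ys) → Run (end st xs) ys
    run-++⁻ʳ []       q       = q
    run-++⁻ʳ (x ∷ xs) (o , p) = run-++⁻ʳ xs p

    run-++⁻ˡ : ∀ {st} xs {ys} → Run st (xs ++ ys) → Run st xs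
    run-++⁻ˡ []       q       = tt
    run-++⁻ˡ (x ∷ xs) (o , p) = o , run-++⁻ˡ xs p

    end-++ : ∀ {st} xs {ys} → end st (xs ++ ys) ≡ end (end st xs) ys
    end-++ []       = refl
    end-++ (x ∷ xs) = end-++ xs

    run-at : ∀ {c p} bs → Run (on c p) bs → Run (at (site c)) bs
    run-at []       r             = tt
    run-at (b ∷ bs) ((e , _) , r) = e , r

    -- Forgetting the incoming state only drops conditions; this allows a path to be cut anywhere.
    run-none : ∀ st bs → Run st bs → Run none bs
    run-none st       []       r       = tt
    run-none none     (b ∷ bs) r       = r
    run-none (at s)   (b ∷ bs) (_ , r) = tt , run-at bs r
    run-none (on c p) (b ∷ bs) (_ , r) = tt , run-at bs r

    bverts : Block → List V
    bverts (s , m) = toList s ++ toList m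

    verts : List Block → List V
    verts []       = []
    verts (b ∷ bs) = bverts b ++ verts bs

    verts-++ : ∀ xs ys → verts (xs ++ ys) ≡ verts xs ++ verts ys
    verts-++ []       ys = refl
    verts-++ (x ∷ xs) ys = trans (cong (bverts x ++_) (verts-++ xs ys)) (sym (++-assoc (bverts x) _ _))

    length-++-toList : ∀ {r t} (u : Vec V r) (w : Vec V t) → length (toList u ++ toList w) ≡ r + t
    length-++-toList u w = trans (length-++ (toList u)) (cong₂ _+_ (length-toList u) (length-toList w))

    length-bverts : ∀ b → length (bverts b) ≡ d
    length-bverts (s , m) = length-++-toList s m

    length-verts : ∀ bs → length (verts bs) ≡ length bs * d
    length-verts []       = refl
    length-verts (b ∷ bs) = trans (length-++ (bverts b)) (cong₂ _+_ (length-bverts b) (length-verts bs))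

    -- While F and the m vertices still to come number at most n/D₀, they block at most half of the
    -- n/2d vertices that the degree condition offers.
    record Room (m : ℕ) (F : List V) : Set where
      constructor mkRoom
      field room : D₀ * (m + length F) ≤ n

    room-≤ : ∀ {m m′ F} → m′ ≤ m → Room m F → Room m′ F
    room-≤ {F = F} le (mkRoom r) = mkRoom (≤-trans (*-monoʳ-≤ D₀ (+-monoˡ-≤ (length F) le)) r)

    room-++ : ∀ {r m F} (w : Vec V r) → Room (r + m) F → Room m (toList w ++ F)
    room-++ {r} {m} {F} w (mkRoom p) = mkRoom (≤-trans (≤-reflexive (cong (D₀ *_)
      (trans (cong (m +_) (trans (length-++ (toList w)) (cong (_+ length F) (length-toList w)))) (e m r (length F))))) p)
      where e : ∀ m r f → m + (r + f) ≡ r + m + f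
            e = solve-∀

    room-0 : ∀ {m F} → Room m F → D₀ * length F ≤ n
    room-0 {m} {F} (mkRoom r) = ≤-trans (*-monoʳ-≤ D₀ (m≤n+m (length F) m)) r

    rare-∈ : ∀ N F → N * length F ≤ n → Rare 1 N (allFin n) (_∈? F)
    rare-∈ N F le = mkRare (≤-trans (*-monoʳ-≤ N (cnt-∈ F (UniqueP.allFin⁺ n)))
      (≤-trans le (≤-reflexive (sym (trans (*-identityˡ _) (length-allFin n))))))

    free-vertex : ∀ F → D₀ * length F ≤ n → Dense D₀ (allFin n) (λ v → ¬? (v ∈? F))
    free-vertex F le = dense-≤ 2≤D₀ (dense-diff {D = 1} {s = 1} {N = 2} {Q? = _∈? F} {R? = λ v → ¬? (v ∈? F)}
        ≤-refl (λ v _ ∉ → ∉) (mkDense {P? = λ _ → yes tt} (≤-reflexive (trans (length-∑ (allFin n)) (sym (*-identityˡ _)))))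
        (rare-∈ 2 F (≤-trans (*-monoˡ-≤ (length F) 2≤D₀) le)) (s≤s z≤n))
      where
      2≤D₀ : 2 ≤ D₀
      2≤D₀ = *-monoʳ-≤ 2 (s≤s {0} z≤n)

    free : ∀ r F → Room r F → Dense (D₀ ^ r) (tup r) (λ w → fresh? F (toList w))
    free zero    F room = dense-pow-0 fresh-[]
    free (suc r) F room = dense-pow-suc (free-vertex F (room-0 room)) λ v v∉ →
      dense-mono (λ w _ f → fresh-∷ v∉ f) (free r (v ∷ F) (room-++ (v ∷ []) room))

    module _ (deg : Degrees) where

      close-vertex : ∀ L F → Unique L → suc (length L) ≡ k → D₀ * length F ≤ n →
                     Dense D₀ (allFin n) (λ v → E? (v ∷ L) ×-dec ¬? (v ∈? F))
      close-vertex L F u len le = dense-diff {D = 2 * d} {s = 1} {N = D₀} {Q? = _∈? F}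
        (≤-reflexive (*-identityʳ D₀)) (λ v e ∉ → e , ∉) (deg L u (suc-injective len)) (rare-∈ D₀ F le) (s≤s z≤n)

      -- All vertices but the last are arbitrary free ones; the degree condition supplies the last.
      close : ∀ r L F → Unique L → (∀ {v} → v ∈ L → v ∈ F) → suc r + length L ≡ k → Room (suc r) F →
              Dense (D₀ ^ suc r) (tup (suc r)) (λ w → E? (toList w ++ L) ×-dec fresh? F (toList w))
      close zero L F u sub len room = dense-pow-suc (close-vertex L F u len (room-0 room))
        λ v (e , v∉) → dense-pow-0 (e , fresh-∷ v∉ fresh-[])
      close (suc r) L F u sub len room = dense-pow-suc (free-vertex F (room-0 room)) λ v v∉ →
        dense-mono (λ w _ (e , f) → E-resp (shift v (toList w) L) e , fresh-∷ v∉ f)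
          (close r (v ∷ L) (v ∷ F) (AllB.tabulate (λ { i refl → v∉ (sub i) }) ∷ u)
            (λ { (here refl) → here refl ; (there i) → there (sub i) })
            (trans (cong suc (+-suc r (length L))) len) (room-++ (v ∷ []) room))

    sparse-pair : ∀ {C} → Sparse C → ∀ i (s : Vec V ℓ) {r t} → r + t ≡ d → (xs : Vec V r × Vec V t → List V) →
                  (∀ u w → xs (u , w) ↭ toList s ++ (toList u ++ toList w)) →
                  Rare 1 C (tup r ⊗ tup t) (λ p → Mono? i (xs p))
    sparse-pair {C} sp i s {r} {t} eq xs perm = rare-reindex {ys = tup (r + t)} (λ (u , w) → u VecB.++ w)
      (λ f → trans (∑-⊗ (tup r) (tup t) _) (sym (∑-pow-+ r t (allFin n) f)))
      (λ (u , w) → Mono-resp (↭-trans (perm u w) (↭-reflexive (cong (toList s ++_) (sym (toList-++ u w))))))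
      (subst (λ x → Rare 1 C (tup x) (λ w → Mono? i (toList s ++ toList w))) (sym eq) (sp i s))

    sparse-triple : ∀ {C} → Sparse C → ∀ i (s : Vec V ℓ) (xs : V × (Vec V b × Vec V ℓ) → List V) →
                    (∀ v m w → xs (v , m , w) ↭ toList s ++ ((v ∷ toList m) ++ toList w)) →
                    Rare 1 C (allFin n ⊗ (tup b ⊗ tup ℓ)) (λ p → Mono? i (xs p))
    sparse-triple sp i s xs perm = rare-reindex {ys = tup h ⊗ tup ℓ} (λ (v , m , w) → v ∷ m , w)
      (λ f → trans (∑-⊗ (allFin n) (tup b ⊗ tup ℓ) _) (trans (∑-cong (allFin n) (λ v → ∑-⊗ (tup b) (tup ℓ) _))
         (sym (trans (∑-⊗ (tup h) (tup ℓ) f) (∑-pow-suc b (allFin n) _)))))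
      (λ (v , m , w) → Mono-resp (perm v m w))
      (sparse-pair sp i s (+-comm h ℓ) (λ (u , w) → toList s ++ (toList u ++ toList w)) (λ _ _ → ↭-refl))

-- Connectors between two ends.

module Connector where

  open Prelude
  open Counting
  open Blowup using (⊗-nonempty)
  open Freshness
  open Graph

  module Connect (a b : ℕ) {n : ℕ} (S : System n) where

    open Graphs a b S
    open Perm using (_⊕_; _⊜_) renaming (solve to permute)

    ConnV : Set
    ConnV = Vec V ℓ × Vec V h × Vec V ℓ × Vec V h × Vec V h

    conns : List ConnV
    conns = tup ℓ ⊗ (tup h ⊗ (tup ℓ ⊗ (tup h ⊗ tup h)))

    connBlocks : Vec V ℓ → ConnV → List Block
    connBlocks s′ (T₁ , M₁ , T₂ , M₂ , M₃) = (T₁ , M₁) ∷ (T₂ , M₂) ∷ (s′ , M₃) ∷ []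

    connVerts : ConnV → List V
    connVerts (T₁ , M₁ , T₂ , M₂ , M₃) = toList T₁ ++ toList M₁ ++ toList T₂ ++ toList M₂ ++ toList M₃

    lastEdge : Vec V ℓ → ConnV → List V
    lastEdge s′ (T₁ , M₁ , T₂ , M₂ , M₃) = ed (s′ , M₃) T₂

    -- The last edge avoids two colours because the path behind a connector may begin in two ways,
    -- before and after an absorption. In the reservoir both colours coincide.
    ConnOK : Block → Vec V ℓ → Vec V ℓ → ℕ → ℕ → List V → ConnV → Set
    ConnOK c p s′ i j F y = Run (on c p) (connBlocks s′ y) × (col (lastEdge s′ y) ≢ i × col (lastEdge s′ y) ≢ j) × Fresh F (connVerts y)

    ConnOK? : ∀ c p s′ i j F → Decidable (ConnOK c p s′ i j F)
    ConnOK? c p s′ i j F y = Run? (on c p) (connBlocks s′ y) ×-dec ((¬? (_ ≟ _) ×-dec ¬? (_ ≟ _)) ×-dec fresh? _ _)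

    unique-++ : ∀ {F xs ys : List V} → Unique ys → (∀ {v} → v ∈ ys → v ∈ F) → Fresh F xs → Unique (xs ++ ys)
    unique-++ u sub f = fresh-unique u (fresh-⊆ sub f)

    sub-++ : ∀ {xs ys F : List V} → (∀ {v} → v ∈ ys → v ∈ F) → ∀ {v} → v ∈ xs ++ ys → v ∈ xs ++ F
    sub-++ {xs} {ys} sub i = [ ∈-++⁺ˡ , (λ j → ∈-++⁺ʳ xs (sub j)) ]′ (∈-++⁻ xs i)

    module _ (pos : 0 < n) (deg : Degrees) {C : ℕ} (sp : Sparse C) where

      -- Each comparison leaves d vertices to resample: T₁, M₁ for the first edge against the
      -- previous one, T₂, M₂ for the middle against the first, T₁, M₂ for the middle against the
      -- last, T₂, M₃ for the last against i and against j. These are the five events in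
      -- `5 * connD ≤ C`. With only two edges, the second would contain both `s′` and the overlap
      -- with the first, and only h of its vertices would be free.
      conn-dense : ∀ c p s′ i j F → 5 * connD ≤ C →
                   Unique (toList (site c)) → (∀ {v} → v ∈ toList (site c) → v ∈ F) →
                   Unique (toList s′) → (∀ {v} → v ∈ toList s′ → v ∈ F) → Room connSize F →
                   Dense connD conns (ConnOK? c p s′ i j F)
      conn-dense c p s′ i j F bigC us sub us′ sub′ room =
        dense-diff {P? = plain?} {Q? = bad?} {R? = ConnOK? c p s′ i j F}
          (≤-trans (≤-reflexive (*-comm connD 5)) bigC) good plain-dense bad-rare (s≤s z≤n)
        where
        s = site c

        e₁ e₂ e₃ : ConnV → List V
        e₁ (T₁ , M₁ , T₂ , M₂ , M₃) = ed (T₁ , M₁) s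
        e₂ (T₁ , M₁ , T₂ , M₂ , M₃) = ed (T₂ , M₂) T₁
        e₃ = lastEdge s′

        Plain : ConnV → Set
        Plain y = E (e₁ y) × E (e₂ y) × E (e₃ y) × Fresh F (connVerts y)

        plain? : Decidable Plain
        plain? y = E? _ ×-dec (E? _ ×-dec (E? _ ×-dec fresh? _ _))

        Bad : ConnV → Set
        Bad y = Mono (col (ed c p)) (e₁ y) ⊎ (Mono (col (e₁ y)) (e₂ y) ⊎ (Mono (col (e₃ y)) (e₂ y) ⊎ (Mono i (e₃ y) ⊎ Mono j (e₃ y))))

        bad? : Decidable Bad
        bad? y = Mono? _ _ ⊎-dec (Mono? _ _ ⊎-dec (Mono? _ _ ⊎-dec (Mono? _ _ ⊎-dec Mono? _ _)))

        plain-dense : Dense (D₀ ^ ℓ * (D₀ ^ h * (D₀ ^ ℓ * (D₀ ^ h * D₀ ^ h)))) conns plain?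
        plain-dense =
          dense-⊗ (free ℓ F (room-≤ (m≤m+n ℓ _) room)) λ T₁ f₁ →
          let r₁ = room-++ T₁ room in
          dense-⊗ (close deg b (toList T₁ ++ toList s) (toList T₁ ++ F) (unique-++ us sub f₁) (sub-++ {toList T₁} sub)
            (trans (cong (h +_) (length-++-toList T₁ s)) (l₁ h ℓ)) (room-≤ (m≤m+n h _) r₁)) λ M₁ (E₁ , f₂) →
          let r₂ = room-++ M₁ r₁ in
          dense-⊗ (free ℓ (toList M₁ ++ toList T₁ ++ F) (room-≤ (m≤m+n ℓ _) r₂)) λ T₂ f₃ →
          let r₃ = room-++ T₂ r₂ in
          dense-⊗ (close deg b (toList T₂ ++ toList T₁) (toList T₂ ++ toList M₁ ++ toList T₁ ++ F)
            (unique-++ (proj₁ f₁) (λ i → ∈-++⁺ʳ (toList M₁) (∈-++⁺ˡ i)) f₃)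
            (sub-++ {toList T₂} (λ i → ∈-++⁺ʳ (toList M₁) (∈-++⁺ˡ i)))
            (trans (cong (h +_) (length-++-toList T₂ T₁)) (l₁ h ℓ)) (room-≤ (m≤m+n h _) r₃)) λ M₂ (E₂ , f₄) →
          let r₄ = room-++ M₂ r₃ in
          dense-mono (λ M₃ _ (E₃ , f₅) →
              E-resp (permute 3 (λ x y z → x ⊕ (y ⊕ z) ⊜ z ⊕ (y ⊕ x)) ↭-refl (toList M₁) (toList T₁) (toList s)) E₁
            , E-resp (permute 3 (λ x y z → x ⊕ (y ⊕ z) ⊜ z ⊕ (y ⊕ x)) ↭-refl (toList M₂) (toList T₂) (toList T₁)) E₂
            , E-resp (permute 3 (λ x y z → x ⊕ (y ⊕ z) ⊜ y ⊕ (z ⊕ x)) ↭-refl (toList M₃) (toList T₂) (toList s′)) E₃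
            , fresh-++ f₁ (fresh-++ f₂ (fresh-++ f₃ (fresh-++ f₄ f₅))))
            (close deg b (toList T₂ ++ toList s′) (toList M₂ ++ toList T₂ ++ toList M₁ ++ toList T₁ ++ F)
              (unique-++ us′ (λ i → ∈-++⁺ʳ (toList M₁) (∈-++⁺ʳ (toList T₁) (sub′ i))) f₃)
              (λ i → ∈-++⁺ʳ (toList M₂) (sub-++ {toList T₂} (λ i → ∈-++⁺ʳ (toList M₁) (∈-++⁺ʳ (toList T₁) (sub′ i))) i))
              (trans (cong (h +_) (length-++-toList T₂ s′)) (l₁ h ℓ)) r₄)
          where
          l₁ : ∀ h ℓ → h + (ℓ + ℓ) ≡ ℓ + (ℓ + h)
          l₁ = solve-∀

        pair-pos : 0 < length (tup ℓ ⊗ tup h)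
        pair-pos = ⊗-nonempty (tup-nonempty ℓ pos) (tup-nonempty h pos)

        slotT₁ : Slot conns (tup ℓ)
        slotT₁ = slot-fst (slot-id _)
        slotM₁ : Slot conns (tup h)
        slotM₁ = slot-snd (slot-fst (slot-id _))
        slotT₂ : Slot conns (tup ℓ)
        slotT₂ = slot-snd (slot-snd (slot-fst (slot-id _)))
        slotM₂ : Slot conns (tup h)
        slotM₂ = slot-snd (slot-snd (slot-snd (slot-fst (slot-id _))))
        slotM₃ : Slot conns (tup h)
        slotM₃ = slot-snd (slot-snd (slot-snd (slot-snd (slot-id _))))

        last-rare : ∀ i → Rare 1 C conns (λ y → Mono? i (e₃ y))
        last-rare i = rare-slot (slot-pair slotT₂ slotM₃) pair-pos λ y _ →
          sparse-pair sp i s′ refl _ λ u w → permute 3 (λ x y z → x ⊕ (y ⊕ z) ⊜ y ⊕ (x ⊕ z)) ↭-refl (toList u) (toList s′) (toList w)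

        bad-rare : Rare 5 C conns bad?
        bad-rare = rare-⊎ {Q? = λ y → Mono? (col (e₁ y)) (e₂ y) ⊎-dec (Mono? (col (e₃ y)) (e₂ y) ⊎-dec (Mono? i (e₃ y) ⊎-dec Mono? j (e₃ y)))} {R? = bad?} (λ _ z → z)
          (rare-slot {Q? = λ y → Mono? (col (ed c p)) (e₁ y)} (slot-pair slotT₁ slotM₁) pair-pos λ y _ →
            sparse-pair sp (col (ed c p)) s refl _ λ u w → ↭-refl)
          (rare-⊎ {Q? = λ y → Mono? (col (e₃ y)) (e₂ y) ⊎-dec (Mono? i (e₃ y) ⊎-dec Mono? j (e₃ y))} (λ _ z → z)
            (rare-slot {Q? = λ y → Mono? (col (e₁ y)) (e₂ y)} (slot-pair slotT₂ slotM₂) pair-pos λ (T₁ , M₁ , T₂ , M₂ , M₃) _ →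
              sparse-pair sp (col (ed (T₁ , M₁) s)) T₁ refl _ λ u w → ↭-refl)
            (rare-⊎ {Q? = λ y → Mono? i (e₃ y) ⊎-dec Mono? j (e₃ y)} (λ _ z → z)
              (rare-slot {Q? = λ y → Mono? (col (e₃ y)) (e₂ y)} (slot-pair slotT₁ slotM₂) pair-pos λ (T₁ , M₁ , T₂ , M₂ , M₃) _ →
                sparse-pair sp (col (ed (s′ , M₃) T₂)) T₂ refl _ λ u w →
                  permute 3 (λ x y z → x ⊕ (y ⊕ z) ⊜ y ⊕ (x ⊕ z)) ↭-refl (toList u) (toList T₂) (toList w))
              (rare-⊎ (λ _ z → z) (last-rare i) (last-rare j))))

        good : ∀ y → Plain y → ¬ Bad y → ConnOK c p s′ i j F y
        good y (E₁ , E₂ , E₃ , f) ¬bad =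
          ((E₁ , λ q → ¬bad (inj₁ (E₁ , q))) ,
           (E₂ , λ q → ¬bad (inj₂ (inj₁ (E₂ , q)))) ,
           (E₃ , λ q → ¬bad (inj₂ (inj₂ (inj₁ (E₂ , sym q))))) , tt) ,
          ((λ q → ¬bad (inj₂ (inj₂ (inj₂ (inj₁ (E₃ , q)))))) , (λ q → ¬bad (inj₂ (inj₂ (inj₂ (inj₂ (E₃ , q))))))) ,
          f

-- Exchange gadgets and the insertion of a block.

module Gadgets where

  open Prelude
  open Counting
  open Blowup using (⊗-nonempty)
  open Freshness
  open Graph
  open Connector

  module Gadget (a b : ℕ) {n : ℕ} (S : System n) where

    open Graphs a b S
    open Connect a b S
    open Perm using (_⊕_; _⊜_) renaming (solve to permute)

    ExV : Set
    ExV = Vec V ℓ × Vec V a × Vec V b × V × V × Vec V b × Vec V ℓ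

    exs : List ExV
    exs = tup ℓ ⊗ (tup a ⊗ (tup b ⊗ (allFin n ⊗ (allFin n ⊗ (tup b ⊗ tup ℓ)))))

    exVerts : ExV → List V
    exVerts (S′ , T , m , α′ , β , m′ , Sₙ) = toList S′ ++ toList T ++ toList m ++ α′ ∷ β ∷ toList m′ ++ toList Sₙ

    -- exBefore uses α and exAfter uses x, on the same remaining vertices; their second edges are the same set.
    exBefore exAfter : V → ExV → List Block
    exBefore α (S′ , T , m , α′ , β , m′ , Sₙ) = (β ∷ T , α ∷ m) ∷ (Sₙ , α′ ∷ m′) ∷ []
    exAfter  x (S′ , T , m , α′ , β , m′ , Sₙ) = (α′ ∷ T , x ∷ m) ∷ (Sₙ , β ∷ m′) ∷ []

    exSite : ExV → Vec V ℓ
    exSite = proj₁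

    firstB firstA secondB secondA : V → ExV → List V
    firstB  α (S′ , T , m , α′ , β , m′ , Sₙ) = ed (β ∷ T , α ∷ m) S′
    firstA  x (S′ , T , m , α′ , β , m′ , Sₙ) = ed (α′ ∷ T , x ∷ m) S′
    secondB α (S′ , T , m , α′ , β , m′ , Sₙ) = ed (Sₙ , α′ ∷ m′) (β ∷ T)
    secondA x (S′ , T , m , α′ , β , m′ , Sₙ) = ed (Sₙ , β ∷ m′) (α′ ∷ T)

    ExOK : V → V → List V → ExV → Set
    ExOK x α F y = Run (at (exSite y)) (exBefore α y) × Run (at (exSite y)) (exAfter x y) × Fresh F (exVerts y)

    ExOK? : ∀ x α F → Decidable (ExOK x α F)
    ExOK? x α F y = Run? (at (exSite y)) (exBefore α y) ×-dec (Run? (at (exSite y)) (exAfter x y) ×-dec fresh? _ _)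

    -- Equal sets have equal colours, so the path behind the gadget cannot tell which version was
    -- used.
    second-↭ : ∀ α x y → secondB α y ↭ secondA x y
    second-↭ α x (S′ , T , m , α′ , β , m′ , Sₙ) =
      permute 5 (λ p q r s t → (p ⊕ q) ⊕ (r ⊕ (s ⊕ t)) ⊜ (s ⊕ q) ⊕ (r ⊕ (p ⊕ t))) ↭-refl (β ∷ []) (toList T) (toList Sₙ) (α′ ∷ []) (toList m′)

    MainV : Set
    MainV = Vec V ℓ × Vec V ℓ × Vec V h × Vec V ℓ × Vec V h × Vec V ℓ × Vec V h

    mains : List MainV
    mains = tup ℓ ⊗ (tup ℓ ⊗ (tup h ⊗ (tup ℓ ⊗ (tup h ⊗ (tup ℓ ⊗ tup h)))))

    mainVerts : MainV → List V
    mainVerts (S₀ , S₁ , M₀ , t′ , t″ , Sᵤ , Mᵤ) =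
      toList S₀ ++ toList S₁ ++ toList M₀ ++ toList t′ ++ toList t″ ++ toList Sᵤ ++ toList Mᵤ

    -- The block t = (t′ , t″) is absent from mainBefore and inserted in mainAfter.
    mainBefore mainAfter : MainV → List Block
    mainBefore (S₀ , S₁ , M₀ , t′ , t″ , Sᵤ , Mᵤ) = (S₁ , M₀) ∷ (Sᵤ , Mᵤ) ∷ []
    mainAfter  (S₀ , S₁ , M₀ , t′ , t″ , Sᵤ , Mᵤ) = (t′ , t″) ∷ (S₁ , M₀) ∷ (Sᵤ , Mᵤ) ∷ []

    mainSite : MainV → Vec V ℓ
    mainSite = proj₁

    mainBlock : MainV → Block
    mainBlock (S₀ , S₁ , M₀ , t′ , t″ , Sᵤ , Mᵤ) = t′ , t″

    MainOK : List V → MainV → Set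
    MainOK F y = Run (at (mainSite y)) (mainBefore y) × Run (at (mainSite y)) (mainAfter y) × Fresh F (mainVerts y)

    MainOK? : ∀ F → Decidable (MainOK F)
    MainOK? F y = Run? (at (mainSite y)) (mainBefore y) ×-dec (Run? (at (mainSite y)) (mainAfter y) ×-dec fresh? _ _)

    module _ (pos : 0 < n) (deg : Degrees) {C : ℕ} (sp : Sparse C) where

      private
        pos′ : 0 < length (allFin n)
        pos′ = subst (0 <_) (sym (length-allFin n)) pos

      -- On the common vertices S′, T and m, α′ completes the first edge containing x and β the one
      -- containing α; interchanging α′ and β then preserves the second edge. `firstB` does not
      -- contain α′ and `firstA` does not contain β, so resampling that vertex with m′ and Sₙ leaves
      -- the first edge and its colour alone.
      ex-dense : ∀ x α F → 2 * exD ≤ C → x ∈ F → α ∈ F → Room exSize F → Dense exD exs (ExOK? x α F)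
      ex-dense x α F bigC x∈ α∈ room =
        dense-diff {P? = plain?} {Q? = bad?} {R? = ExOK? x α F}
          (≤-trans (≤-reflexive (*-comm exD 2)) bigC) good plain-dense bad-rare (s≤s z≤n)
        where
        Plain : ExV → Set
        Plain y = E (firstB α y) × E (firstA x y) × E (secondB α y) × Fresh F (exVerts y)
        plain? : Decidable Plain
        plain? y = E? _ ×-dec (E? _ ×-dec (E? _ ×-dec fresh? _ _))

        Bad : ExV → Set
        Bad y = Mono (col (firstB α y)) (secondB α y) ⊎ Mono (col (firstA x y)) (secondA x y)
        bad? : Decidable Bad
        bad? y = Mono? _ _ ⊎-dec Mono? _ _

        good : ∀ y → Plain y → ¬ Bad y → ExOK x α F y
        good y (E₁ , E₂ , E₃ , f) ¬bad =
          (E₁ , (E₃ , λ q → ¬bad (inj₁ (E₃ , q))) , tt) ,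
          (E₂ , (E₃′ , λ q → ¬bad (inj₂ (E₃′ , q))) , tt) , f
          where E₃′ = E-resp (second-↭ α x y) E₃

        plain-dense : Dense (D₀ ^ ℓ * (D₀ ^ a * (D₀ ^ b * (D₀ * (D₀ * (D₀ ^ b * D₀ ^ ℓ)))))) exs plain?
        plain-dense =
          dense-⊗ (free ℓ F (room-≤ (m≤m+n ℓ _) room)) λ S′ f₁ →
          let r₁ = room-++ S′ room ; F₁ = toList S′ ++ F in
          dense-⊗ (free a F₁ (room-≤ (m≤m+n a _) r₁)) λ T f₂ →
          let r₂ = room-++ T r₁ ; F₂ = toList T ++ F₁ in
          dense-⊗ (free b F₂ (room-≤ (m≤m+n b _) r₂)) λ m f₃ →
          let r₃ = room-++ m r₂ ; F₃ = toList m ++ F₂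
              L = λ z → toList m ++ toList T ++ toList S′ ++ z ∷ []
              sub₁ : ∀ {z v} → z ∈ F → v ∈ toList S′ ++ z ∷ [] → v ∈ F₁
              sub₁ = λ {z} z∈ → sub-++ {toList S′} {z ∷ []} (λ { (here refl) → z∈ })
              sub₂ : ∀ {z v} → z ∈ F → v ∈ toList T ++ toList S′ ++ z ∷ [] → v ∈ F₂
              sub₂ = λ {z} z∈ → sub-++ {toList T} {toList S′ ++ z ∷ []} (sub₁ z∈)
              uL : ∀ z → z ∈ F → Unique (L z)
              uL = λ z z∈ → unique-++ (unique-++ (unique-++ ([] ∷ []) (λ { (here refl) → z∈ }) f₁) (sub₁ z∈) f₂) (sub₂ z∈) f₃
              lenL : ∀ z → suc (length (L z)) ≡ k
              lenL = λ z → trans (cong suc (trans (length-++ (toList m)) (cong₂ _+_ (length-toList m)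
                (trans (length-++ (toList T)) (cong₂ _+_ (length-toList T)
                  (trans (length-++ (toList S′)) (cong (_+ 1) (length-toList S′)))))))) (l₁ a b)
          in
          dense-⊗ (close-vertex deg (L x) F₃ (uL x x∈) (lenL x) (room-0 r₃)) λ α′ (E₁ , f₄) →
          let r₄ = room-++ (α′ ∷ []) r₃ ; F₄ = α′ ∷ F₃ in
          dense-⊗ (close-vertex deg (L α) F₄ (uL α α∈) (lenL α) (room-0 r₄)) λ β (E₂ , f₅) →
          let r₅ = room-++ (β ∷ []) r₄ ; F₅ = β ∷ F₄
              subT : ∀ {v} → v ∈ toList T → v ∈ F₃
              subT = λ i → ∈-++⁺ʳ (toList m) (∈-++⁺ˡ i)
              sub₃ : ∀ {v} → v ∈ α′ ∷ toList T → v ∈ F₄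
              sub₃ = sub-++ {α′ ∷ []} subT
              sub₄ : ∀ {v} → v ∈ β ∷ α′ ∷ toList T → v ∈ F₅
              sub₄ = sub-++ {β ∷ []} sub₃
              u₁ : Unique (β ∷ α′ ∷ toList T)
              u₁ = unique-++ (unique-++ (proj₁ f₂) subT (fresh-∷ f₄ fresh-[])) sub₃ (fresh-∷ f₅ fresh-[])
          in
          dense-⊗ (free b F₅ (room-≤ (m≤m+n b _) r₅)) λ m′ f₆ →
          dense-mono (λ Sₙ _ (E₃ , f₇) →
              E-resp (permute 5 (λ p q r s t → p ⊕ (q ⊕ (r ⊕ (s ⊕ t))) ⊜ s ⊕ ((p ⊕ r) ⊕ (t ⊕ q))) ↭-refl
                (β ∷ []) (toList m) (toList T) (toList S′) (α ∷ [])) E₂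
            , E-resp (permute 5 (λ p q r s t → p ⊕ (q ⊕ (r ⊕ (s ⊕ t))) ⊜ s ⊕ ((p ⊕ r) ⊕ (t ⊕ q))) ↭-refl
                (α′ ∷ []) (toList m) (toList T) (toList S′) (x ∷ [])) E₁
            , E-resp (permute 5 (λ p q r s t → p ⊕ (q ⊕ (r ⊕ (s ⊕ t))) ⊜ (r ⊕ t) ⊕ (p ⊕ (s ⊕ q))) ↭-refl
                (toList Sₙ) (toList m′) (β ∷ []) (α′ ∷ []) (toList T)) E₃
            , fresh-++ f₁ (fresh-++ f₂ (fresh-++ f₃ (fresh-∷ f₄ (fresh-∷ f₅ (fresh-++ f₆ f₇))))))
            (close deg a (toList m′ ++ β ∷ α′ ∷ toList T) (toList m′ ++ F₅)
              (unique-++ u₁ sub₄ f₆) (sub-++ {toList m′} sub₄)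
              (trans (cong (ℓ +_) (trans (length-++ (toList m′)) (cong₂ _+_ (length-toList m′) (cong (2 +_) (length-toList T))))) (l₂ a b))
              (room-++ m′ r₅))
          where
          l₁ : ∀ a b → suc (b + (a + (suc a + 1))) ≡ suc a + (suc a + suc b)
          l₁ = solve-∀
          l₂ : ∀ a b → suc a + (b + (2 + a)) ≡ suc a + (suc a + suc b)
          l₂ = solve-∀

        slotα′ : Slot exs (allFin n)
        slotα′ = slot-snd (slot-snd (slot-snd (slot-fst (slot-id _))))
        slotβ : Slot exs (allFin n)
        slotβ = slot-snd (slot-snd (slot-snd (slot-snd (slot-fst (slot-id _)))))
        slotm′ : Slot exs (tup b)
        slotm′ = slot-snd (slot-snd (slot-snd (slot-snd (slot-snd (slot-fst (slot-id _))))))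
        slotSₙ : Slot exs (tup ℓ)
        slotSₙ = slot-snd (slot-snd (slot-snd (slot-snd (slot-snd (slot-snd (slot-id _))))))

        triple-pos : 0 < length (allFin n ⊗ (tup b ⊗ tup ℓ))
        triple-pos = ⊗-nonempty pos′ (⊗-nonempty (tup-nonempty b pos) (tup-nonempty ℓ pos))

        bad-rare : Rare 2 C exs bad?
        bad-rare = rare-⊎ {P? = λ y → Mono? (col (firstB α y)) (secondB α y)}
          {Q? = λ y → Mono? (col (firstA x y)) (secondA x y)} {R? = bad?} (λ _ z → z)
          (rare-slot (slot-pair slotα′ (slot-pair slotm′ slotSₙ)) triple-pos λ y@(S′ , T , m , α′ , β , m′ , Sₙ) _ →
            sparse-triple sp (col (firstB α y)) (β ∷ T) _ λ v m w →
              permute 4 (λ p q r s → p ⊕ (q ⊕ (r ⊕ s)) ⊜ p ⊕ ((r ⊕ s) ⊕ q)) ↭-refl (β ∷ toList T) (toList w) (v ∷ []) (toList m))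
          (rare-slot (slot-pair slotβ (slot-pair slotm′ slotSₙ)) triple-pos λ y@(S′ , T , m , α′ , β , m′ , Sₙ) _ →
            sparse-triple sp (col (firstA x y)) (α′ ∷ T) _ λ v m w →
              permute 4 (λ p q r s → p ⊕ (q ⊕ (r ⊕ s)) ⊜ p ⊕ ((r ⊕ s) ⊕ q)) ↭-refl (α′ ∷ toList T) (toList w) (v ∷ []) (toList m))

      -- t′ completes an edge with S₁ and M₀, and t″ one with S₀ and t′, so that t fits between S₀
      -- and S₁. The trailing block (Sᵤ , Mᵤ) gives both versions the same last edge, whose colour
      -- must therefore differ from those of `e₀` and of `e₀′`.
      main-dense : ∀ F → 3 * mainD ≤ C → Room mainSize F → Dense mainD mains (MainOK? F)
      main-dense F bigC room =
        dense-diff {P? = plain?} {Q? = bad?} {R? = MainOK? F}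
          (≤-trans (≤-reflexive (*-comm mainD 3)) bigC) good plain-dense bad-rare (s≤s z≤n)
        where
        e₀ e₀′ eₜ eᵤ : MainV → List V
        e₀  (S₀ , S₁ , M₀ , t′ , t″ , Sᵤ , Mᵤ) = ed (S₁ , M₀) S₀
        e₀′ (S₀ , S₁ , M₀ , t′ , t″ , Sᵤ , Mᵤ) = ed (S₁ , M₀) t′
        eₜ  (S₀ , S₁ , M₀ , t′ , t″ , Sᵤ , Mᵤ) = ed (t′ , t″) S₀
        eᵤ  (S₀ , S₁ , M₀ , t′ , t″ , Sᵤ , Mᵤ) = ed (Sᵤ , Mᵤ) S₁

        Plain : MainV → Set
        Plain y = E (e₀ y) × E (e₀′ y) × E (eₜ y) × E (eᵤ y) × Fresh F (mainVerts y)
        plain? : Decidable Plain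
        plain? y = E? _ ×-dec (E? _ ×-dec (E? _ ×-dec (E? _ ×-dec fresh? _ _)))

        Bad : MainV → Set
        Bad y = Mono (col (eₜ y)) (e₀′ y) ⊎ (Mono (col (e₀ y)) (eᵤ y) ⊎ Mono (col (e₀′ y)) (eᵤ y))
        bad? : Decidable Bad
        bad? y = Mono? _ _ ⊎-dec (Mono? _ _ ⊎-dec Mono? _ _)

        good : ∀ y → Plain y → ¬ Bad y → MainOK F y
        good y (E₀ , E₀′ , Eₜ , Eᵤ , f) ¬bad =
          (E₀ , (Eᵤ , λ q → ¬bad (inj₂ (inj₁ (Eᵤ , q)))) , tt) ,
          (Eₜ , (E₀′ , λ q → ¬bad (inj₁ (E₀′ , q))) , (Eᵤ , λ q → ¬bad (inj₂ (inj₂ (Eᵤ , q)))) , tt) , f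

        l₁ : ∀ h ℓ → h + (ℓ + ℓ) ≡ ℓ + (ℓ + h)
        l₁ = solve-∀
        l₂ : ∀ h ℓ → ℓ + (h + ℓ) ≡ ℓ + (ℓ + h)
        l₂ = solve-∀

        plain-dense : Dense (D₀ ^ ℓ * (D₀ ^ ℓ * (D₀ ^ h * (D₀ ^ ℓ * (D₀ ^ h * (D₀ ^ ℓ * D₀ ^ h)))))) mains plain?
        plain-dense =
          dense-⊗ (free ℓ F (room-≤ (m≤m+n ℓ _) room)) λ S₀ f₁ →
          let r₁ = room-++ S₀ room ; F₁ = toList S₀ ++ F in
          dense-⊗ (free ℓ F₁ (room-≤ (m≤m+n ℓ _) r₁)) λ S₁ f₂ →
          let r₂ = room-++ S₁ r₁ ; F₂ = toList S₁ ++ F₁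
              subS₀ : ∀ {v} → v ∈ toList S₀ → v ∈ F₁
              subS₀ = ∈-++⁺ˡ in
          dense-⊗ (close deg b (toList S₁ ++ toList S₀) F₂ (unique-++ (proj₁ f₁) subS₀ f₂) (sub-++ {toList S₁} subS₀)
            (trans (cong (h +_) (length-++-toList S₁ S₀)) (l₁ h ℓ)) (room-≤ (m≤m+n h _) r₂)) λ M₀ (E₀ , f₃) →
          let r₃ = room-++ M₀ r₂ ; F₃ = toList M₀ ++ F₂
              subS₁ : ∀ {v} → v ∈ toList S₁ → v ∈ F₂
              subS₁ = ∈-++⁺ˡ
              subS₁S₀ : ∀ {v} → v ∈ toList S₀ → v ∈ F₃
              subS₁S₀ = λ i → ∈-++⁺ʳ (toList M₀) (∈-++⁺ʳ (toList S₁) (∈-++⁺ˡ i)) in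
          dense-⊗ (close deg a (toList M₀ ++ toList S₁) F₃ (unique-++ (proj₁ f₂) subS₁ f₃) (sub-++ {toList M₀} subS₁)
            (trans (cong (ℓ +_) (length-++-toList M₀ S₁)) (l₂ h ℓ)) (room-≤ (m≤m+n ℓ _) r₃)) λ t′ (E₀′ , f₄) →
          let r₄ = room-++ t′ r₃ ; F₄ = toList t′ ++ F₃ in
          dense-⊗ (close deg b (toList t′ ++ toList S₀) F₄ (unique-++ (proj₁ f₁) subS₁S₀ f₄) (sub-++ {toList t′} subS₁S₀)
            (trans (cong (h +_) (length-++-toList t′ S₀)) (l₁ h ℓ)) (room-≤ (m≤m+n h _) r₄)) λ t″ (Eₜ , f₅) →
          let r₅ = room-++ t″ r₄ ; F₅ = toList t″ ++ F₄ in
          dense-⊗ (free ℓ F₅ (room-≤ (m≤m+n ℓ _) r₅)) λ Sᵤ f₆ →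
          let subS₁′ : ∀ {v} → v ∈ toList S₁ → v ∈ F₅
              subS₁′ = λ i → ∈-++⁺ʳ (toList t″) (∈-++⁺ʳ (toList t′) (∈-++⁺ʳ (toList M₀) (∈-++⁺ˡ i))) in
          dense-mono (λ Mᵤ _ (Eᵤ , f₇) →
              E-resp (permute 3 (λ x y z → x ⊕ (y ⊕ z) ⊜ z ⊕ (y ⊕ x)) ↭-refl (toList M₀) (toList S₁) (toList S₀)) E₀
            , E-resp (permute 3 (λ x y z → x ⊕ (y ⊕ z) ⊜ x ⊕ (z ⊕ y)) ↭-refl (toList t′) (toList M₀) (toList S₁)) E₀′
            , E-resp (permute 3 (λ x y z → x ⊕ (y ⊕ z) ⊜ z ⊕ (y ⊕ x)) ↭-refl (toList t″) (toList t′) (toList S₀)) Eₜ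
            , E-resp (permute 3 (λ x y z → x ⊕ (y ⊕ z) ⊜ z ⊕ (y ⊕ x)) ↭-refl (toList Mᵤ) (toList Sᵤ) (toList S₁)) Eᵤ
            , fresh-++ f₁ (fresh-++ f₂ (fresh-++ f₃ (fresh-++ f₄ (fresh-++ f₅ (fresh-++ f₆ f₇))))))
            (close deg b (toList Sᵤ ++ toList S₁) (toList Sᵤ ++ F₅) (unique-++ (proj₁ f₂) subS₁′ f₆) (sub-++ {toList Sᵤ} subS₁′)
              (trans (cong (h +_) (length-++-toList Sᵤ S₁)) (l₁ h ℓ)) (room-++ Sᵤ r₅))

        slotS₁ : Slot mains (tup ℓ)
        slotS₁ = slot-snd (slot-fst (slot-id _))
        slotM₀ : Slot mains (tup h)
        slotM₀ = slot-snd (slot-snd (slot-fst (slot-id _)))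
        slotSᵤ : Slot mains (tup ℓ)
        slotSᵤ = slot-snd (slot-snd (slot-snd (slot-snd (slot-snd (slot-fst (slot-id _))))))
        slotMᵤ : Slot mains (tup h)
        slotMᵤ = slot-snd (slot-snd (slot-snd (slot-snd (slot-snd (slot-snd (slot-id _))))))

        pair-pos : 0 < length (tup ℓ ⊗ tup h)
        pair-pos = ⊗-nonempty (tup-nonempty ℓ pos) (tup-nonempty h pos)

        bad-rare : Rare 3 C mains bad?
        bad-rare = rare-⊎ {P? = λ y → Mono? (col (eₜ y)) (e₀′ y)}
          {Q? = λ y → Mono? (col (e₀ y)) (eᵤ y) ⊎-dec Mono? (col (e₀′ y)) (eᵤ y)} {R? = bad?} (λ _ z → z)
          (rare-slot (slot-pair slotS₁ slotM₀) pair-pos λ y@(S₀ , S₁ , M₀ , t′ , t″ , Sᵤ , Mᵤ) _ →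
            sparse-pair sp (col (eₜ y)) t′ refl _ λ u w → ↭-refl)
          (rare-⊎ {P? = λ y → Mono? (col (e₀ y)) (eᵤ y)} {Q? = λ y → Mono? (col (e₀′ y)) (eᵤ y)} (λ _ z → z)
            (rare-slot (slot-pair slotSᵤ slotMᵤ) pair-pos λ y@(S₀ , S₁ , M₀ , t′ , t″ , Sᵤ , Mᵤ) _ →
              sparse-pair sp (col (e₀ y)) S₁ refl _ λ u w → ↭-refl)
            (rare-slot (slot-pair slotSᵤ slotMᵤ) pair-pos λ y@(S₀ , S₁ , M₀ , t′ , t″ , Sᵤ , Mᵤ) _ →
              sparse-pair sp (col (e₀′ y)) S₁ refl _ λ u w → ↭-refl))

-- Absorbers for d-tuples.

module Absorber where

  open Prelude
  open Counting
  open Freshness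
  open Graph
  open Connector
  open Gadgets

  module Absorb (a b : ℕ) {n : ℕ} (S : System n) where

    open Graphs a b S
    open Connect a b S
    open Gadget a b S
    open Perm using (_⊕_; _⊜_; id) renaming (solve to permute)

    Anchor : Block → List V → Set
    Anchor c F = Unique (toList (site c)) × (∀ {v} → v ∈ toList (site c) → v ∈ F)

    anchor-⊆ : ∀ {c F F′} → (∀ {v} → v ∈ F → v ∈ F′) → Anchor c F → Anchor c F′
    anchor-⊆ sub (u , s) = u , λ i → sub (s i)

    -- A continuation sees only the site and the last colour. The two versions of an exchange end in
    -- different blocks but agree in these.
    data _≈ₛ_ : St → St → Set where
      same : ∀ {c p c′ p′} → site c ≡ site c′ → col (ed c p) ≡ col (ed c′ p′) → on c p ≈ₛ on c′ p′

    run-≈ : ∀ {st st′} bs → st ≈ₛ st′ → Run st bs → Run st′ bs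
    run-≈ []       eq                       r             = tt
    run-≈ (b ∷ bs) (same {s , m} {p} {s , m′} refl q) ((e , ne) , r) = (e , λ z → ne (trans z (sym q))) , r

    end-≈ : ∀ {st st′} b bs → st ≈ₛ st′ → end st (b ∷ bs) ≡ end st′ (b ∷ bs)
    end-≈ b bs (same {s , m} {p} {s , m′} refl q) = refl

    run-on : ∀ c p b bs → Run (at (site c)) (b ∷ bs) → col (ed c p) ≢ col (ed b (site c)) → Run (on c p) (b ∷ bs)
    run-on c p b bs (e , r) ne = (e , λ q → ne (sym q)) , r

    StartsOff : Vec V ℓ → ℕ → List Block → Set
    StartsOff s i []       = ⊤
    StartsOff s i (b ∷ bs) = i ≢ col (ed b s)

    LinkV : Set
    LinkV = ExV × ConnV

    links : List LinkV
    links = exs ⊗ conns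

    exEnd : ExV → Block × Vec V ℓ
    exEnd (S′ , T , m , α′ , β , m′ , Sₙ) = (Sₙ , α′ ∷ m′) , β ∷ T

    linkBefore : ∀ {r} → Vec V r → Vec LinkV r → List Block
    linkBefore []       []             = []
    linkBefore (α ∷ αs) ((e , c) ∷ ls) = connBlocks (exSite e) c ++ exBefore α e ++ linkBefore αs ls

    linkAfter : ∀ {r} → Vec V r → Vec LinkV r → List Block
    linkAfter []       []             = []
    linkAfter (x ∷ xs) ((e , c) ∷ ls) = connBlocks (exSite e) c ++ exAfter x e ++ linkAfter xs ls

    linkVerts : ∀ {r} → Vec LinkV r → List V
    linkVerts []             = []
    linkVerts ((e , c) ∷ ls) = exVerts e ++ connVerts c ++ linkVerts ls

    linkEnd : ∀ {r} → Block × Vec V ℓ → Vec LinkV r → Block × Vec V ℓ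
    linkEnd q []             = q
    linkEnd q ((e , c) ∷ ls) = linkEnd (exEnd e) ls

    Link₁ : Block × Vec V ℓ → V → V → List V → LinkV → Set
    Link₁ (c , p) x α F (e , cn) =
      ExOK x α F e × ConnOK c p (exSite e) (col (firstB α e)) (col (firstA x e)) (exVerts e ++ F) cn

    Link₁? : ∀ q x α F → Decidable (Link₁ q x α F)
    Link₁? (c , p) x α F (e , cn) =
      ExOK? x α F e ×-dec ConnOK? c p (exSite e) (col (firstB α e)) (col (firstA x e)) (exVerts e ++ F) cn

    LinkOK : ∀ {r} → Block × Vec V ℓ → Vec V r → Vec V r → List V → Vec LinkV r → Set
    LinkOK q []       []       F []             = ⊤
    LinkOK q (x ∷ xs) (α ∷ αs) F ((e , cn) ∷ ls) =
      Link₁ q x α F (e , cn) × LinkOK (exEnd e) xs αs (connVerts cn ++ exVerts e ++ F) ls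

    LinkOK? : ∀ {r} q (xs αs : Vec V r) F → Decidable (LinkOK q xs αs F)
    LinkOK? q []       []       F []              = yes tt
    LinkOK? q (x ∷ xs) (α ∷ αs) F ((e , cn) ∷ ls) =
      Link₁? q x α F (e , cn) ×-dec LinkOK? (exEnd e) xs αs (connVerts cn ++ exVerts e ++ F) ls

    length-exVerts : ∀ e → length (exVerts e) ≡ exSize
    length-exVerts (S′ , T , m , α′ , β , m′ , Sₙ) =
      trans (length-++ (toList S′)) (cong₂ _+_ (length-toList S′)
        (trans (length-++ (toList T)) (cong₂ _+_ (length-toList T)
          (trans (length-++ (toList m)) (cong₂ _+_ (length-toList m) (cong (2 +_) (length-++-toList m′ Sₙ)))))))

    length-connVerts : ∀ c → length (connVerts c) ≡ connSize
    length-connVerts (T₁ , M₁ , T₂ , M₂ , M₃) =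
      trans (length-++ (toList T₁)) (cong₂ _+_ (length-toList T₁)
        (trans (length-++ (toList M₁)) (cong₂ _+_ (length-toList M₁)
          (trans (length-++ (toList T₂)) (cong₂ _+_ (length-toList T₂) (length-++-toList M₂ M₃))))))

    length-mainVerts : ∀ y → length (mainVerts y) ≡ mainSize
    length-mainVerts (S₀ , S₁ , M₀ , t′ , t″ , Sᵤ , Mᵤ) =
      trans (length-++ (toList S₀)) (cong₂ _+_ (length-toList S₀)
        (trans (length-++ (toList S₁)) (cong₂ _+_ (length-toList S₁)
          (trans (length-++ (toList M₀)) (cong₂ _+_ (length-toList M₀)
            (trans (length-++ (toList t′)) (cong₂ _+_ (length-toList t′)
              (trans (length-++ (toList t″)) (cong₂ _+_ (length-toList t″) (length-++-toList Sᵤ Mᵤ))))))))))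

    length-linkVerts : ∀ {r} (ls : Vec LinkV r) → length (linkVerts ls) ≡ r * linkSize
    length-linkVerts []             = refl
    length-linkVerts {suc r} ((e , c) ∷ ls) = trans (length-++ (exVerts e)) (trans (cong₂ _+_ (length-exVerts e)
      (trans (length-++ (connVerts c)) (cong₂ _+_ (length-connVerts c) (length-linkVerts ls)))) (sym (+-assoc exSize connSize (r * linkSize))))

    room-list : ∀ {r m F} (xs : List V) → length xs ≡ r → Room (r + m) F → Room m (xs ++ F)
    room-list {r} {m} {F} xs len (mkRoom p) = mkRoom (≤-trans (≤-reflexive (cong (D₀ *_)
      (trans (cong (m +_) (trans (length-++ xs) (cong (_+ length F) len))) (e m r (length F))))) p)
      where e : ∀ m r f → m + (r + f) ≡ r + m + f
            e = solve-∀

    ex-anchor : ∀ {F} e cn → Unique (exVerts e) → Anchor (proj₁ (exEnd e)) (connVerts cn ++ exVerts e ++ F)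
    ex-anchor (S′ , T , m , α′ , β , m′ , Sₙ) cn u =
      unique-++⁻ʳ (toList m′) (unique-++⁻ʳ (α′ ∷ β ∷ []) (unique-++⁻ʳ (toList m) (unique-++⁻ʳ (toList T) (unique-++⁻ʳ (toList S′) u)))) ,
      λ i → ∈-++⁺ʳ (connVerts cn) (∈-++⁺ˡ (∈-++⁺ʳ (toList S′) (∈-++⁺ʳ (toList T) (∈-++⁺ʳ (toList m)
        (there (there (∈-++⁺ʳ (toList m′) i)))))))

    module _ (pos : 0 < n) (deg : Degrees) {C : ℕ} (sp : Sparse C) (C₁ : 5 * connD ≤ C) (C₂ : 2 * exD ≤ C) (C₃ : 3 * mainD ≤ C) where

      link-dense : ∀ {r} q (xs αs : Vec V r) F → Anchor (proj₁ q) F → (∀ {v} → v ∈ toList xs → v ∈ F) → (∀ {v} → v ∈ toList αs → v ∈ F) →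
                   Room (r * linkSize) F → Dense ((exD * connD) ^ r) (pow r links) (LinkOK? q xs αs F)
      link-dense q []       []       F an sx sα room = dense-pow-0 tt
      link-dense {suc r} (c , p) (x ∷ xs) (α ∷ αs) F (u , sub) sx sα room =
        dense-pow-suc {P? = Link₁? (c , p) x α F}
          (dense-⊗ (ex-dense pos deg sp x α F C₂ (sx (here refl)) (sα (here refl)) (room-≤ (m≤m+n exSize _) room′)) λ e ok →
            let r₁ = room-list (exVerts e) (length-exVerts e) room′ in
            dense-mono (λ cn _ ok′ → ok , ok′)
              (conn-dense pos deg sp c p (exSite e) (col (firstB α e)) (col (firstA x e)) (exVerts e ++ F) C₁ u (λ i → ∈-++⁺ʳ (exVerts e) (sub i))
                (unique-++⁻ˡ (toList (exSite e)) (proj₁ (proj₂ (proj₂ ok)))) (λ i → ∈-++⁺ˡ (∈-++⁺ˡ i)) (room-≤ (m≤m+n connSize _) r₁)))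
          λ (e , cn) (ok , ok′) →
            let sub′ : ∀ {v} → v ∈ F → v ∈ connVerts cn ++ exVerts e ++ F
                sub′ = λ i → ∈-++⁺ʳ (connVerts cn) (∈-++⁺ʳ (exVerts e) i) in
            dense-mono (λ ls _ oks → (ok , ok′) , oks)
              (link-dense (exEnd e) xs αs (connVerts cn ++ exVerts e ++ F) (ex-anchor e cn (proj₁ (proj₂ (proj₂ ok))))
                (λ i → sub′ (sx (there i))) (λ i → sub′ (sα (there i)))
                (room-list (connVerts cn) (length-connVerts cn) (room-list (exVerts e) (length-exVerts e) room′)))
        where
        room′ : Room (exSize + (connSize + r * linkSize)) F
        room′ = room-≤ (≤-reflexive (sym (+-assoc exSize connSize (r * linkSize)))) room

    -- The connectors were chosen for the states of `linkBefore`. The states of `linkAfter` are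
    -- equivalent at every junction, and the connectors avoid both first colours, so the same
    -- connectors run there too.
    link-run : ∀ {r} q (xs αs : Vec V r) F ls {st} → LinkOK q xs αs F ls → uncurry on q ≈ₛ st →
               Run (uncurry on q) (linkBefore αs ls) × Run st (linkAfter xs ls)
               × end (uncurry on q) (linkBefore αs ls) ≡ uncurry on (linkEnd q ls)
               × uncurry on (linkEnd q ls) ≈ₛ end st (linkAfter xs ls)
    link-run q [] [] F [] ok eq = tt , tt , refl , eq
    link-run (c , p) (x ∷ xs) (α ∷ αs) F ((e@(S′ , T , m , α′ , β , m′ , Sₙ) , cn@(T₁ , M₁ , T₂ , M₂ , M₃)) ∷ ls) {st}
             (((rb , ra , fr) , (rc , (ne₁ , ne₂) , fr′)) , ok) eq =
      let ih₁ , ih₂ , ih₃ , ih₄ = link-run (exEnd e) xs αs (connVerts cn ++ exVerts e ++ F) ls {end (at S′) (exAfter x e)} ok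
            (same refl (col-resp (second-↭ α x e)))
          cb = connBlocks S′ cn
          endc : end st cb ≡ end (on c p) cb
          endc = sym (end-≈ (T₁ , M₁) ((T₂ , M₂) ∷ (S′ , M₃) ∷ []) eq)
      in run-++⁺ {on c p} cb {exBefore α e ++ linkBefore αs ls} rc
           (run-++⁺ {on (S′ , M₃) T₂} (exBefore α e) (run-on (S′ , M₃) T₂ (β ∷ T , α ∷ m) ((Sₙ , α′ ∷ m′) ∷ []) rb ne₁) ih₁) ,
         run-++⁺ {st} cb {exAfter x e ++ linkAfter xs ls} (run-≈ cb eq rc) (subst (λ s → Run s (exAfter x e ++ linkAfter xs ls)) (sym endc)
           (run-++⁺ {on (S′ , M₃) T₂} (exAfter x e) (run-on (S′ , M₃) T₂ (α′ ∷ T , x ∷ m) ((Sₙ , β ∷ m′) ∷ []) ra ne₂) ih₂)) ,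
         ih₃ ,
         subst (λ s → uncurry on (linkEnd (exEnd e) ls) ≈ₛ s) (sym (trans (end-++ {st} cb {exAfter x e ++ linkAfter xs ls}) (cong (λ s → end s (exAfter x e ++ linkAfter xs ls)) endc))) ih₄

    link-fresh : ∀ {r} q (xs αs : Vec V r) F ls → LinkOK q xs αs F ls → Fresh F (linkVerts ls)
    link-fresh q [] [] F [] ok = fresh-[]
    link-fresh (c , p) (x ∷ xs) (α ∷ αs) F ((e , cn) ∷ ls) (((_ , _ , f) , (_ , _ , f′)) , ok) =
      fresh-++ f (fresh-++ f′ (link-fresh (exEnd e) xs αs _ ls ok))

    conn-verts : ∀ s′ c → verts (connBlocks s′ c) ↭ toList s′ ++ connVerts c
    conn-verts s′ (T₁ , M₁ , T₂ , M₂ , M₃) =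
      permute 6 (λ s t m t′ m′ m″ → (t ⊕ m) ⊕ ((t′ ⊕ m′) ⊕ ((s ⊕ m″) ⊕ id)) ⊜ s ⊕ (t ⊕ (m ⊕ (t′ ⊕ (m′ ⊕ m″))))) ↭-refl
        (toList s′) (toList T₁) (toList M₁) (toList T₂) (toList M₂) (toList M₃)

    exBefore-verts : ∀ α e → toList (exSite e) ++ verts (exBefore α e) ↭ α ∷ exVerts e
    exBefore-verts α (S′ , T , m , α′ , β , m′ , Sₙ) =
      permute 8 (λ s t m a′ b m′ sₙ a → s ⊕ (((b ⊕ t) ⊕ (a ⊕ m)) ⊕ ((sₙ ⊕ (a′ ⊕ m′)) ⊕ id)) ⊜ a ⊕ (s ⊕ (t ⊕ (m ⊕ (a′ ⊕ (b ⊕ (m′ ⊕ sₙ))))))) ↭-refl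
        (toList S′) (toList T) (toList m) (α′ ∷ []) (β ∷ []) (toList m′) (toList Sₙ) (α ∷ [])

    exAfter-verts : ∀ x e → toList (exSite e) ++ verts (exAfter x e) ↭ x ∷ exVerts e
    exAfter-verts α (S′ , T , m , α′ , β , m′ , Sₙ) =
      permute 8 (λ s t m a′ b m′ sₙ a → s ⊕ (((a′ ⊕ t) ⊕ (a ⊕ m)) ⊕ ((sₙ ⊕ (b ⊕ m′)) ⊕ id)) ⊜ a ⊕ (s ⊕ (t ⊕ (m ⊕ (a′ ⊕ (b ⊕ (m′ ⊕ sₙ))))))) ↭-refl
        (toList S′) (toList T) (toList m) (α′ ∷ []) (β ∷ []) (toList m′) (toList Sₙ) (α ∷ [])

    private
      -- One more link, for either order of its exchange part: bs is its pair of blocks, rest the remaining path.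
      link-verts-step : ∀ e cn x (bs rest : List Block) {R L : List V} → toList (exSite e) ++ verts bs ↭ x ∷ exVerts e → verts rest ↭ R ++ L →
                        verts (connBlocks (exSite e) cn ++ bs ++ rest) ↭ x ∷ (R ++ (exVerts e ++ connVerts cn ++ L))
      link-verts-step e cn x bs rest {R} {L} p q =
        ↭-trans (↭-reflexive (trans (verts-++ (connBlocks (exSite e) cn) (bs ++ rest)) (cong (verts (connBlocks (exSite e) cn) ++_) (verts-++ bs rest))))
        (↭-trans (++⁺ (conn-verts (exSite e) cn) (++⁺ˡ (verts bs) q))
        (↭-trans (permute 5 (λ s c v r l → (s ⊕ c) ⊕ (v ⊕ (r ⊕ l)) ⊜ (s ⊕ v) ⊕ (r ⊕ (c ⊕ l))) ↭-refl (toList (exSite e)) (connVerts cn) (verts bs) R L)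
        (↭-trans (++⁺ʳ (R ++ (connVerts cn ++ L)) p)
        (permute 5 (λ x e r c l → (x ⊕ e) ⊕ (r ⊕ (c ⊕ l)) ⊜ x ⊕ (r ⊕ (e ⊕ (c ⊕ l)))) ↭-refl (x ∷ []) (exVerts e) R (connVerts cn) L))))

    linkBefore-verts : ∀ {r} (αs : Vec V r) ls → verts (linkBefore αs ls) ↭ toList αs ++ linkVerts ls
    linkBefore-verts []       []              = ↭-refl
    linkBefore-verts (α ∷ αs) ((e , cn) ∷ ls) = link-verts-step e cn α (exBefore α e) (linkBefore αs ls) {toList αs} {linkVerts ls} (exBefore-verts α e) (linkBefore-verts αs ls)

    linkAfter-verts : ∀ {r} (xs : Vec V r) ls → verts (linkAfter xs ls) ↭ toList xs ++ linkVerts ls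
    linkAfter-verts []       []              = ↭-refl
    linkAfter-verts (x ∷ xs) ((e , cn) ∷ ls) = link-verts-step e cn x (exAfter x e) (linkAfter xs ls) {toList xs} {linkVerts ls} (exAfter-verts x e) (linkAfter-verts xs ls)

    AbsV : Set
    AbsV = MainV × Vec LinkV d × ConnV

    absorbers : List AbsV
    absorbers = mains ⊗ (pow d links ⊗ conns)

    tuple : MainV → Vec V d
    tuple y = proj₁ (mainBlock y) VecB.++ proj₂ (mainBlock y)

    firstBefore firstAfter : MainV → List V
    firstBefore (S₀ , S₁ , M₀ , t′ , t″ , Sᵤ , Mᵤ) = ed (S₁ , M₀) S₀
    firstAfter  (S₀ , S₁ , M₀ , t′ , t″ , Sᵤ , Mᵤ) = ed (t′ , t″) S₀

    absEnd : AbsV → Block × Vec V ℓ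
    absEnd ((S₀ , S₁ , M₀ , t′ , t″ , Sᵤ , Mᵤ) , _) = (Sᵤ , Mᵤ) , S₁

    absVerts : AbsV → List V
    absVerts (y , ls , cn) = mainVerts y ++ linkVerts ls ++ connVerts cn

    -- Before absorption the exchanges hold the vertices of t. Afterwards they hold x, and the
    -- released vertices form the inserted block, so the vertex set grows by exactly x.
    absBefore : AbsV → List Block
    absBefore (y , ls , cn) = linkBefore (tuple y) ls ++ connBlocks (mainSite y) cn ++ mainBefore y

    absAfter : Vec V d → AbsV → List Block
    absAfter x (y , ls , cn) = linkAfter x ls ++ connBlocks (mainSite y) cn ++ mainAfter y

    -- The order of choice is not the order on the path. The insertion part comes first, because the
    -- links must know which vertices of t to release, then come the links, and last the connector
    -- between them; on the path the insertion part is at the end. F′ makes the absorber avoid x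
    -- itself.
    AbsOK : Block × Vec V ℓ → Vec V d → List V → AbsV → Set
    AbsOK q x F (y , ls , cn) = MainOK F′ y × LinkOK q x (tuple y) (mainVerts y ++ F′) ls
        × ConnOK (proj₁ (linkEnd q ls)) (proj₂ (linkEnd q ls)) (mainSite y) (col (firstBefore y)) (col (firstAfter y)) (linkVerts ls ++ mainVerts y ++ F′) cn
      where F′ = toList x ++ F

    AbsOK? : ∀ q x F → Decidable (AbsOK q x F)
    AbsOK? q x F (y , ls , cn) = MainOK? F′ y ×-dec (LinkOK? q x (tuple y) (mainVerts y ++ F′) ls
        ×-dec ConnOK? (proj₁ (linkEnd q ls)) (proj₂ (linkEnd q ls)) (mainSite y) (col (firstBefore y)) (col (firstAfter y)) (linkVerts ls ++ mainVerts y ++ F′) cn)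
      where F′ = toList x ++ F

    length-absVerts : ∀ y → length (absVerts y) ≡ absSize
    length-absVerts (y , ls , cn) = trans (length-++ (mainVerts y)) (cong₂ _+_ (length-mainVerts y)
      (trans (length-++ (linkVerts ls)) (cong₂ _+_ (length-linkVerts ls) (length-connVerts cn))))

    private
      tuple-⊆ : ∀ y {v} → v ∈ toList (tuple y) → v ∈ mainVerts y
      tuple-⊆ (S₀ , S₁ , M₀ , t′ , t″ , Sᵤ , Mᵤ) i = ∈-++⁺ʳ (toList S₀) (∈-++⁺ʳ (toList S₁) (∈-++⁺ʳ (toList M₀)
        (∈-resp-↭ (permute 4 (λ p q r s → (p ⊕ q) ⊕ (r ⊕ s) ⊜ p ⊕ (q ⊕ (r ⊕ s))) ↭-refl (toList t′) (toList t″) (toList Sᵤ) (toList Mᵤ))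
          (∈-++⁺ˡ (subst (_ ∈_) (toList-++ t′ t″) i)))))

      link-anchor : ∀ {r} q (xs αs : Vec V r) F ls → Anchor (proj₁ q) F → LinkOK q xs αs F ls → Anchor (proj₁ (linkEnd q ls)) (linkVerts ls ++ F)
      link-anchor q [] [] F [] an ok = an
      link-anchor q (x ∷ xs) (α ∷ αs) F ((e , cn) ∷ ls) an (((_ , _ , f) , _) , ok) =
        anchor-⊆ {proj₁ (linkEnd (exEnd e) ls)} (∈-resp-↭ (permute 4 (λ l c e f → l ⊕ (c ⊕ (e ⊕ f)) ⊜ (e ⊕ (c ⊕ l)) ⊕ f) ↭-refl (linkVerts ls) (connVerts cn) (exVerts e) F))
          (link-anchor (exEnd e) xs αs _ ls (ex-anchor e cn (proj₁ f)) ok)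

    module _ (pos : 0 < n) (deg : Degrees) {C : ℕ} (sp : Sparse C) (C₁ : 5 * connD ≤ C) (C₂ : 2 * exD ≤ C) (C₃ : 3 * mainD ≤ C) where

      abs-dense : ∀ q x F → Anchor (proj₁ q) F → Room (d + absSize) F → Dense absD absorbers (AbsOK? q x F)
      abs-dense q x F (u , sub) room =
        dense-⊗ (main-dense pos deg sp F′ C₃ (room-≤ (m≤m+n mainSize _) r₀)) λ y ok₁ →
        let r₁ = room-list (mainVerts y) (length-mainVerts y) r₀
            an₁ : Anchor (proj₁ q) (mainVerts y ++ F′)
            an₁ = u , λ i → ∈-++⁺ʳ (mainVerts y) (∈-++⁺ʳ (toList x) (sub i)) in
        dense-⊗ (link-dense pos deg sp C₁ C₂ C₃ q x (tuple y) (mainVerts y ++ F′) an₁ (λ i → ∈-++⁺ʳ (mainVerts y) (∈-++⁺ˡ i))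
          (λ i → ∈-++⁺ˡ (tuple-⊆ y i)) (room-≤ (m≤m+n (d * linkSize) connSize) r₁)) λ ls ok₂ →
        let u₂ , s₂ = link-anchor q x (tuple y) (mainVerts y ++ F′) ls an₁ ok₂ in
        dense-mono (λ cn _ ok₃ → ok₁ , ok₂ , ok₃)
          (conn-dense pos deg sp (proj₁ (linkEnd q ls)) (proj₂ (linkEnd q ls)) (mainSite y) _ _ _ C₁ u₂ s₂ (unique-++⁻ˡ (toList (mainSite y)) (proj₁ (proj₂ (proj₂ ok₁))))
            (λ i → ∈-++⁺ʳ (linkVerts ls) (∈-++⁺ˡ (∈-++⁺ˡ i)))
            (room-list (linkVerts ls) (length-linkVerts ls) r₁))
        where
        F′ = toList x ++ F
        r₀ : Room absSize F′
        r₀ = room-++ x room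

    module _ (q : Block × Vec V ℓ) (x : Vec V d) (F : List V) (z : AbsV) (ok : AbsOK q x F z) where

      private
        F′ = toList x ++ F
        y  = proj₁ z
        ls = proj₁ (proj₂ z)
        cn = proj₂ (proj₂ z)
        cb = connBlocks (mainSite y) cn
        ok₁ = proj₁ ok
        ok₂ = proj₁ (proj₂ ok)
        ok₃ = proj₂ (proj₂ ok)
        main-on : ∀ bs → Run (at (mainSite y)) bs → StartsOff (mainSite y) (col (lastEdge (mainSite y) cn)) bs →
                  Run (on (mainSite y , proj₂ (proj₂ (proj₂ (proj₂ cn)))) (proj₁ (proj₂ (proj₂ cn)))) bs
        main-on []       r       ne = tt
        main-on (b ∷ bs) (e , r) ne = (e , λ q → ne (sym q)) , r
        lr = link-run q x (tuple y) (mainVerts y ++ F′) ls {uncurry on q} ok₂ (same refl refl)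

      abs-run-before : Run (uncurry on q) (absBefore z)
      abs-run-before = run-++⁺ (linkBefore (tuple y) ls) {cb ++ mainBefore y} (proj₁ lr)
        (subst (λ s → Run s (cb ++ mainBefore y)) (sym (proj₁ (proj₂ (proj₂ lr))))
          (run-++⁺ {uncurry on (linkEnd q ls)} cb {mainBefore y} (proj₁ ok₃) (main-on (mainBefore y) (proj₁ ok₁) (proj₁ (proj₁ (proj₂ ok₃))))))

      abs-run-after : Run (uncurry on q) (absAfter x z)
      abs-run-after = run-++⁺ (linkAfter x ls) {cb ++ mainAfter y} (proj₁ (proj₂ lr))
        (run-≈ (cb ++ mainAfter y) (proj₂ (proj₂ (proj₂ lr)))
          (run-++⁺ {uncurry on (linkEnd q ls)} cb {mainAfter y} (proj₁ ok₃) (main-on (mainAfter y) (proj₁ (proj₂ ok₁)) (proj₂ (proj₁ (proj₂ ok₃))))))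

      abs-fresh : Fresh F (absVerts z)
      abs-fresh = fresh-⊆ (∈-++⁺ʳ (toList x)) (fresh-++ (proj₂ (proj₂ ok₁)) (fresh-++ (link-fresh q x (tuple y) _ ls ok₂) (proj₂ (proj₂ ok₃))))

    -- This state and that of `end-absAfter` are identical, not merely equivalent, so each absorber
    -- in a chain can be switched independently of the others.
    end-absBefore : ∀ st z → end st (absBefore z) ≡ uncurry on (absEnd z)
    end-absBefore st (y , ls , cn) = trans (end-++ (linkBefore (tuple y) ls)) (go (end st (linkBefore (tuple y) ls)))
      where
      go : ∀ st → end st (connBlocks (mainSite y) cn ++ mainBefore y) ≡ uncurry on (absEnd (y , ls , cn))
      go none     = refl
      go (at _)   = refl
      go (on _ _) = refl

    end-absAfter : ∀ st x z → end st (absAfter x z) ≡ uncurry on (absEnd z)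
    end-absAfter st x (y , ls , cn) = trans (end-++ (linkAfter x ls)) (go (end st (linkAfter x ls)))
      where
      go : ∀ st → end st (connBlocks (mainSite y) cn ++ mainAfter y) ≡ uncurry on (absEnd (y , ls , cn))
      go none     = refl
      go (at _)   = refl
      go (on _ _) = refl

    absBefore-verts : ∀ z → verts (absBefore z) ↭ absVerts z
    absBefore-verts (y@(S₀ , S₁ , M₀ , t′ , t″ , Sᵤ , Mᵤ) , ls , cn) =
      ↭-trans (↭-reflexive (trans (verts-++ (linkBefore (tuple y) ls) _) (cong (verts (linkBefore (tuple y) ls) ++_) (verts-++ (connBlocks S₀ cn) (mainBefore y)))))
      (↭-trans (++⁺ (↭-trans (linkBefore-verts (tuple y) ls) (↭-reflexive (cong (_++ linkVerts ls) (toList-++ t′ t″)))) (++⁺ʳ (verts (mainBefore y)) (conn-verts S₀ cn)))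
      (permute 9 (λ s₀ s₁ m₀ t u p q l c → ((t ⊕ u) ⊕ l) ⊕ ((s₀ ⊕ c) ⊕ ((s₁ ⊕ m₀) ⊕ ((p ⊕ q) ⊕ id))) ⊜
                   (s₀ ⊕ (s₁ ⊕ (m₀ ⊕ (t ⊕ (u ⊕ (p ⊕ q)))))) ⊕ (l ⊕ c)) ↭-refl
        (toList S₀) (toList S₁) (toList M₀) (toList t′) (toList t″) (toList Sᵤ) (toList Mᵤ) (linkVerts ls) (connVerts cn)))

    absAfter-verts : ∀ x z → verts (absAfter x z) ↭ toList x ++ absVerts z
    absAfter-verts x (y@(S₀ , S₁ , M₀ , t′ , t″ , Sᵤ , Mᵤ) , ls , cn) =
      ↭-trans (↭-reflexive (trans (verts-++ (linkAfter x ls) _) (cong (verts (linkAfter x ls) ++_) (verts-++ (connBlocks S₀ cn) (mainAfter y)))))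
      (↭-trans (++⁺ (linkAfter-verts x ls) (++⁺ʳ (verts (mainAfter y)) (conn-verts S₀ cn)))
      (permute 10 (λ x s₀ s₁ m₀ t u p q l c → (x ⊕ l) ⊕ ((s₀ ⊕ c) ⊕ ((t ⊕ u) ⊕ ((s₁ ⊕ m₀) ⊕ ((p ⊕ q) ⊕ id)))) ⊜
                   x ⊕ ((s₀ ⊕ (s₁ ⊕ (m₀ ⊕ (t ⊕ (u ⊕ (p ⊕ q)))))) ⊕ (l ⊕ c))) ↭-refl
        (toList x) (toList S₀) (toList S₁) (toList M₀) (toList t′) (toList t″) (toList Sᵤ) (toList Mᵤ) (linkVerts ls) (connVerts cn)))

    abs-anchor : ∀ {F} z → Unique (absVerts z) → Anchor (proj₁ (absEnd z)) (absVerts z ++ F)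
    abs-anchor ((S₀ , S₁ , M₀ , t′ , t″ , Sᵤ , Mᵤ) , ls , cn) u =
      unique-++⁻ˡ (toList Sᵤ) (unique-++⁻ʳ (toList t″) (unique-++⁻ʳ (toList t′) (unique-++⁻ʳ (toList M₀) (unique-++⁻ʳ (toList S₁)
        (unique-++⁻ʳ (toList S₀) (unique-++⁻ˡ (mainVerts (S₀ , S₁ , M₀ , t′ , t″ , Sᵤ , Mᵤ)) u)))))) ,
      λ i → ∈-++⁺ˡ (∈-++⁺ˡ (∈-++⁺ʳ (toList S₀) (∈-++⁺ʳ (toList S₁) (∈-++⁺ʳ (toList M₀) (∈-++⁺ʳ (toList t′) (∈-++⁺ʳ (toList t″) (∈-++⁺ˡ i)))))))

-- Zigzag paths from supersaturation.

module Zigzag where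

  open Prelude
  open Counting
  open Greedy using (∈-pick; ^-distribʳ-*)
  open Blowup
  open Freshness
  open Graph
  open import Data.Nat.Divisibility using (divides; ∣m+n∣m⇒∣n; m∣m*n; ∣1⇒≡1)
  open import Data.Fin using (inject₁; toℕ; _↑ˡ_; _↑ʳ_; remQuot; combine)
  open import Data.Fin.Properties using (toℕ-inject₁; combine-remQuot; toℕ-combine; toℕ-↑ˡ; toℕ-↑ʳ; toℕ<n)
  open import Data.List using (tabulate)
  open import Data.List.Properties using (map-id; length-tabulate)
  open import Data.Vec.Properties using (lookup∘update; lookup∘update′)
  import Data.Fin.Properties as FinP

  ∑-↭ : {A : Set} {xs ys : List A} (f : A → ℕ) → xs ↭ ys → ∑ xs f ≡ ∑ ys f
  ∑-↭ f P.refl          = refl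
  ∑-↭ f (P.prep x p)    = cong (f x +_) (∑-↭ f p)
  ∑-↭ f (P.swap x y p)  = trans (cong (λ z → f x + (f y + z)) (∑-↭ f p)) (e (f x) (f y) _)
    where e : ∀ a b c → a + (b + c) ≡ b + (a + c)
          e = solve-∀
  ∑-↭ f (P.trans p q)   = trans (∑-↭ f p) (∑-↭ f q)

  pick-all : {A : Set} {ys ws : List A} → Unique ys → (∀ {y} → y ∈ ys → y ∈ ws) → ∃ λ rest → ws ↭ ys ++ rest
  pick-all {ys = []}     {ws} u        sub = ws , ↭-refl
  pick-all {ys = y ∷ ys} {ws} (a ∷ u) sub =
    let ws′ , p    = ∈-pick (sub (here refl))
        rest , q   = pick-all {ws = ws′} u λ i → drop (AllB.lookup a i) (∈-resp-↭ p (sub (there i)))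
    in rest , ↭-trans p (prep y q)
    where
    drop : ∀ {z ws′} → y ≢ z → z ∈ y ∷ ws′ → z ∈ ws′
    drop ne (here refl) = ⊥-elim (ne refl)
    drop ne (there i)   = i

  ∑-sub : ∀ {A : Set} {n} (φ : A → Fin n) (xs : List A) → Unique (map φ xs) → (g : Fin n → ℕ) → ∑ xs (g ∘ φ) ≤ ∑ (allFin n) g
  ∑-sub {n = n} φ xs u g = let rest , p = pick-all {ws = allFin n} u (λ _ → ∈-allFin _) in
    ≤-trans (≤-reflexive (sym (∑-map φ xs g))) (≤-trans (m≤m+n _ (∑ rest g)) (≤-reflexive (trans (sym (∑-++ (map φ xs) rest g)) (sym (∑-↭ g p)))))

  unique-map-id : {A : Set} {us : List A} → Unique us → Unique (map (λ v → v) us)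
  unique-map-id {us = us} u = subst Unique (sym (map-id us)) u

  ∑-pow-sub : ∀ {n} {us : List (Fin n)} → Unique us → ∀ r (g : Vec (Fin n) r → ℕ) → ∑ (pow r us) g ≤ ∑ (pow r (allFin n)) g
  ∑-pow-sub {n} {us} u zero    g = ≤-reflexive (trans (∑-pow-0 us g) (sym (∑-pow-0 (allFin n) g)))
  ∑-pow-sub {n} {us} u (suc r) g = begin
    ∑ (pow (suc r) us) g                                   ≡⟨ ∑-pow-suc r us g ⟩
    ∑ us (λ v → ∑ (pow r us) (λ w → g (v ∷ w)))            ≤⟨ ∑-mono us (λ v → ∑-pow-sub u r (λ w → g (v ∷ w))) ⟩
    ∑ us (λ v → ∑ (pow r (allFin n)) (λ w → g (v ∷ w)))    ≤⟨ ∑-sub (λ v → v) us (unique-map-id u) (λ v → ∑ (pow r (allFin n)) (λ w → g (v ∷ w))) ⟩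
    ∑ (allFin n) (λ v → ∑ (pow r (allFin n)) (λ w → g (v ∷ w))) ≡⟨ ∑-pow-suc r (allFin n) g ⟨
    ∑ (pow (suc r) (allFin n)) g                           ∎
    where open ≤-Reasoning

  rare-fst : ∀ {A B : Set} {s N} {xs : List A} {ys : List B} {P : A → Set} {P? : Decidable P} →
             Rare s N xs P? → Rare s N (xs ⊗ ys) (λ p → P? (proj₁ p))
  rare-fst {s = s} {N} {xs} {ys} {P? = P?} (mkRare p) = mkRare (begin
    N * cnt (xs ⊗ ys) (λ z → P? (proj₁ z))   ≡⟨ cong (N *_) (trans (∑-⊗ xs ys _) (trans (∑-cong xs (λ x → ∑-const _ ys)) (∑-*ˡ (length ys) xs _))) ⟩
    N * (length ys * cnt xs P?)              ≡⟨ e N (length ys) _ ⟩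
    N * cnt xs P? * length ys                ≤⟨ *-monoˡ-≤ (length ys) p ⟩
    s * length xs * length ys                ≡⟨ trans (*-assoc s _ _) (cong (s *_) (sym (length-⊗ xs ys))) ⟩
    s * length (xs ⊗ ys)                     ∎)
    where
    open ≤-Reasoning
    e : ∀ a b c → a * (b * c) ≡ a * c * b
    e = solve-∀

  rare-snd : ∀ {A B : Set} {s N} {xs : List A} {ys : List B} {Q : A × B → Set} {Q? : Decidable Q} →
             (∀ x → Rare s N ys (λ y → Q? (x , y))) → Rare s N (xs ⊗ ys) Q?
  rare-snd {s = s} {N} {xs} {ys} {Q? = Q?} q = mkRare (begin
    N * cnt (xs ⊗ ys) Q?                             ≡⟨ trans (cong (N *_) (∑-⊗ xs ys _)) (sym (∑-*ˡ N xs _)) ⟩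
    ∑ xs (λ x → N * cnt ys (λ y → Q? (x , y)))       ≤⟨ ∑-mono xs (λ x → rare (q x)) ⟩
    ∑ xs (λ _ → s * length ys)                       ≡⟨ ∑-const _ xs ⟩
    length xs * (s * length ys)                      ≡⟨ e (length xs) s _ ⟩
    s * (length xs * length ys)                      ≡⟨ cong (s *_) (length-⊗ xs ys) ⟨
    s * length (xs ⊗ ys)                             ∎)
    where
    open ≤-Reasoning
    e : ∀ a b c → a * (b * c) ≡ b * (a * c)
    e = solve-∀

  cat : {A : Set} {N : ℕ} → (Fin N → List A) → List A
  cat {N = zero}  g = []
  cat {N = suc N} g = g zero ++ cat (g ∘ suc)

  cat-+ : {A : Set} (M N : ℕ) (g : Fin (M + N) → List A) → cat g ≡ cat (λ i → g (i ↑ˡ N)) ++ cat (λ i → g (M ↑ʳ i))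
  cat-+ zero    N g = refl
  cat-+ (suc M) N g = trans (cong (g zero ++_) (cat-+ M N (g ∘ suc))) (sym (++-assoc (g zero) _ _))

  length-cat : {A : Set} {N m : ℕ} (g : Fin N → List A) → (∀ i → length (g i) ≡ m) → length (cat g) ≡ N * m
  length-cat {N = zero}  g e = refl
  length-cat {N = suc N} g e = trans (length-++ (g zero)) (cong₂ _+_ (e zero) (length-cat (g ∘ suc) (e ∘ suc)))

  cat-All : {A : Set} {P : A → Set} {N : ℕ} {g : Fin N → List A} → (∀ i → All P (g i)) → All P (cat g)
  cat-All {N = zero}  p = []
  cat-All {N = suc N} p = AllP.++⁺ (p zero) (cat-All (p ∘ suc))

  cat-toList : {A : Set} {N : ℕ} (w : Vec A N) → cat (λ i → lookup w i ∷ []) ≡ toList w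
  cat-toList []      = refl
  cat-toList (x ∷ w) = cong (x ∷_) (cat-toList w)

  cat-injective : {A : Set} {N : ℕ} (g : Fin N → A) → Unique (cat (λ i → g i ∷ [])) → ∀ {i j} → g i ≡ g j → i ≡ j
  cat-injective {N = suc N} g (p ∷ u) {zero}  {zero}  eq = refl
  cat-injective {N = suc N} g (p ∷ u) {zero}  {suc j} eq = ⊥-elim (AllB.lookup p (cat-∈ (g ∘ suc) j) eq)
    where
    cat-∈ : ∀ {A : Set} {N} (g : Fin N → A) j → g j ∈ cat (λ i → g i ∷ [])
    cat-∈ g zero    = here refl
    cat-∈ g (suc j) = there (cat-∈ (g ∘ suc) j)
  cat-injective {N = suc N} g (p ∷ u) {suc i} {zero}  eq = sym (cat-injective g (p ∷ u) {zero} {suc i} (sym eq))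
  cat-injective {N = suc N} g (p ∷ u) {suc i} {suc j} eq = cong suc (cat-injective (g ∘ suc) u eq)

  cat-unique : {A : Set} {N : ℕ} (φ : Fin N → A) → (∀ {i j} → φ i ≡ φ j → i ≡ j) → Unique (cat (λ i → φ i ∷ []))
  cat-unique {N = zero}  φ inj = []
  cat-unique {N = suc N} φ inj = cat-All {P = φ zero ≢_} {g = λ i → φ (suc i) ∷ []} (λ i → (λ eq → contradiction (inj eq) λ ()) ∷ [])
    ∷ cat-unique (φ ∘ suc) (λ eq → FinP.suc-injective (inj eq))

  all-toList : {A : Set} {P : A → Set} {N : ℕ} {w : Vec A N} → (∀ i → P (lookup w i)) → All P (toList w)
  all-toList {w = []}    p = []
  all-toList {w = x ∷ w} p = p zero ∷ all-toList (p ∘ suc)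

  -- Otherwise `2+ q` would divide 1.
  no-consecutive-multiples : ∀ q x y → 2+ q * x ≢ 2+ q * y + 1
  no-consecutive-multiples q x y eq = contradiction (∣1⇒≡1 (∣m+n∣m⇒∣n {2+ q} {2+ q * y} {1} (divides x (trans (sym eq) (*-comm (2+ q) x))) (m∣m*n y))) λ ()

  module Spreading {n : ℕ} (N₀ R : ℕ) where

    private V = Fin n

    -- A random vertex list meets F or repeats itself with probability at most 1/N₀ per vertex. R
    -- bounds the vertices in play at once; the base lists have at least N₀R entries, so that even R
    -- forbidden vertices are rare.
    record Spread {A : Set} (L : List A) (vs : A → List V) (m : ℕ) : Set where
      constructor mkSpread
      field
        size   : ∀ x → length (vs x) ≡ m
        spread : ∀ F → length F + m ≤ R → Rare m N₀ L (λ x → ¬? (fresh? F (vs x)))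
    open Spread public

    spread-≗ : {A : Set} {L : List A} {vs vs′ : A → List V} {m : ℕ} → (∀ x → vs x ≡ vs′ x) → Spread L vs m → Spread L vs′ m
    spread-≗ eq sp = mkSpread (λ x → trans (cong length (sym (eq x))) (size sp x))
      (λ F le → rare-mono (λ x _ ¬f f → ¬f (subst (Fresh F) (eq x) f)) (spread sp F le))

    spread-base : {A : Set} (φ : A → V) {xs : List A} → Unique (map φ xs) → N₀ * R ≤ length xs → Spread xs (λ x → φ x ∷ []) 1
    spread-base φ {xs} u big = mkSpread (λ _ → refl) λ F le → mkRare (begin
      N₀ * cnt xs (λ x → ¬? (fresh? F (φ x ∷ [])))  ≤⟨ *-monoʳ-≤ N₀ (cnt-mono xs _ (λ x → φ x ∈? F) (λ x _ ¬f → decidable-stable (φ x ∈? F) (λ v∉ → ¬f (fresh-∷ v∉ fresh-[])))) ⟩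
      N₀ * cnt xs (λ x → φ x ∈? F)                  ≡⟨ cong (N₀ *_) (∑-map φ xs _) ⟨
      N₀ * cnt (map φ xs) (_∈? F)                   ≤⟨ *-monoʳ-≤ N₀ (cnt-∈ F u) ⟩
      N₀ * length F                                 ≤⟨ *-monoʳ-≤ N₀ (≤-trans (m≤m+n _ 1) le) ⟩
      N₀ * R                                        ≤⟨ big ⟩
      length xs                                     ≡⟨ *-identityˡ _ ⟨
      1 * length xs                                 ∎)
      where open ≤-Reasoning

    spread-pow : {A : Set} {L : List A} {vs : A → List V} {m : ℕ} → Spread L vs m → ∀ N →
                 Spread (pow N L) (λ w → cat (λ i → vs (lookup w i))) (N * m)
    spread-pow {A} {L} {vs} {m} sp N = mkSpread (λ w → length-cat _ (λ i → size sp (lookup w i))) (go N)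
      where
      go : ∀ N F → length F + N * m ≤ R → Rare (N * m) N₀ (pow N L) (λ w → ¬? (fresh? F (cat (λ i → vs (lookup w i)))))
      go zero    F le = mkRare (≤-reflexive (trans (cong (N₀ *_) (trans (∑-pow-0 L _) (ind-no (¬? (fresh? F [])) (λ ¬f → ¬f fresh-[])))) (*-zeroʳ N₀)))
      go (suc N) F le = rare-reindex {ys = L ⊗ pow N L} (λ { (x ∷ w) → x , w })
        (λ f → trans (∑-pow-suc N L _) (sym (∑-⊗ L (pow N L) f)))
        (λ { (x ∷ w) ¬f → ¬f })
        (rare-⊎ {P? = λ p → ¬? (fresh? F (vs (proj₁ p)))}
          {Q? = λ p → ¬? (fresh? (vs (proj₁ p) ++ F) (cat (λ i → vs (lookup (proj₂ p) i))))}
          {R? = λ p → ¬? (fresh? F (vs (proj₁ p) ++ cat (λ i → vs (lookup (proj₂ p) i))))}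
          (λ (x , w) ¬f → dec-⊎ (¬? (fresh? F (vs x))) (λ ¬¬f g → ¬f (fresh-++ (decidable-stable (fresh? F (vs x)) ¬¬f) g)))
          (rare-fst (spread sp F (≤-trans (+-monoʳ-≤ (length F) (m≤m+n m _)) le)))
          (rare-snd (λ x → go N (vs x ++ F) (≤-trans (≤-reflexive (trans (cong (_+ N * m) (trans (length-++ (vs x)) (cong (_+ length F) (size sp x)))) (e m (length F) (N * m)))) le))))
        where e : ∀ m f x → m + f + x ≡ f + (m + x)
              e = solve-∀

  -- N = θq odd blocks, each of the q sources being used θ times. `zigS` adds the numerators of all
  -- rare events: repeated sources, repeated vertices in A, B and M, and colour conflicts at N - 1
  -- junctions of either kind.
  module ZigSizes (a b θ′ q′ D : ℕ) where

    open Sizes a b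

    θ q N N′ : ℕ
    θ  = suc θ′
    q  = suc (suc q′)
    N′ = suc (q′ + θ′ * q)
    N  = suc N′

    zigD zigS : ℕ
    zigD = blowD (N + N) (blowD N (blowD N (blowD q D)))
    zigS = q * 1 + (N * (a * 1) + (N * (ℓ * 1) + ((N + N) * (h * 1) + (N′ * 1 + N′ * 1))))

    -- Opaque constants: later arguments use only the two bounds and never compute with the values.
    abstract
      zigN zigR : ℕ
      zigN = 2 * zigD * zigS
      zigR = N + (q * 1 + (N * (a * 1) + (N * (ℓ * 1) + (N + N) * (h * 1))))

      zigN-bound : 2 * zigD * zigS ≤ zigN
      zigN-bound = ≤-refl

      zigR-bound : N + (q * 1 + (N * (a * 1) + (N * (ℓ * 1) + (N + N) * (h * 1)))) ≤ zigR
      zigR-bound = ≤-refl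

  module Zig (a b : ℕ) {n : ℕ} (S : System n) (θ′ q′ D : ℕ) where

    open Graphs a b S
    open ZigSizes a b θ′ q′ D
    open Perm using (_⊕_; _⊜_; id) renaming (solve to permute)

    zigzag : ∀ {N} → (Fin N → Block) → (Fin N → Block) → List Block
    zigzag {zero}  X O = []
    zigzag {suc N} X O = X zero ∷ O zero ∷ zigzag (X ∘ suc) (O ∘ suc)

    length-zigzag : ∀ {N} (X O : Fin N → Block) → length (zigzag X O) ≡ N + N
    length-zigzag {zero}  X O = refl
    length-zigzag {suc N} X O = cong suc (trans (cong suc (length-zigzag (X ∘ suc) (O ∘ suc))) (sym (+-suc N N)))

    zigzag-run-on : ∀ {N} c p (X O : Fin (suc N) → Block) →
      (∀ i → E (ed (O i) (site (X i)))) → OK (on c p) (X zero) → col (ed (O zero) (site (X zero))) ≢ col (ed (X zero) (site c)) →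
      (∀ i → E (ed (X (suc i)) (site (O (inject₁ i))))) →
      (∀ i → col (ed (X (suc i)) (site (O (inject₁ i)))) ≢ col (ed (O (inject₁ i)) (site (X (inject₁ i))))) →
      (∀ i → col (ed (O (suc i)) (site (X (suc i)))) ≢ col (ed (X (suc i)) (site (O (inject₁ i))))) →
      Run (on c p) (zigzag X O)
    zigzag-run-on {zero}  c p X O e ok ne eX n₁ n₂ = ok , (e zero , ne) , tt
    zigzag-run-on {suc N} c p X O e ok ne eX n₁ n₂ = ok , (e zero , ne) ,
      zigzag-run-on (O zero) (site (X zero)) (X ∘ suc) (O ∘ suc) (e ∘ suc) (eX zero , n₁ zero) (n₂ zero) (eX ∘ suc) (n₁ ∘ suc) (n₂ ∘ suc)

    zigzag-run : ∀ {N} (X O : Fin (suc N) → Block) →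
      (∀ i → E (ed (O i) (site (X i)))) →
      (∀ i → E (ed (X (suc i)) (site (O (inject₁ i))))) →
      (∀ i → col (ed (X (suc i)) (site (O (inject₁ i)))) ≢ col (ed (O (inject₁ i)) (site (X (inject₁ i))))) →
      (∀ i → col (ed (O (suc i)) (site (X (suc i)))) ≢ col (ed (X (suc i)) (site (O (inject₁ i))))) →
      Run none (zigzag X O)
    zigzag-run {zero}  X O e eX n₁ n₂ = tt , e zero , tt
    zigzag-run {suc N} X O e eX n₁ n₂ = tt , e zero ,
      zigzag-run-on (O zero) (site (X zero)) (X ∘ suc) (O ∘ suc) (e ∘ suc) (eX zero , n₁ zero) (n₂ zero) (eX ∘ suc) (n₁ ∘ suc) (n₂ ∘ suc)

    zigzag-verts : ∀ {N} (v : Fin N → V) (A : Fin N → Vec V a) (B : Fin N → Vec V ℓ) (M M′ : Fin N → Vec V h) →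
      verts (zigzag (λ i → v i ∷ A i , M i) (λ i → B i , M′ i)) ↭
      tabulate v ++ cat (toList ∘ A) ++ cat (toList ∘ B) ++ cat (toList ∘ M) ++ cat (toList ∘ M′)
    zigzag-verts {zero}  v A B M M′ = ↭-refl
    zigzag-verts {suc N} v A B M M′ =
      ↭-trans (++⁺ˡ (bverts (v zero ∷ A zero , M zero)) (++⁺ˡ (bverts (B zero , M′ zero)) (zigzag-verts (v ∘ suc) (A ∘ suc) (B ∘ suc) (M ∘ suc) (M′ ∘ suc))))
      (permute 10 (λ v a b m m′ v′ a′ b′ n n′ →
          ((v ⊕ a) ⊕ m) ⊕ ((b ⊕ m′) ⊕ (v′ ⊕ (a′ ⊕ (b′ ⊕ (n ⊕ n′))))) ⊜
          (v ⊕ v′) ⊕ ((a ⊕ a′) ⊕ ((b ⊕ b′) ⊕ ((m ⊕ n) ⊕ (m′ ⊕ n′))))) ↭-refl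
        (v zero ∷ []) (toList (A zero)) (toList (B zero)) (toList (M zero)) (toList (M′ zero))
        (tabulate (v ∘ suc)) (cat (toList ∘ A ∘ suc)) (cat (toList ∘ B ∘ suc)) (cat (toList ∘ M ∘ suc)) (cat (toList ∘ M′ ∘ suc)))

    -- Source src i supplies the vertex of the i-th odd block; neighbouring odd blocks use different sources.
    abstract
      src : Fin N → Fin q
      src i = proj₂ (remQuot {θ} q i)

      pos : Fin N → Fin θ
      pos i = proj₁ (remQuot {θ} q i)

      src-pos : ∀ i j → src i ≡ src j → pos i ≡ pos j → i ≡ j
      src-pos i j p r = trans (sym (combine-remQuot {θ} q i)) (trans (cong₂ combine r p) (combine-remQuot {θ} q j))

      toℕ-src : ∀ i → toℕ i ≡ q * toℕ (pos i) + toℕ (src i)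
      toℕ-src i = trans (cong toℕ (sym (combine-remQuot {θ} q i))) (toℕ-combine (pos i) (src i))

    -- The source of block i is the residue of i modulo q ≥ 2. Resampling the source of block i + 1
    -- must leave alone the edge at block i against which colours are compared.
    src-alternates : ∀ (i : Fin N′) → src (inject₁ i) ≢ src (suc i)
    src-alternates i eq = no-consecutive-multiples q′ (toℕ (pos (suc i))) (toℕ (pos (inject₁ i))) key
      where
      open ≡-Reasoning
      key : q * toℕ (pos (suc i)) ≡ q * toℕ (pos (inject₁ i)) + 1
      key = +-cancelʳ-≡ (toℕ (src (suc i))) _ _ (begin
        q * toℕ (pos (suc i)) + toℕ (src (suc i))              ≡⟨ toℕ-src (suc i) ⟨
        suc (toℕ i)                                            ≡⟨ cong suc (toℕ-inject₁ i) ⟨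
        suc (toℕ (inject₁ i))                                  ≡⟨ cong suc (toℕ-src (inject₁ i)) ⟩
        suc (q * toℕ (pos (inject₁ i)) + toℕ (src (inject₁ i))) ≡⟨ cong (λ z → suc (q * toℕ (pos (inject₁ i)) + toℕ z)) eq ⟩
        suc (q * toℕ (pos (inject₁ i)) + toℕ (src (suc i)))    ≡⟨ e (q * toℕ (pos (inject₁ i))) _ ⟩
        q * toℕ (pos (inject₁ i)) + 1 + toℕ (src (suc i))      ∎)
        where e : ∀ x y → suc (x + y) ≡ x + 1 + y
              e = solve-∀

    inject₁≢suc : ∀ {m} (i : Fin m) → inject₁ i ≢ suc i
    inject₁≢suc i eq = 1+n≢n (trans (cong toℕ (sym eq)) (toℕ-inject₁ i))

    left≢right : ∀ {m m′} (i : Fin m) (j : Fin m′) → i ↑ˡ m′ ≢ m ↑ʳ j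
    left≢right {m} {m′} i j eq = <⇒≢ (<-≤-trans (toℕ<n i) (m≤m+n m (toℕ j))) (trans (sym (toℕ-↑ˡ i m′)) (trans (cong toℕ eq) (toℕ-↑ʳ m j)))

    module Sources {X : Set} (xs : List X) (f : X → Vec V θ) (us : List V) (u-us : Unique us)
             (f-inj : ∀ {x x′ p p′} → x ∈ xs → x′ ∈ xs → lookup (f x) p ≡ lookup (f x′) p′ → x ≡ x′ × p ≡ p′)
             (f-uniq : ∀ p → Unique (map (λ x → lookup (f x) p) xs)) where

      -- A, B and M have k - 1 vertices together, and each of the θ vertices of x completes them.
      -- After a blow-up any vertex of any source fits any A, B and M, which yields both kinds of
      -- edges of the zigzag: each contains exactly one source vertex.
      Source : X × (Vec V a × (Vec V ℓ × Vec V h)) → Set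
      Source (x , A , B , M) = VAll (λ v → E (v ∷ toList A ++ toList B ++ toList M)) (f x)

      source? : Decidable Source
      source? (x , A , B , M) = VAllB.all? (λ v → E? (v ∷ toList A ++ toList B ++ toList M)) (f x)

      record ZigPath : Set where
        field
          sources  : Vec X q
          sources∈ : ∀ j → lookup sources j ∈ xs
          distinct : ∀ {i j} → lookup sources i ≡ lookup sources j → i ≡ j
          path     : List Block
          run      : Run none path
          len      : length path ≡ N + N
          unique   : Unique (verts path)
          from     : All (λ v → v ∈ us ⊎ ∃ λ j → v ∈ toList (f (lookup sources j))) (verts path)

      module _ {C e : ℕ} (sp : Sparse C) (e>0 : 0 < e) (n≤us : n ≤ e * length us) (n≤xs : n ≤ e * length xs)
               (bigC : zigN * e ^ d ≤ C) (bigus : zigN * zigR ≤ length us) (bigxs : zigN * zigR ≤ length xs)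
               (us>0 : 0 < length us) (xs>0 : 0 < length xs)
               (dn : Dense D (xs ⊗ (pow a us ⊗ (pow ℓ us ⊗ pow h us))) source?) where

        open Spreading {n} zigN zigR

        -- A number of conflicts bounded over all of V^d remains rare in a list whose length is at
        -- least n^d / e^d; the factor `e ^ d` in the bound on C pays for the restriction.
        rare-within : {A : Set} {L : List A} {P : A → Set} (P? : Decidable P) (K : ℕ) → cnt L P? ≤ K → C * K ≤ n ^ d →
                      n ^ d ≤ e ^ d * length L → Rare 1 zigN L P?
        rare-within {L = L} P? K le CK nd = mkRare (*-cancelˡ-≤ (e ^ d) {{m^n≢0 e d {{>-nonZero e>0}}}} (begin
          e ^ d * (zigN * cnt L P?)    ≡⟨ r₁ (e ^ d) zigN _ ⟩
          zigN * e ^ d * cnt L P?      ≤⟨ *-mono-≤ bigC le ⟩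
          C * K                        ≤⟨ CK ⟩
          n ^ d                        ≤⟨ nd ⟩
          e ^ d * length L             ≡⟨ cong (e ^ d *_) (*-identityˡ _) ⟨
          e ^ d * (1 * length L)       ∎))
          where
          open ≤-Reasoning
          r₁ : ∀ x y z → x * (y * z) ≡ y * x * z
          r₁ = solve-∀

        power-≤ : ∀ r → n ^ r ≤ e ^ r * length (pow r us)
        power-≤ r = ≤-trans (^-monoˡ-≤ r n≤us) (≤-reflexive (trans (^-distribʳ-* r e (length us)) (cong (e ^ r *_) (sym (length-pow r us)))))

        total : ℕ → Vec V ℓ → ℕ
        total i s = cnt (tup ℓ ⊗ tup h) (λ (T , M) → Mono? i (toList s ++ toList T ++ toList M))

        total-small : ∀ i s → C * total i s ≤ n ^ d
        total-small i s = ≤-trans (rare (sparse-pair sp i s refl (λ (T , M) → toList s ++ toList T ++ toList M) (λ _ _ → ↭-refl)))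
          (≤-reflexive (trans (*-identityˡ _) (trans (length-⊗ (tup ℓ) (tup h)) (trans (cong₂ _*_ (length-tup ℓ) (length-tup h)) (sym (^-distribˡ-+-* n ℓ h))))))

        rare-O : ∀ i (s : Vec V ℓ) → Rare 1 zigN (pow ℓ us ⊗ pow h us) (λ (B , M) → Mono? i (toList s ++ toList B ++ toList M))
        rare-O i s = rare-within _ (total i s) count (total-small i s) sizes
          where
          open ≤-Reasoning
          g : Vec V ℓ → Vec V h → ℕ
          g B M = ind (Mono? i (toList s ++ toList B ++ toList M))
          count : cnt (pow ℓ us ⊗ pow h us) (λ (B , M) → Mono? i (toList s ++ toList B ++ toList M)) ≤ total i s
          count = begin
            ∑ (pow ℓ us ⊗ pow h us) (λ (B , M) → g B M)          ≡⟨ ∑-⊗ (pow ℓ us) (pow h us) _ ⟩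
            ∑ (pow ℓ us) (λ B → ∑ (pow h us) (g B))              ≤⟨ ∑-mono (pow ℓ us) (λ B → ∑-pow-sub u-us h (g B)) ⟩
            ∑ (pow ℓ us) (λ B → ∑ (tup h) (g B))                 ≤⟨ ∑-pow-sub u-us ℓ (λ B → ∑ (tup h) (g B)) ⟩
            ∑ (tup ℓ) (λ B → ∑ (tup h) (g B))                    ≡⟨ ∑-⊗ (tup ℓ) (tup h) _ ⟨
            total i s                                            ∎
          sizes : n ^ d ≤ e ^ d * length (pow ℓ us ⊗ pow h us)
          sizes = begin
            n ^ d                                                              ≡⟨ ^-distribˡ-+-* n ℓ h ⟩
            n ^ ℓ * n ^ h                                                      ≤⟨ *-mono-≤ (power-≤ ℓ) (power-≤ h) ⟩
            e ^ ℓ * length (pow ℓ us) * (e ^ h * length (pow h us))            ≡⟨ r (e ^ ℓ) _ (e ^ h) _ ⟩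
            e ^ ℓ * e ^ h * (length (pow ℓ us) * length (pow h us))            ≡⟨ cong₂ _*_ (^-distribˡ-+-* e ℓ h) (length-⊗ (pow ℓ us) (pow h us)) ⟨
            e ^ d * length (pow ℓ us ⊗ pow h us)                               ∎
            where r : ∀ x y z w → x * y * (z * w) ≡ x * z * (y * w)
                  r = solve-∀

        rare-X : ∀ i (s : Vec V ℓ) p → Rare 1 zigN (xs ⊗ (pow a us ⊗ pow h us))
                   (λ (x , A , M) → Mono? i (toList s ++ (lookup (f x) p ∷ toList A) ++ toList M))
        rare-X i s p = rare-within _ (total i s) count (total-small i s) sizes
          where
          open ≤-Reasoning
          g : V → Vec V a → Vec V h → ℕ
          g v A M = ind (Mono? i (toList s ++ (v ∷ toList A) ++ toList M))
          count : cnt (xs ⊗ (pow a us ⊗ pow h us)) (λ (x , A , M) → Mono? i (toList s ++ (lookup (f x) p ∷ toList A) ++ toList M)) ≤ total i s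
          count = begin
            ∑ (xs ⊗ (pow a us ⊗ pow h us)) (λ (x , A , M) → g (lookup (f x) p) A M)
              ≡⟨ trans (∑-⊗ xs (pow a us ⊗ pow h us) _) (∑-cong xs (λ x → ∑-⊗ (pow a us) (pow h us) _)) ⟩
            ∑ xs (λ x → ∑ (pow a us) (λ A → ∑ (pow h us) (g (lookup (f x) p) A)))
              ≤⟨ ∑-sub (λ x → lookup (f x) p) xs (f-uniq p) (λ v → ∑ (pow a us) (λ A → ∑ (pow h us) (g v A))) ⟩
            ∑ (allFin n) (λ v → ∑ (pow a us) (λ A → ∑ (pow h us) (g v A)))
              ≤⟨ ∑-mono (allFin n) (λ v → ≤-trans (∑-mono (pow a us) (λ A → ∑-pow-sub u-us h (g v A))) (∑-pow-sub u-us a (λ A → ∑ (tup h) (g v A)))) ⟩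
            ∑ (allFin n) (λ v → ∑ (tup a) (λ A → ∑ (tup h) (g v A)))
              ≡⟨ trans (∑-⊗ (tup ℓ) (tup h) _) (∑-pow-suc a (allFin n) _) ⟨
            total i s ∎
          sizes : n ^ d ≤ e ^ d * length (xs ⊗ (pow a us ⊗ pow h us))
          sizes = begin
            n ^ d                                                                     ≡⟨ ^-distribˡ-+-* n ℓ h ⟩
            n * n ^ a * n ^ h                                                         ≤⟨ *-mono-≤ (*-mono-≤ n≤xs (power-≤ a)) (power-≤ h) ⟩
            e * length xs * (e ^ a * length (pow a us)) * (e ^ h * length (pow h us)) ≡⟨ r e (length xs) (e ^ a) _ (e ^ h) _ ⟩
            e * e ^ a * e ^ h * (length xs * (length (pow a us) * length (pow h us))) ≡⟨ cong₂ _*_ (^-distribˡ-+-* e ℓ h) (trans (length-⊗ xs (pow a us ⊗ pow h us)) (cong (length xs *_) (length-⊗ (pow a us) (pow h us)))) ⟨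
            e ^ d * length (xs ⊗ (pow a us ⊗ pow h us))                               ∎
            where r : ∀ x y z w t u → x * y * (z * w) * (t * u) ≡ x * z * t * (y * (w * u))
                  r = solve-∀

        ZV : Set
        ZV = ((Vec X q × Vec (Vec V a) N) × Vec (Vec V ℓ) N) × Vec (Vec V h) (N + N)

        space : List ZV
        space = ((pow q xs ⊗ pow N (pow a us)) ⊗ pow N (pow ℓ us)) ⊗ pow (N + N) (pow h us)

        vtx : Vec X q → Fin N → V
        vtx X i = lookup (f (lookup X (src i))) (pos i)

        odd even : ZV → Fin N → Block
        odd  (((X , A) , B) , M) i = vtx X i ∷ lookup A i , lookup M (i ↑ˡ N)
        even (((X , A) , B) , M) i = lookup B i , lookup M (N ↑ʳ i)

        edO : ZV → Fin N → List V
        edO y i = ed (even y i) (site (odd y i))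

        edX : ZV → Fin N′ → List V
        edX y i = ed (odd y (suc i)) (site (even y (inject₁ i)))

        full? : Decidable (λ y → (∀ i → E (edO y i)) × (∀ i → E (edX y i)))
        full? y = FinP.all? (λ i → E? (edO y i)) ×-dec FinP.all? (λ i → E? (edX y i))

        full-edges : ∀ X A B M → (∀ j r s t → Source (lookup X j , lookup A r , lookup B s , lookup M t)) →
                     let y = ((X , A) , B) , M in (∀ i → E (edO y i)) × (∀ i → E (edX y i))
        full-edges X A B M full =
          (λ i → VAll-lookup (full (src i) i i (N ↑ʳ i)) (pos i)) ,
          (λ i → E-resp (permute 4 (λ v a b m → v ⊕ (a ⊕ (b ⊕ m)) ⊜ b ⊕ ((v ⊕ a) ⊕ m)) ↭-refl
                   (vtx X (suc i) ∷ []) (toList (lookup A (suc i))) (toList (lookup B (inject₁ i))) (toList (lookup M (suc i ↑ˡ N))))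
                   (VAll-lookup (full (src (suc i)) (suc i) (inject₁ i) (suc i ↑ˡ N)) (pos (suc i))))

        edges-dense : Dense zigD space full?
        edges-dense = blowup₄ {R? = source?} q N N (N + N) xs>0 (pow-nonempty a us>0) (pow-nonempty ℓ us>0) (pow-nonempty h us>0) {T? = full?} full-edges dn

        -- Their first vertices represent the sources: if these are distinct, so are the sources,
        -- and `f-inj` then separates all vertices taken from them.
        reps : Vec X q → List V
        reps X = cat (λ j → lookup (f (lookup X j)) zero ∷ [])

        flat : ∀ {r m} → Vec (Vec V r) m → List V
        flat A = cat (λ i → toList (lookup A i))

        spread-tup : ∀ r → Spread (pow r us) toList (r * 1)
        spread-tup r = spread-≗ cat-toList (spread-pow (spread-base (λ v → v) (unique-map-id u-us) bigus) r)

        FX FA FB FM CX CO Bad : ZV → Set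
        FX (((X , A) , B) , M) = ¬ Fresh [] (reps X)
        FA (((X , A) , B) , M) = ¬ Fresh (tabulate (vtx X)) (flat A)
        FB (((X , A) , B) , M) = ¬ Fresh (flat A ++ tabulate (vtx X)) (flat B)
        FM (((X , A) , B) , M) = ¬ Fresh (flat B ++ flat A ++ tabulate (vtx X)) (flat M)
        CX y = ∃ λ i → Mono (col (edO y (inject₁ i))) (edX y i)
        CO y = ∃ λ i → Mono (col (edX y i)) (edO y (suc i))
        Bad y = FX y ⊎ (FA y ⊎ (FB y ⊎ (FM y ⊎ (CX y ⊎ CO y))))

        FX? : Decidable FX
        FX? (((X , A) , B) , M) = ¬? (fresh? _ _)
        FA? : Decidable FA
        FA? (((X , A) , B) , M) = ¬? (fresh? _ _)
        FB? : Decidable FB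
        FB? (((X , A) , B) , M) = ¬? (fresh? _ _)
        FM? : Decidable FM
        FM? (((X , A) , B) , M) = ¬? (fresh? _ _)
        CX? : Decidable CX
        CX? y = FinP.any? (λ i → Mono? (col (edO y (inject₁ i))) (edX y i))
        CO? : Decidable CO
        CO? y = FinP.any? (λ i → Mono? (col (edX y i)) (edO y (suc i)))
        bad? : Decidable Bad
        bad? y = FX? y ⊎-dec (FA? y ⊎-dec (FB? y ⊎-dec (FM? y ⊎-dec (CX? y ⊎-dec CO? y))))

        lenV : ∀ X → length (tabulate (vtx X)) ≡ N
        lenV X = length-tabulate (vtx X)
        lenA : ∀ {r m} (A : Vec (Vec V r) m) → length (flat A) ≡ m * (r * 1)
        lenA {r} A = length-cat _ (λ i → trans (length-toList (lookup A i)) (sym (*-identityʳ r)))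

        FX-rare : Rare (q * 1) zigN space FX?
        FX-rare = rare-fst (rare-fst (rare-fst {P? = λ X → ¬? (fresh? [] (reps X))}
          (spread (spread-pow (spread-base (λ x → lookup (f x) zero) (f-uniq zero) bigxs) q) []
            (≤-trans (≤-trans (m≤m+n (q * 1) _) (m≤n+m _ N)) zigR-bound))))

        FA-rare : Rare (N * (a * 1)) zigN space FA?
        FA-rare = rare-fst (rare-fst {P? = λ (X , A) → ¬? (fresh? (tabulate (vtx X)) (flat A))}
          (rare-snd λ X → spread (spread-pow (spread-tup a) N) (tabulate (vtx X))
            (≤-trans (≤-reflexive (cong (_+ N * (a * 1)) (lenV X))) (≤-trans (+-monoʳ-≤ N (≤-trans (m≤m+n (N * (a * 1)) _) (m≤n+m _ (q * 1)))) zigR-bound))))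

        FB-rare : Rare (N * (ℓ * 1)) zigN space FB?
        FB-rare = rare-fst {P? = λ ((X , A) , B) → ¬? (fresh? (flat A ++ tabulate (vtx X)) (flat B))}
          (rare-snd λ (X , A) → spread (spread-pow (spread-tup ℓ) N) (flat A ++ tabulate (vtx X))
            (≤-trans (≤-reflexive (trans (cong (_+ N * (ℓ * 1)) (trans (length-++ (flat A)) (cong₂ _+_ (lenA A) (lenV X)))) (r₁ (N * (a * 1)) N (N * (ℓ * 1)))))
              (≤-trans (+-monoʳ-≤ N (≤-trans (+-monoʳ-≤ (N * (a * 1)) (m≤m+n (N * (ℓ * 1)) _)) (m≤n+m _ (q * 1)))) zigR-bound)))
          where r₁ : ∀ x y z → x + y + z ≡ y + (x + z)
                r₁ = solve-∀

        FM-rare : Rare ((N + N) * (h * 1)) zigN space FM?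
        FM-rare = rare-snd λ ((X , A) , B) → spread (spread-pow (spread-tup h) (N + N)) (flat B ++ flat A ++ tabulate (vtx X))
            (≤-trans (≤-reflexive (trans (cong (_+ (N + N) * (h * 1)) (trans (length-++ (flat B)) (cong₂ _+_ (lenA B) (trans (length-++ (flat A)) (cong₂ _+_ (lenA A) (lenV X))))))
              (r₁ (N * (ℓ * 1)) (N * (a * 1)) N ((N + N) * (h * 1))))) (≤-trans (+-monoʳ-≤ N (m≤n+m _ (q * 1))) zigR-bound))
          where r₁ : ∀ x y z w → x + (y + z) + w ≡ z + (y + (x + w))
                r₁ = solve-∀

        slotX : Fin q → Slot space xs
        slotX j = slot-fst (slot-fst (slot-fst (slot-pow j)))
        slotA : Fin N → Slot space (pow a us)
        slotA i = slot-fst (slot-fst (slot-snd (slot-pow i)))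
        slotB : Fin N → Slot space (pow ℓ us)
        slotB i = slot-fst (slot-snd (slot-pow i))
        slotM : Fin (N + N) → Slot space (pow h us)
        slotM i = slot-snd (slot-pow i)

        any-rare : {Q : Fin N′ → ZV → Set} (Q? : ∀ i → Decidable (Q i)) → (∀ i → Rare 1 zigN space (Q? i)) →
                   Rare (N′ * 1) zigN space (λ y → FinP.any? (λ i → Q? i y))
        any-rare Q? r = subst (λ m → Rare (m * 1) zigN space (λ y → FinP.any? (λ i → Q? i y))) (length-allFin N′)
          (rare-any (allFin N′) Q? _ (λ y (i , p) → lose (∈-allFin i) p) (λ i _ → r i))

        -- With the overlap B held fixed, a source, A and M are resampled: 1 + a + h = d vertices.
        CX-rare : Rare (N′ * 1) zigN space CX?
        CX-rare = any-rare (λ i y → Mono? (col (edO y (inject₁ i))) (edX y i)) λ i →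
          rare-slot (slot-pair (slotX (src (suc i))) (slot-pair (slotA (suc i)) (slotM (suc i ↑ˡ N))))
            (⊗-nonempty xs>0 (⊗-nonempty (pow-nonempty a us>0) (pow-nonempty h us>0)))
            λ y@(((X , A) , B) , M) _ →
              rare-mono (λ (x , A′ , M′) _ (e , c) →
                  let eqX = cong₂ (λ w z → toList (lookup B (inject₁ i)) ++ (w ++ z))
                              (cong₂ (λ w z → lookup (f w) (pos (suc i)) ∷ toList z) (lookup∘update (src (suc i)) X x) (lookup∘update (suc i) A A′))
                              (cong toList (lookup∘update (suc i ↑ˡ N) M M′))
                      eqO = cong₂ (λ w z → w ++ (toList (lookup B (inject₁ i)) ++ z))
                              (cong₂ (λ w z → lookup (f w) (pos (inject₁ i)) ∷ toList z) (lookup∘update′ (src-alternates i) X x) (lookup∘update′ (inject₁≢suc i) A A′))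
                              (cong toList (lookup∘update′ (λ z → left≢right (suc i) (inject₁ i) (sym z)) M M′))
                  in subst E eqX e , trans (cong col (sym eqX)) (trans c (cong col eqO)))
                (rare-X (col (edO y (inject₁ i))) (lookup B (inject₁ i)) (pos (suc i)))

        CO-rare : Rare (N′ * 1) zigN space CO?
        CO-rare = any-rare (λ i y → Mono? (col (edX y i)) (edO y (suc i))) λ i →
          rare-slot (slot-pair (slotB (suc i)) (slotM (N ↑ʳ suc i)))
            (⊗-nonempty (pow-nonempty ℓ us>0) (pow-nonempty h us>0))
            λ y@(((X , A) , B) , M) _ →
              rare-mono (λ (B′ , M′) _ (e , c) →
                  let eqO = cong₂ (λ w z → (vtx X (suc i) ∷ toList (lookup A (suc i))) ++ (toList w ++ toList z))
                              (lookup∘update (suc i) B B′) (lookup∘update (N ↑ʳ suc i) M M′)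
                      eqX = cong₂ (λ w z → toList w ++ ((vtx X (suc i) ∷ toList (lookup A (suc i))) ++ toList z))
                              (lookup∘update′ (inject₁≢suc i) B B′) (lookup∘update′ (left≢right (suc i) (suc i)) M M′)
                  in subst E eqO e , trans (cong col (sym eqO)) (trans c (cong col eqX)))
                (rare-O (col (edX y i)) (vtx X (suc i) ∷ lookup A (suc i)))

        bad-rare : Rare zigS zigN space bad?
        bad-rare = rare-⊎ {P? = FX?} {Q? = λ y → FA? y ⊎-dec (FB? y ⊎-dec (FM? y ⊎-dec (CX? y ⊎-dec CO? y)))} (λ _ z → z) FX-rare
          (rare-⊎ {P? = FA?} {Q? = λ y → FB? y ⊎-dec (FM? y ⊎-dec (CX? y ⊎-dec CO? y))} (λ _ z → z) FA-rare
          (rare-⊎ {P? = FB?} {Q? = λ y → FM? y ⊎-dec (CX? y ⊎-dec CO? y)} (λ _ z → z) FB-rare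
          (rare-⊎ {P? = FM?} {Q? = λ y → CX? y ⊎-dec CO? y} (λ _ z → z) FM-rare
          (rare-⊎ {P? = CX?} {Q? = CO?} (λ _ z → z) CX-rare CO-rare))))

        Good : ZV → Set
        Good y = ((∀ i → E (edO y i)) × (∀ i → E (edX y i))) × ¬ Bad y

        good-dense : Dense (2 * zigD) space (λ y → full? y ×-dec ¬? (bad? y))
        good-dense = dense-diff {P? = full?} {Q? = bad?} {R? = λ y → full? y ×-dec ¬? (bad? y)} zigN-bound (λ y p ¬b → p , ¬b) edges-dense bad-rare (s≤s z≤n)

        space-nonempty : 0 < length space
        space-nonempty = ⊗-nonempty (⊗-nonempty (⊗-nonempty (pow-nonempty q xs>0) (pow-nonempty N (pow-nonempty a us>0)))
          (pow-nonempty N (pow-nonempty ℓ us>0))) (pow-nonempty (N + N) (pow-nonempty h us>0))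

        zig-path-from : ∀ y → y ∈ space → Good y → ZigPath
        zig-path-from y@(((X , A) , B) , M) y∈ ((eO , eX) , ¬bad) = record
          { sources = X ; sources∈ = X∈ ; distinct = dist ; path = zigzag (odd y) (even y)
          ; run = zigzag-run (odd y) (even y) eO eX
              (λ i c → ¬bad (inj₂ (inj₂ (inj₂ (inj₂ (inj₁ (i , eX i , c)))))))
              (λ i c → ¬bad (inj₂ (inj₂ (inj₂ (inj₂ (inj₂ (i , eO (suc i) , c)))))))
          ; len = length-zigzag (odd y) (even y)
          ; unique = Unique-resp-↭ (↭-trans (permute 4 (λ v a b m → (a ⊕ (b ⊕ m)) ⊕ v ⊜ v ⊕ (a ⊕ (b ⊕ m))) ↭-refl (tabulate (vtx X)) (flat A) (flat B) (flat M)) (↭-sym perm))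
              (fresh-unique (UniqueP.tabulate⁺ vtx-inj) (fresh-++ fA (fresh-++ fB fM)))
          ; from = All-resp-↭ (↭-sym perm) (AllP.++⁺ (AllP.tabulate⁺ (λ i → inj₂ (src i , VMem.∈-toList⁺ (VMem.∈-lookup (pos i) _))))
              (AllP.++⁺ (inU A A∈) (AllP.++⁺ (inU B B∈) (inU M M∈))))
          }
          where
          y∈₁ = proj₁ (∈-⊗⁻ ((pow q xs ⊗ pow N (pow a us)) ⊗ pow N (pow ℓ us)) y∈)
          M∈ = ∈-pow⁻ (proj₂ (∈-⊗⁻ ((pow q xs ⊗ pow N (pow a us)) ⊗ pow N (pow ℓ us)) y∈))
          y∈₂ = proj₁ (∈-⊗⁻ (pow q xs ⊗ pow N (pow a us)) y∈₁)
          B∈ = ∈-pow⁻ (proj₂ (∈-⊗⁻ (pow q xs ⊗ pow N (pow a us)) y∈₁))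
          A∈ = ∈-pow⁻ (proj₂ (∈-⊗⁻ (pow q xs) y∈₂))
          X∈ = ∈-pow⁻ (proj₁ (∈-⊗⁻ (pow q xs) y∈₂))

          inU : ∀ {r m} (W : Vec (Vec V r) m) → (∀ i → lookup W i ∈ pow r us) → All (λ v → v ∈ us ⊎ ∃ λ j → v ∈ toList (f (lookup X j))) (flat W)
          inU W W∈ = cat-All (λ i → all-toList (λ j → inj₁ (∈-pow⁻ (W∈ i) j)))

          fX : Fresh [] (reps X)
          fX = decidable-stable (fresh? _ _) (λ z → ¬bad (inj₁ z))
          fA : Fresh (tabulate (vtx X)) (flat A)
          fA = decidable-stable (fresh? _ _) (λ z → ¬bad (inj₂ (inj₁ z)))
          fB : Fresh (flat A ++ tabulate (vtx X)) (flat B)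
          fB = decidable-stable (fresh? _ _) (λ z → ¬bad (inj₂ (inj₂ (inj₁ z))))
          fM : Fresh (flat B ++ flat A ++ tabulate (vtx X)) (flat M)
          fM = decidable-stable (fresh? _ _) (λ z → ¬bad (inj₂ (inj₂ (inj₂ (inj₁ z)))))

          dist : ∀ {i j} → lookup X i ≡ lookup X j → i ≡ j
          dist eq = cat-injective (λ j → lookup (f (lookup X j)) zero) (proj₁ fX) (cong (λ x → lookup (f x) zero) eq)

          vtx-inj : ∀ {i j} → vtx X i ≡ vtx X j → i ≡ j
          vtx-inj {i} {j} eq = let ex , ep = f-inj (X∈ (src i)) (X∈ (src j)) eq in src-pos i j (dist ex) ep

          perm : verts (zigzag (odd y) (even y)) ↭ tabulate (vtx X) ++ flat A ++ flat B ++ flat M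
          perm = ↭-trans (zigzag-verts (vtx X) (lookup A) (lookup B) (λ i → lookup M (i ↑ˡ N)) (λ i → lookup M (N ↑ʳ i)))
            (↭-reflexive (cong (λ z → tabulate (vtx X) ++ flat A ++ flat B ++ z) (sym (cat-+ N N (λ i → toList (lookup M i))))))

        abstract
          zig-path : ZigPath
          zig-path = let y , y∈ , good = dense-find good-dense space-nonempty in zig-path-from y y∈ good

-- Covering almost all vertices by tiles.

module Cover where

  open Prelude
  open Counting
  open Blowup
  open Freshness
  open Graph
  open Zigzag
  open import Data.List using (tabulate)
  open import Data.Vec.Properties using (toList∘fromList; lookup-map)

  unique-length : ∀ {n} {xs : List (Fin n)} → Unique xs → length xs ≤ n
  unique-length {n} {xs} u = ≤-trans (≤-reflexive (length-∑ xs)) (≤-trans (∑-sub (λ v → v) xs (unique-map-id u) (λ _ → 1))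
    (≤-reflexive (trans (sym (length-∑ (allFin n))) (length-allFin n))))

  ∑-toList : {A : Set} {m : ℕ} (w : Vec A m) (f : A → ℕ) → ∑ (toList w) f ≡ ∑ (allFin m) (λ i → f (lookup w i))
  ∑-toList {m = m} w f = go w f (λ i → i) (λ _ → refl)
    where
    go : ∀ {A : Set} {k m : ℕ} (w : Vec A k) {g : Fin m → A} (f : A → ℕ) (φ : Fin k → Fin m) → (∀ i → lookup w i ≡ g (φ i)) →
         ∑ (toList w) f ≡ ∑ (tabulate φ) (f ∘ g)
    go []      f φ e = refl
    go (x ∷ w) f φ e = cong₂ _+_ (cong f (e zero)) (go w f (φ ∘ suc) (e ∘ suc))

  length-filter-cnt : {A : Set} {P : A → Set} (P? : Decidable P) (xs : List A) → length (filter P? xs) ≡ cnt xs P?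
  length-filter-cnt P? []       = refl
  length-filter-cnt P? (x ∷ xs) with P? x
  ... | yes _ = cong suc (length-filter-cnt P? xs)
  ... | no _  = length-filter-cnt P? xs

  take-vec : {A : Set} {P : A → Set} (m : ℕ) {xs : List A} → m ≤ length xs → Unique xs → All P xs →
             ∃ λ (w : Vec A m) → Unique (toList w) × VAll P w × (∀ {v} → v ∈ toList w → v ∈ xs)
  take-vec zero    le u p = [] , [] , [] , λ ()
  take-vec (suc m) {x ∷ xs} (s≤s le) (a ∷ u) (p ∷ ps) =
    let w , uw , pw , sub = take-vec m le u ps
    in x ∷ w , AllB.tabulate (λ i → AllB.lookup a (sub i)) ∷ uw , p ∷ pw , λ { (here refl) → here refl ; (there i) → there (sub i) }

  abstract
    list→vec : {A : Set} (xs : List A) {m : ℕ} → length xs ≡ m → ∃ λ (w : Vec A m) → toList w ≡ xs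
    list→vec xs refl = VecB.fromList xs , toList∘fromList xs

  lookup-unique : {A : Set} {m : ℕ} (w : Vec A m) → Unique (toList w) → ∀ {i j} → lookup w i ≡ lookup w j → i ≡ j
  lookup-unique w u = cat-injective (lookup w) (subst Unique (sym (cat-toList w)) u)

  -- A tile has τ = 2qG blocks and is useful if θ = (q + 1)G of its vertices, just over τ/2, can be
  -- used. Then q tiles yield 2θq = (q + 1)τ blocks, one tile more than was spent. With one vertex
  -- per source, qG sources give exactly one tile, which is why q₁′ + 2 = qG. 1/g is a lower bound
  -- for γ, 1/e the uncovered proportion at which extension stops, and ē bounds both n/|U| and n/T.
  module CoverSizes (a b g′ q′ G′ e : ℕ) where

    open Sizes a b

    g q G τ θ′ θ q₁′ : ℕ
    g   = suc g′
    q   = suc (suc q′)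
    G   = suc G′
    τ   = 2 * (q * G)
    θ′  = G′ + q * G
    θ   = suc θ′
    q₁′ = G′ + (G′ + q′ * G)

    ē D₁ D₂ : ℕ
    ē  = e + 16 * d * g * (τ * d)
    D₁ = 8 * g
    D₂ = 8 * g * length (pow θ (allFin (τ * d)))

    module Z₁ = ZigSizes a b 0 q₁′ D₁
    module Z₂ = ZigSizes a b θ′ q′ D₂

    tupR : ℕ
    tupR = a * 1 + (ℓ * 1 + h * 1)

    coverN coverC : ℕ
    coverN = ē * (Z₁.zigN * Z₁.zigR + (Z₂.zigN * Z₂.zigR + 8 * (g + 2 * d) * tupR * tupR))
    coverC = (Z₁.zigN + Z₂.zigN) * ē ^ d

  module Covering (a b : ℕ) {n : ℕ} (S : System n) (g′ q′ G′ e : ℕ) where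

    open Graphs a b S
    open CoverSizes a b g′ q′ G′ e

    Codegrees : Set
    Codegrees = ∀ L → Unique L → length L ≡ a + d → (g + 2 * d) * n ≤ 2 * d * g * cnt (allFin n) (λ v → E? (v ∷ L))

    Tile : Set
    Tile = Vec Block τ

    -- A vector gives each vertex of a tile a position, so that one choice of positions can be
    -- shared by all tiles.
    vverts : ∀ {m} → Vec Block m → Vec V (m * d)
    vverts []            = []
    vverts ((s , m) ∷ t) = (s VecB.++ m) VecB.++ vverts t

    toList-vverts : ∀ {m} (t : Vec Block m) → toList (vverts t) ≡ verts (toList t)
    toList-vverts []            = refl
    toList-vverts ((s , m) ∷ t) = trans (toList-++ (s VecB.++ m) (vverts t)) (cong₂ _++_ (toList-++ s m) (toList-vverts t))

    tverts : Tile → List V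
    tverts t = toList (vverts t)

    tv : List Tile → List V
    tv []       = []
    tv (t ∷ ts) = tverts t ++ tv ts

    tv-++ : ∀ ts ts′ → tv (ts ++ ts′) ≡ tv ts ++ tv ts′
    tv-++ []       ts′ = refl
    tv-++ (t ∷ ts) ts′ = trans (cong (tverts t ++_) (tv-++ ts ts′)) (sym (++-assoc (tverts t) _ _))

    tv-↭ : ∀ {ts ts′} → ts ↭ ts′ → tv ts ↭ tv ts′
    tv-↭ P.refl         = ↭-refl
    tv-↭ (P.prep t p)   = ++⁺ˡ (tverts t) (tv-↭ p)
    tv-↭ (P.swap {xs} {ys} t t′ p) = ↭-trans (++⁺ˡ (tverts t) (++⁺ˡ (tverts t′) (tv-↭ p)))
      (permute 3 (λ x y z → x ⊕ (y ⊕ z) ⊜ y ⊕ (x ⊕ z)) ↭-refl (tverts t) (tverts t′) (tv ys))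
      where open Perm using (_⊕_; _⊜_) renaming (solve to permute)
    tv-↭ (P.trans p p′) = ↭-trans (tv-↭ p) (tv-↭ p′)

    length-tv : ∀ ts → length (tv ts) ≡ length ts * (τ * d)
    length-tv []       = refl
    length-tv (t ∷ ts) = trans (length-++ (tverts t)) (cong₂ _+_ (length-toList (vverts t)) (length-tv ts))

    ∈-tv : ∀ {v t ts} → t ∈ ts → v ∈ tverts t → v ∈ tv ts
    ∈-tv (here refl) j = ∈-++⁺ˡ j
    ∈-tv {ts = t ∷ ts} (there i) j = ∈-++⁺ʳ (tverts t) (∈-tv i j)

    tile-unique : ∀ {t ts} → t ∈ ts → Unique (tv ts) → Unique (tverts t)
    tile-unique {ts = t ∷ ts} (here refl) u = unique-++⁻ˡ (tverts t) u
    tile-unique {ts = t ∷ ts} (there i)   u = tile-unique i (unique-++⁻ʳ (tverts t) u)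

    same-tile : ∀ {v t t′ ts} → Unique (tv ts) → t ∈ ts → t′ ∈ ts → v ∈ tverts t → v ∈ tverts t′ → t ≡ t′
    same-tile u (here refl) (here refl) x y = refl
    same-tile {ts = t ∷ ts} u (here refl) (there j) x y = ⊥-elim (unique-++-disjoint (tverts t) u x (∈-tv j y))
    same-tile {ts = t ∷ ts} u (there i) (here refl) x y = ⊥-elim (unique-++-disjoint (tverts t) u y (∈-tv i x))
    same-tile {ts = t ∷ ts} u (there i) (there j) x y = same-tile (unique-++⁻ʳ (tverts t) u) i j x y

    unique-reps : (φ : Tile → V) → (∀ t → φ t ∈ tverts t) → ∀ {ts} → Unique (tv ts) → Unique (map φ ts)
    unique-reps φ φ∈ {[]}     u = []
    unique-reps φ φ∈ {t ∷ ts} u = AllP.map⁺ (AllB.tabulate λ {t′} i eq →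
      unique-++-disjoint (tverts t) u (φ∈ t) (∈-tv i (subst (_∈ tverts t′) (sym eq) (φ∈ t′)))) ∷ unique-reps φ φ∈ (unique-++⁻ʳ (tverts t) u)

    abstract
      chop : ∀ m st (v : Vec Block (m * τ)) → Run st (toList v) →
             ∃ λ ts → length ts ≡ m × All (λ t → Run none (toList t)) ts × tv ts ≡ verts (toList v)
      chop zero    st []  r = [] , refl , [] , refl
      chop (suc m) st v r with VecB.splitAt τ v
      ... | t , w , refl =
        let r′ = subst (Run st) (toList-++ t w) r
            ts , len , runs , eq = chop m (end st (toList t)) w (run-++⁻ʳ (toList t) r′)
        in t ∷ ts , cong suc len , run-none st (toList t) (run-++⁻ˡ (toList t) r′) ∷ runs ,
           trans (cong₂ _++_ (toList-vverts t) eq) (trans (sym (verts-++ (toList t) (toList w))) (cong verts (sym (toList-++ t w))))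

    record Family (Z : List V) : Set where
      field
        tiles : List Tile
        runs  : All (λ t → Run none (toList t)) tiles
        fresh : Fresh Z (tv tiles)
    open Family public

    uncovered : ∀ {Z} → Family Z → List V
    uncovered {Z} F = filter (λ v → ¬? (v ∈? (Z ++ tv (tiles F)))) (allFin n)

    module _ {C : ℕ} (cod : Codegrees) (sp : Sparse C) (n>0 : 0 < n) (e>0 : 0 < e) (bigC : coverC ≤ C) (bigN : coverN ≤ n) (bigq : 8 * g ≤ q′)
             {Z : List V} (smallZ : 8 * g * length Z ≤ n) where

      module _ (F : Family Z) (large : n ≤ e * length (uncovered F)) where

        private
          ts = tiles F
          us = uncovered F
          T  = length ts
          u-ts : Unique (tv ts)
          u-ts = proj₁ (fresh F)

        u-us : Unique us
        u-us = UniqueP.filter⁺ _ (UniqueP.allFin⁺ n)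

        us-∉ : ∀ {v} → v ∈ us → v ∉ Z ++ tv ts
        us-∉ i = proj₂ (∈-filter⁻ (λ v → ¬? (v ∈? (Z ++ tv ts))) {xs = allFin n} i)

        ē>0 : 0 < ē
        ē>0 = ≤-trans e>0 (m≤m+n e _)

        n≤us : n ≤ ē * length us
        n≤us = ≤-trans large (*-monoˡ-≤ (length us) (m≤m+n e _))

        us>0 : 0 < length us
        us>0 = n≢0⇒n>0 λ z → <⇒≱ n>0 (≤-trans n≤us (≤-reflexive (trans (cong (ē *_) z) (*-zeroʳ ē))))

        big : ∀ {K L} → K ≤ Z₁.zigN * Z₁.zigR + (Z₂.zigN * Z₂.zigR + 8 * (g + 2 * d) * tupR * tupR) → n ≤ ē * L → K ≤ L
        big {K} {L} le le′ = *-cancelˡ-≤ ē {{>-nonZero ē>0}} (≤-trans (*-monoʳ-≤ ē le) (≤-trans bigN le′))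

        Extended : Set
        Extended = ∃ λ (F′ : Family Z) → length (tiles F′) ≡ suc T

        module Inside = Zig a b S 0 q₁′ D₁
        module Mixed  = Zig a b S θ′ q′ D₂

        single-inj : ∀ {x x′ : V} {p p′ : Fin 1} → x ∈ us → x′ ∈ us → lookup (x ∷ []) p ≡ lookup (x′ ∷ []) p′ → x ≡ x′ × p ≡ p′
        single-inj {p = zero} {zero} _ _ eq = eq , refl

        single-unique : ∀ (p : Fin 1) → Unique (map (λ v → lookup (v ∷ []) p) us)
        single-unique zero = unique-map-id u-us

        module I = Inside.Sources us VecB.[_] us u-us single-inj single-unique

        extend-inside : I.ZigPath → Extended
        extend-inside zp =
          let v , v≡ = list→vec path (trans len (e₁ G′ q′))
              new , len-new , runs-new , tv-new = chop 1 none v (subst (Run none) (sym v≡) run)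
              tv≡ = trans tv-new (cong verts v≡)
          in record { tiles = new ++ ts ; runs = AllP.++⁺ runs-new (runs F)
                    ; fresh = subst (Fresh Z) (sym (trans (tv-++ new ts) (cong (_++ tv ts) tv≡)))
                        (UniqueP.++⁺ unique u-ts (λ (i , j) → us-∉ (inU i) (∈-++⁺ʳ Z j)) ,
                         AllP.++⁺ (AllB.tabulate (λ i j → us-∉ (inU i) (∈-++⁺ˡ j))) (proj₂ (fresh F))) } ,
             trans (length-++ new) (cong (_+ T) len-new)
          where
          open I.ZigPath zp
          e₁ : ∀ G′ q′ → (suc (suc (G′ + (G′ + q′ * suc G′) + 0))) + (suc (suc (G′ + (G′ + q′ * suc G′) + 0))) ≡ 1 * (2 * (suc (suc q′) * suc G′))
          e₁ = solve-∀
          inU : ∀ {v} → v ∈ verts path → v ∈ us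
          inU i with AllB.lookup from i
          ... | inj₁ j = j
          ... | inj₂ (j , here refl) = sources∈ j

        inside-path : Dense D₁ (us ⊗ (pow a us ⊗ (pow ℓ us ⊗ pow h us))) I.source? → I.ZigPath
        inside-path dn = I.zig-path sp ē>0 n≤us n≤us (≤-trans (*-monoˡ-≤ (ē ^ d) (m≤m+n Z₁.zigN Z₂.zigN)) bigC)
                 (big (m≤m+n _ _) n≤us) (big (m≤m+n _ _) n≤us) us>0 us>0 dn

        module _ (π : Vec (Fin (τ * d)) θ) (u-π : Unique (toList π)) where

          pick : Tile → Vec V θ
          pick t = VecB.map (lookup (vverts t)) π

          pick-lookup : ∀ t p → lookup (pick t) p ≡ lookup (vverts t) (lookup π p)
          pick-lookup t p = lookup-map p (lookup (vverts t)) π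

          pick-∈ : ∀ t p → lookup (pick t) p ∈ tverts t
          pick-∈ t p = subst (_∈ tverts t) (sym (pick-lookup t p)) (VMem.∈-toList⁺ (VMem.∈-lookup (lookup π p) (vverts t)))

          pick-inj : ∀ {t t′ p p′} → t ∈ ts → t′ ∈ ts → lookup (pick t) p ≡ lookup (pick t′) p′ → t ≡ t′ × p ≡ p′
          pick-inj {t} {t′} {p} {p′} i i′ eq with same-tile u-ts i i′ (pick-∈ t p) (subst (_∈ tverts t′) (sym eq) (pick-∈ t′ p′))
          ... | refl = refl , lookup-unique π u-π (lookup-unique (vverts t) (tile-unique i u-ts)
                         (trans (sym (pick-lookup t p)) (trans eq (pick-lookup t p′))))

          module M = Mixed.Sources ts pick us u-us pick-inj (λ p → unique-reps (λ t → lookup (pick t) p) (λ t → pick-∈ t p) u-ts)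

          -- The q source tiles are dismantled and q + 1 tiles are cut from the path. Vertices of
          -- the sources that the path does not use become uncovered again.
          extend-mixed : M.ZigPath → Extended
          extend-mixed zp =
            let v , v≡ = list→vec path (trans len (e₁ G′ q′))
                new , len-new , runs-new , tv-new = chop (suc q) none v (subst (Run none) (sym v≡) run)
                tv≡ = trans tv-new (cong verts v≡)
                rest , perm = pick-all {ys = toList sources} {ts} u-src (λ i → src∈ i)
                perm-tv = ↭-trans (tv-↭ perm) (↭-reflexive (tv-++ (toList sources) rest))
                u-split = Unique-resp-↭ perm-tv u-ts
                disj : ∀ {v} → v ∈ verts path → v ∉ tv rest
                disj = λ i j → [ (λ i′ → us-∉ i′ (∈-++⁺ʳ Z (∈-resp-↭ (↭-sym perm-tv) (∈-++⁺ʳ (tv (toList sources)) j))))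
                               , (λ i′ → unique-++-disjoint (tv (toList sources)) u-split i′ j) ]′ (where-from i)
                disjZ : ∀ {v} → v ∈ verts path → v ∉ Z
                disjZ = λ i j → [ (λ i′ → us-∉ i′ (∈-++⁺ˡ j))
                                , (λ i′ → fresh-disjoint (fresh F) (∈-resp-↭ (↭-sym perm-tv) (∈-++⁺ˡ i′)) j) ]′ (where-from i)
            in record { tiles = new ++ rest ; runs = AllP.++⁺ runs-new (AllP.++⁻ʳ (toList sources) (All-resp-↭ perm (runs F)))
                      ; fresh = subst (Fresh Z) (sym (trans (tv-++ new rest) (cong (_++ tv rest) tv≡)))
                          (UniqueP.++⁺ unique (unique-++⁻ʳ (tv (toList sources)) u-split) (λ (i , j) → disj i j) ,
                           AllP.++⁺ (AllB.tabulate disjZ) (AllP.++⁻ʳ (tv (toList sources)) (All-resp-↭ perm-tv (proj₂ (fresh F))))) } ,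
               trans (length-++ new) (trans (cong (_+ length rest) len-new) (cong suc
                 (sym (trans (↭-length perm) (trans (length-++ (toList sources)) (cong (_+ length rest) (length-toList sources)))))))
            where
            open M.ZigPath zp
            e₁ : ∀ G′ q′ → (suc (suc (q′ + (G′ + suc (suc q′) * suc G′) * suc (suc q′)))) + (suc (suc (q′ + (G′ + suc (suc q′) * suc G′) * suc (suc q′))))
                 ≡ suc (suc (suc q′)) * (2 * (suc (suc q′) * suc G′))
            e₁ = solve-∀
            u-src : Unique (toList sources)
            u-src = subst Unique (cat-toList sources) (cat-unique (lookup sources) distinct)
            src∈ : ∀ {t} → t ∈ toList sources → t ∈ ts
            src∈ i = AllB.lookup (all-toList sources∈) i
            where-from : ∀ {v} → v ∈ verts path → v ∈ us ⊎ v ∈ tv (toList sources)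
            where-from i with AllB.lookup from i
            ... | inj₁ j = inj₁ j
            ... | inj₂ (j , k) = inj₂ (∈-tv (VMem.∈-toList⁺ (VMem.∈-lookup j sources)) (pick-sub (lookup sources j) k))
              where
              pick-sub : ∀ t {v} → v ∈ toList (pick t) → v ∈ tverts t
              pick-sub t k = AllB.lookup (all-toList (pick-∈ t)) k

          mixed-path : n ≤ ē * T → Dense D₂ (ts ⊗ (pow a us ⊗ (pow ℓ us ⊗ pow h us))) M.source? → M.ZigPath
          mixed-path n≤ts dn = M.zig-path sp ē>0 n≤us n≤ts (≤-trans (*-monoˡ-≤ (ē ^ d) (m≤n+m Z₂.zigN Z₁.zigN)) bigC)
                   (big (≤-trans (m≤m+n _ _) (m≤n+m _ (Z₁.zigN * Z₁.zigR))) n≤us)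
                   (big (≤-trans (m≤m+n _ _) (m≤n+m _ (Z₁.zigN * Z₁.zigR))) n≤ts) us>0 ts>0 dn
            where
            ts>0 : 0 < T
            ts>0 = n≢0⇒n>0 λ z → <⇒≱ n>0 (≤-trans n≤ts (≤-reflexive (trans (cong (ē *_) z) (*-zeroʳ ē))))

        ws : List (Vec V a × (Vec V ℓ × Vec V h))
        ws = pow a us ⊗ (pow ℓ us ⊗ pow h us)

        flat : Vec V a × (Vec V ℓ × Vec V h) → List V
        flat (A , B , M) = toList A ++ toList B ++ toList M

        length-flat : ∀ w → length (flat w) ≡ a + d
        length-flat (A , B , M) = trans (length-++ (toList A)) (cong₂ _+_ (length-toList A) (length-++-toList B M))

        private
          W = length ws

        -- The degree condition speaks of repetition-free tuples only; the others must be so few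
        -- that the degree missing at them stays below the slack.
        repeated-rare : 8 * (g + 2 * d) * cnt ws (λ w → ¬? (unique? (flat w))) ≤ W
        repeated-rare = *-cancelˡ-≤ tupR {{>-nonZero tupR>0}} (≤-trans (≤-reflexive (r₁ tupR (8 * (g + 2 * d)) _)) (rare rr))
          where
          open Spreading {n} (8 * (g + 2 * d) * tupR) tupR
          r₁ : ∀ x y z → x * (y * z) ≡ y * x * z
          r₁ = solve-∀
          tupR>0 : 0 < tupR
          tupR>0 = ≤-trans (s≤s z≤n) (m≤n+m (ℓ * 1 + h * 1) (a * 1))
          sp-tup : ∀ r → Spread (pow r us) toList (r * 1)
          sp-tup r = spread-≗ cat-toList (spread-pow (spread-base (λ v → v) (unique-map-id u-us)
            (big (≤-trans (m≤n+m _ (Z₂.zigN * Z₂.zigR)) (m≤n+m _ (Z₁.zigN * Z₁.zigR))) n≤us)) r)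
          FA FB FM : Vec V a × (Vec V ℓ × Vec V h) → Set
          FA (A , B , M) = ¬ Fresh [] (toList A)
          FB (A , B , M) = ¬ Fresh (toList A ++ []) (toList B)
          FM (A , B , M) = ¬ Fresh (toList B ++ toList A ++ []) (toList M)
          FA? : Decidable FA
          FA? (A , B , M) = ¬? (fresh? _ _)
          FB? : Decidable FB
          FB? (A , B , M) = ¬? (fresh? _ _)
          FM? : Decidable FM
          FM? (A , B , M) = ¬? (fresh? _ _)
          l₀ : ∀ {r} (A : Vec V r) → length (toList A) ≡ r * 1
          l₀ {r} A = trans (length-toList A) (sym (*-identityʳ r))
          l₁ : ∀ {r} (A : Vec V r) → length (toList A ++ []) ≡ r * 1
          l₁ A = trans (cong length (++-identityʳ (toList A))) (l₀ A)
          split : ∀ w → ¬ Unique (flat w) → FA w ⊎ (FB w ⊎ FM w)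
          split (A , B , M) ¬u = dec-⊎ (¬? (fresh? _ _)) λ fA → dec-⊎ (¬? (fresh? _ _)) λ fB fM →
            ¬u (proj₁ (fresh-++ (decidable-stable (fresh? [] (toList A)) fA) (fresh-++ (decidable-stable (fresh? (toList A ++ []) (toList B)) fB) fM)))
          rr : Rare tupR (8 * (g + 2 * d) * tupR) ws (λ w → ¬? (unique? (flat w)))
          rr = rare-⊎ {P? = FA?} {Q? = λ w → FB? w ⊎-dec FM? w} split
            (rare-fst (spread (sp-tup a) [] (m≤m+n _ _)))
            (rare-⊎ {P? = FB?} {Q? = FM?} (λ _ z → z)
              (rare-snd λ A → rare-fst (spread (sp-tup ℓ) (toList A ++ []) (≤-trans (≤-reflexive (cong (_+ ℓ * 1) (l₁ A))) (+-monoʳ-≤ (a * 1) (m≤m+n _ _)))))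
              (rare-snd λ A → rare-snd λ B → spread (sp-tup h) (toList B ++ toList A ++ [])
                (≤-reflexive (trans (cong (_+ h * 1) (trans (length-++ (toList B)) (cong₂ _+_ (l₀ B) (l₁ A)))) (r₂ (ℓ * 1) (a * 1) (h * 1))))))
            where r₂ : ∀ x y z → x + y + z ≡ y + (x + z)
                  r₂ = solve-∀

        nb : Tile → Vec V a × (Vec V ℓ × Vec V h) → ℕ
        nb t w = cnt (tverts t) (λ v → E? (v ∷ flat w))

        private
          Snb = ∑ ws (λ w → ∑ ts (λ t → nb t w))
          cU  = cnt (us ⊗ ws) I.source?

        ∑-tv : ∀ (f : V → ℕ) ts → ∑ (tv ts) f ≡ ∑ ts (λ t → ∑ (tverts t) f)
        ∑-tv f []       = refl
        ∑-tv f (t ∷ ts) = trans (∑-++ (tverts t) (tv ts) f) (cong (∑ (tverts t) f +_) (∑-tv f ts))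

        degree-≤ : ∀ w → cnt (allFin n) (λ v → E? (v ∷ flat w)) ≤ length Z + ∑ ts (λ t → nb t w) + cnt us (λ v → E? (v ∷ flat w))
        degree-≤ w = let rest , p = pick-all {ws = Z ++ tv ts ++ us} (UniqueP.allFin⁺ n) (λ {v} _ → everywhere v) in begin
          ∑ (allFin n) f                         ≤⟨ m≤m+n _ (∑ rest f) ⟩
          ∑ (allFin n) f + ∑ rest f              ≡⟨ trans (sym (∑-++ (allFin n) rest f)) (sym (∑-↭ f p)) ⟩
          ∑ (Z ++ tv ts ++ us) f                 ≡⟨ trans (∑-++ Z _ f) (cong (∑ Z f +_) (∑-++ (tv ts) us f)) ⟩
          ∑ Z f + (∑ (tv ts) f + ∑ us f)         ≡⟨ sym (+-assoc (∑ Z f) _ _) ⟩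
          ∑ Z f + ∑ (tv ts) f + ∑ us f           ≤⟨ +-monoˡ-≤ (∑ us f) (+-mono-≤ (cnt≤length Z (λ v → E? (v ∷ flat w))) (≤-reflexive (∑-tv f ts))) ⟩
          length Z + ∑ ts (λ t → nb t w) + ∑ us f ∎
          where
          open ≤-Reasoning
          f : V → ℕ
          f v = ind (E? (v ∷ flat w))
          everywhere : ∀ v → v ∈ Z ++ tv ts ++ us
          everywhere v with v ∈? (Z ++ tv ts)
          ... | yes i = subst (v ∈_) (++-assoc Z (tv ts) us) (∈-++⁺ˡ i)
          ... | no ¬i = ∈-++⁺ʳ Z (∈-++⁺ʳ (tv ts) (∈-filter⁺ (λ v → ¬? (v ∈? (Z ++ tv ts))) (∈-allFin v) ¬i))

        ∑-degrees : ∑ ws (λ w → cnt (allFin n) (λ v → E? (v ∷ flat w))) ≤ W * length Z + Snb + cU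
        ∑-degrees = begin
          ∑ ws (λ w → cnt (allFin n) (λ v → E? (v ∷ flat w)))  ≤⟨ ∑-mono ws degree-≤ ⟩
          ∑ ws (λ w → length Z + ∑ ts (λ t → nb t w) + cnt us (λ v → E? (v ∷ flat w)))
            ≡⟨ trans (∑-+ ws _ _) (cong₂ _+_ (trans (∑-+ ws _ _) (cong (_+ Snb) (∑-const (length Z) ws))) refl) ⟩
          W * length Z + Snb + ∑ ws (λ w → cnt us (λ v → E? (v ∷ flat w)))
            ≡⟨ cong (W * length Z + Snb +_) (∑-swap ws us _) ⟩
          W * length Z + Snb + ∑ us (λ v → cnt ws (λ w → E? (v ∷ flat w)))
            ≤⟨ +-monoʳ-≤ _ (∑-mono us (λ v → cnt-mono ws _ (λ w → I.source? (v , w)) (λ w _ e → e ∷ []))) ⟩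
          W * length Z + Snb + ∑ us (λ v → cnt ws (λ w → I.source? (v , w)))
            ≡⟨ cong (W * length Z + Snb +_) (∑-⊗ us ws _) ⟨
          W * length Z + Snb + cU ∎
          where open ≤-Reasoning

        degree-sum : (g + 2 * d) * n * W ≤ (g + 2 * d) * n * cnt ws (λ w → ¬? (unique? (flat w))) + 2 * d * g * (W * length Z + Snb + cU)
        degree-sum = begin
          X * W                                 ≡⟨ trans (*-comm X W) (sym (∑-const X ws)) ⟩
          ∑ ws (λ _ → X)                        ≤⟨ ∑-mono ws bound ⟩
          ∑ ws (λ w → X * ind (¬? (unique? (flat w))) + 2 * d * g * cnt (allFin n) (λ v → E? (v ∷ flat w)))
            ≡⟨ trans (∑-+ ws _ _) (cong₂ _+_ (∑-*ˡ X ws _) (∑-*ˡ (2 * d * g) ws _)) ⟩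
          X * cnt ws (λ w → ¬? (unique? (flat w))) + 2 * d * g * ∑ ws (λ w → cnt (allFin n) (λ v → E? (v ∷ flat w)))
            ≤⟨ +-monoʳ-≤ (X * cnt ws (λ w → ¬? (unique? (flat w)))) (*-monoʳ-≤ (2 * d * g) ∑-degrees) ⟩
          X * cnt ws (λ w → ¬? (unique? (flat w))) + 2 * d * g * (W * length Z + Snb + cU) ∎
          where
          open ≤-Reasoning
          X = (g + 2 * d) * n
          bound : ∀ w → X ≤ X * ind (¬? (unique? (flat w))) + 2 * d * g * cnt (allFin n) (λ v → E? (v ∷ flat w))
          bound w = by (unique? (flat w))
            where
            by : Dec (Unique (flat w)) → X ≤ X * ind (¬? (unique? (flat w))) + 2 * d * g * cnt (allFin n) (λ v → E? (v ∷ flat w))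
            by (yes u) = ≤-trans (cod (flat w) u (length-flat w)) (m≤n+m _ (X * ind (¬? (unique? (flat w)))))
            by (no ¬u) = ≤-trans (≤-reflexive (sym (trans (cong (X *_) (ind-yes (¬? (unique? (flat w))) ¬u)) (*-identityʳ X)))) (m≤m+n _ _)

        module _ (sparse-inside : 8 * g * cU ≤ length us * W) where

          -- Almost all of the degree of U^(k-1) goes into the tiles.
          key : 8 * (g + 2 * d) * (n * W) ≤ n * W + 4 * d * (n * W) + 2 * d * (8 * g * Snb)
          key = begin
            8 * (g + 2 * d) * (n * W)             ≡⟨ r₁ (g + 2 * d) n W ⟩
            8 * ((g + 2 * d) * n * W)             ≤⟨ *-monoʳ-≤ 8 degree-sum ⟩
            8 * ((g + 2 * d) * n * B + 2 * d * g * (W * length Z + Snb + cU))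
              ≡⟨ r₂ (g + 2 * d) n B d g W (length Z) Snb cU ⟩
            n * (8 * (g + 2 * d) * B) + 2 * d * (8 * g * length Z) * W + 2 * d * (8 * g * cU) + 2 * d * (8 * g * Snb)
              ≤⟨ +-monoˡ-≤ _ (+-mono-≤ (+-mono-≤ (*-monoʳ-≤ n repeated-rare) (*-monoˡ-≤ W (*-monoʳ-≤ (2 * d) smallZ)))
                   (*-monoʳ-≤ (2 * d) (≤-trans sparse-inside (*-monoˡ-≤ W (unique-length u-us))))) ⟩
            n * W + 2 * d * n * W + 2 * d * (n * W) + 2 * d * (8 * g * Snb)
              ≡⟨ cong (_+ 2 * d * (8 * g * Snb)) (r₃ n W d) ⟩
            n * W + 4 * d * (n * W) + 2 * d * (8 * g * Snb) ∎
            where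
            open ≤-Reasoning
            B = cnt ws (λ w → ¬? (unique? (flat w)))
            r₁ : ∀ x n W → 8 * x * (n * W) ≡ 8 * (x * n * W)
            r₁ = solve-∀
            r₂ : ∀ x n B d g W z s c → 8 * (x * n * B + 2 * d * g * (W * z + s + c)) ≡
                   n * (8 * x * B) + 2 * d * (8 * g * z) * W + 2 * d * (8 * g * c) + 2 * d * (8 * g * s)
            r₂ = solve-∀
            r₃ : ∀ n W d → n * W + 2 * d * n * W + 2 * d * (n * W) ≡ n * W + 4 * d * (n * W)
            r₃ = solve-∀

          T-tiles : T * (τ * d) ≤ n
          T-tiles = ≤-trans (≤-reflexive (sym (length-tv ts))) (unique-length u-ts)

          -- The tiles receive linear degree on average, and each offers at most τd vertices, so
          -- there are linearly many tiles.
          n≤ts : n ≤ ē * T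
          n≤ts = ≤-trans (*-cancelʳ-≤ n _ W {{>-nonZero W>0}} (≤-trans (slack g (a + suc b) (n * W) _ (≤-trans key (+-monoʳ-≤ (n * W + 4 * d * (n * W)) (*-monoʳ-≤ (2 * d) (*-monoʳ-≤ (8 * g) Snb≤)))))
              (≤-reflexive (r₁ d g (τ * d) T W)))) (*-monoˡ-≤ T (m≤n+m (16 * d * g * (τ * d)) e))
            where
            open ≤-Reasoning
            Snb≤ : Snb ≤ W * (T * (τ * d))
            Snb≤ = ≤-trans (∑-mono ws (λ w → ≤-trans (∑-mono ts (λ t → ≤-trans (cnt≤length (tverts t) _) (≤-reflexive (length-toList (vverts t))))) (≤-reflexive (∑-const (τ * d) ts))))
              (≤-reflexive (∑-const (T * (τ * d)) ws))
            r₁ : ∀ d g x T W → 2 * d * (8 * g * (W * (T * x))) ≡ 16 * d * g * x * T * W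
            r₁ = solve-∀
            slack : ∀ g d′ x s → 8 * (g + 2 * suc d′) * x ≤ x + 4 * suc d′ * x + s → x ≤ s
            slack g d′ x s le = +-cancelˡ-≤ (x + 4 * suc d′ * x) _ _ (≤-trans (≤-trans (+-monoʳ-≤ (x + 4 * suc d′ * x) (m≤m+n x ((8 * g + 12 * d′ + 10) * x))) (≤-reflexive (sym (r g d′ x)))) le)
              where r : ∀ g d′ x → 8 * (g + 2 * suc d′) * x ≡ x + 4 * suc d′ * x + (x + (8 * g + 12 * d′ + 10) * x)
                    r = solve-∀
            W>0 : 0 < W
            W>0 = ⊗-nonempty (pow-nonempty a us>0) (⊗-nonempty (pow-nonempty ℓ us>0) (pow-nonempty h us>0))

          good? : Decidable (λ ((t , w) : Tile × (Vec V a × (Vec V ℓ × Vec V h))) → θ ≤ nb t w)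
          good? (t , w) = θ ≤? nb t w

          -- Bookkeeping in units of nW, after multiplication by 16dg: the surplus 1/g of the degree
          -- is worth 16d. Against it stand repetitions with 1, Z with 2d, edges inside U with 2d,
          -- the excess of θ over τ/2 with 1, and, if good pairs were few, these with 2d. But 6d + 2
          -- < 16d.
          good-dense : ¬ (8 * g * cnt (ts ⊗ ws) good? ≤ T * W)
          good-dense few = <⇒≱ nW>0 (tight g (a + suc b) (n * W) (≤-trans key (+-monoʳ-≤ (n * W + 4 * d * (n * W)) bound)))
            where
            open ≤-Reasoning
            nW>0 : 0 < n * W
            nW>0 = *-mono-≤ n>0 (⊗-nonempty (pow-nonempty a us>0) (⊗-nonempty (pow-nonempty ℓ us>0) (pow-nonempty h us>0)))
            cG = cnt (ts ⊗ ws) good?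
            tight : ∀ g d′ x → 8 * (g + 2 * suc d′) * x ≤ x + 4 * suc d′ * x + (8 * g * x + x + 2 * suc d′ * x) → x ≤ 0
            tight g d′ x le = ≤-trans (m≤m+n x ((10 * d′ + 7) * x)) (+-cancelˡ-≤ (x + 4 * suc d′ * x + (8 * g * x + x + 2 * suc d′ * x)) _ _
              (≤-trans (≤-reflexive (sym (r g d′ x))) (≤-trans le (≤-reflexive (sym (+-identityʳ _))))))
              where r : ∀ g d′ x → 8 * (g + 2 * suc d′) * x ≡ x + 4 * suc d′ * x + (8 * g * x + x + 2 * suc d′ * x) + (x + (10 * d′ + 7) * x)
                    r = solve-∀
            nb≤ : ∀ t w → nb t w ≤ θ + τ * d * ind (good? (t , w))
            nb≤ t w = by (θ ≤? nb t w)
              where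
              by : (g : Dec (θ ≤ nb t w)) → nb t w ≤ θ + τ * d * ind g
              by (yes _) = ≤-trans (≤-trans (cnt≤length (tverts t) _) (≤-reflexive (trans (length-toList (vverts t)) (sym (*-identityʳ _))))) (m≤n+m _ θ)
              by (no ¬p) = ≤-trans (<⇒≤ (≰⇒> ¬p)) (m≤m+n θ _)
            Snb≤ : Snb ≤ T * W * θ + τ * d * cG
            Snb≤ = begin
              ∑ ws (λ w → ∑ ts (λ t → nb t w))                                   ≡⟨ ∑-swap ws ts _ ⟩
              ∑ ts (λ t → ∑ ws (λ w → nb t w))                                   ≤⟨ ∑-mono ts (λ t → ∑-mono ws (λ w → nb≤ t w)) ⟩
              ∑ ts (λ t → ∑ ws (λ w → θ + τ * d * ind (good? (t , w))))          ≡⟨ ∑-⊗ ts ws _ ⟨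
              ∑ (ts ⊗ ws) (λ p → θ + τ * d * ind (good? p))                      ≡⟨ trans (∑-+ (ts ⊗ ws) _ _) (cong₂ _+_ (∑-const θ (ts ⊗ ws)) (∑-*ˡ (τ * d) (ts ⊗ ws) _)) ⟩
              length (ts ⊗ ws) * θ + τ * d * cG                                  ≡⟨ cong (λ z → z * θ + τ * d * cG) (length-⊗ ts ws) ⟩
              T * W * θ + τ * d * cG                                             ∎
            -- As qθ = (q + 1)τ/2 and Tτd ≤ n, 2dTθ is at most n(1 + 1/q); the hypothesis 8g ≤ q′
            -- makes the excess at most n/8g.
            θ-bound : 8 * g * (2 * d * T * θ) ≤ 8 * g * n + n
            θ-bound = *-cancelˡ-≤ q (begin
              q * (8 * g * (2 * d * T * θ))                ≡⟨ r₁ q′ g d T G′ ⟩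
              8 * g * (T * (τ * d) * suc q)                ≤⟨ *-monoʳ-≤ (8 * g) (*-monoˡ-≤ (suc q) T-tiles) ⟩
              8 * g * (n * suc q)                          ≡⟨ r₂ g n q ⟩
              q * (8 * g * n) + 8 * g * n                  ≤⟨ +-monoʳ-≤ (q * (8 * g * n)) (*-monoˡ-≤ n (≤-trans bigq (≤-trans (n≤1+n q′) (n≤1+n (suc q′))))) ⟩
              q * (8 * g * n) + q * n                      ≡⟨ *-distribˡ-+ q (8 * g * n) n ⟨
              q * (8 * g * n + n)                          ∎)
              where
              r₁ : ∀ q′ g d T G′ → suc (suc q′) * (8 * g * (2 * d * T * suc (G′ + suc (suc q′) * suc G′))) ≡
                     8 * g * (T * (2 * (suc (suc q′) * suc G′) * d) * suc (suc (suc q′)))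
              r₁ = solve-∀
              r₂ : ∀ g n q → 8 * g * (n * suc q) ≡ q * (8 * g * n) + 8 * g * n
              r₂ = solve-∀
            bound : 2 * d * (8 * g * Snb) ≤ 8 * g * (n * W) + n * W + 2 * d * (n * W)
            bound = begin
              2 * d * (8 * g * Snb)                                               ≤⟨ *-monoʳ-≤ (2 * d) (*-monoʳ-≤ (8 * g) Snb≤) ⟩
              2 * d * (8 * g * (T * W * θ + τ * d * cG))                          ≡⟨ r₁ d g T W θ (τ * d) cG ⟩
              8 * g * (2 * d * T * θ) * W + 2 * d * (τ * d * (8 * g * cG))        ≤⟨ +-mono-≤ (*-monoˡ-≤ W θ-bound) (*-monoʳ-≤ (2 * d) (*-monoʳ-≤ (τ * d) few)) ⟩
              (8 * g * n + n) * W + 2 * d * (τ * d * (T * W))                     ≡⟨ r₂ g n W d (τ * d) T ⟩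
              8 * g * (n * W) + n * W + 2 * d * (T * (τ * d) * W)                 ≤⟨ +-monoʳ-≤ (8 * g * (n * W) + n * W) (*-monoʳ-≤ (2 * d) (*-monoˡ-≤ W T-tiles)) ⟩
              8 * g * (n * W) + n * W + 2 * d * (n * W)                           ∎
              where
              r₁ : ∀ d g T W θ x c → 2 * d * (8 * g * (T * W * θ + x * c)) ≡ 8 * g * (2 * d * T * θ) * W + 2 * d * (x * (8 * g * c))
              r₁ = solve-∀
              r₂ : ∀ g n W d x T → (8 * g * n + n) * W + 2 * d * (x * (T * W)) ≡ 8 * g * (n * W) + n * W + 2 * d * (T * x * W)
              r₂ = solve-∀

        At : Vec (Fin (τ * d)) θ → Tile × (Vec V a × (Vec V ℓ × Vec V h)) → Set
        At π (t , w) = Unique (toList π) × VAll (λ v → E (v ∷ flat w)) (VecB.map (lookup (vverts t)) π)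

        at? : ∀ π → Decidable (At π)
        at? π (t , w) = AllPairs.allPairs? (λ x y → ¬? (x FinB.≟ y)) (toList π) ×-dec VAllB.all? (λ v → E? (v ∷ flat w)) (VecB.map (lookup (vverts t)) π)

        positions : ∀ t w → θ ≤ nb t w → Any (λ π → At π (t , w)) (pow θ (allFin (τ * d)))
        positions t w le =
          let π , u , ok , _ = take-vec {P = λ i → E (lookup (vverts t) i ∷ flat w)} θ {ps}
                (≤-trans le (≤-reflexive (trans (∑-toList (vverts t) _) (sym (length-filter-cnt p? (allFin (τ * d)))))))
                (UniqueP.filter⁺ p? (UniqueP.allFin⁺ (τ * d))) (AllP.all-filter p? (allFin (τ * d)))
          in lose (∈-pow⁺ (λ i → ∈-allFin (lookup π i))) (u , map-all ok)
          where
          p? = λ i → E? (lookup (vverts t) i ∷ flat w)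
          ps = filter p? (allFin (τ * d))
          map-all : ∀ {m} {π : Vec (Fin (τ * d)) m} → VAll (λ i → E (lookup (vverts t) i ∷ flat w)) π →
                    VAll (λ v → E (v ∷ flat w)) (VecB.map (lookup (vverts t)) π)
          map-all []       = []
          map-all (o ∷ os) = o ∷ map-all os

        extend : Extended
        extend = by (dense? D₁ (us ⊗ ws) I.source?)
          where
          module _ (¬dn : ¬ Dense D₁ (us ⊗ ws) I.source?) where
            few : 8 * g * cU ≤ length us * W
            few = ≤-trans (<⇒≤ (≰⇒> (λ le → ¬dn (mkDense le)))) (≤-reflexive (length-⊗ us ws))

            gd : Dense (8 * g) (ts ⊗ ws) (good? few)
            gd = mkDense (≤-trans (≤-reflexive (length-⊗ ts ws)) (<⇒≤ (≰⇒> (good-dense few))))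

            T>0 : 0 < T
            T>0 = n≢0⇒n>0 λ z → <⇒≱ n>0 (≤-trans (n≤ts few) (≤-reflexive (trans (cong (ē *_) z) (*-zeroʳ ē))))

            mixed : Extended
            mixed =
              -- The zigzag needs the same θ positions in every tile. A pigeonhole over all position
              -- vectors finds them and accounts for the second factor of `D₂`.
              let π , _ , dπ = dense-pigeonhole {P? = good? few} (pow θ (allFin (τ * d))) at?
                    (pow-nonempty θ (subst (0 <_) (sym (length-allFin (τ * d))) (s≤s z≤n))) (λ (t , w) _ → positions t w) gd
                  _ , _ , (u-π , _) = dense-find dπ (⊗-nonempty T>0 (⊗-nonempty (pow-nonempty a us>0) (⊗-nonempty (pow-nonempty ℓ us>0) (pow-nonempty h us>0))))
              in extend-mixed π u-π (mixed-path π u-π (n≤ts few) (dense-mono (λ _ _ → proj₂) dπ))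

          by : Dec (Dense D₁ (us ⊗ ws) I.source?) → Extended
          by (yes dn) = extend-inside (inside-path dn)
          by (no ¬dn) = mixed ¬dn

      -- Each extension adds one tile, and there are never more than n of them, so the fuel m cannot
      -- run out.
      cover-from : ∀ m (F : Family Z) → n < length (tiles F) + m → ∃ λ (F′ : Family Z) → e * length (uncovered F′) < n
      cover-from m F bound = by (n ≤? e * length (uncovered F))
        where
        T≤n : length (tiles F) ≤ n
        T≤n = ≤-trans (m≤m*n (length (tiles F)) (τ * d)) (≤-trans (≤-reflexive (sym (length-tv (tiles F)))) (unique-length (proj₁ (fresh F))))
        next : ∀ m → n < length (tiles F) + m → n ≤ e * length (uncovered F) → ∃ λ (F′ : Family Z) → e * length (uncovered F′) < n
        next zero    lt _     = ⊥-elim (<⇒≱ lt (≤-trans (≤-reflexive (+-identityʳ _)) T≤n))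
        next (suc m) lt large = let F′ , len = extend F large in cover-from m F′ (subst (n <_) (trans (+-suc _ m) (cong (_+ m) (sym len))) lt)
        by : Dec (n ≤ e * length (uncovered F)) → ∃ λ (F′ : Family Z) → e * length (uncovered F′) < n
        by (no ¬p) = F , ≰⇒> ¬p
        by (yes p) = next m bound p

      cover : ∃ λ (F : Family Z) → e * length (uncovered F) < n
      cover = cover-from (suc n) (record { tiles = [] ; runs = [] ; fresh = fresh-[] }) ≤-refl

-- Joining absorbers, reservoir and tiles into a closed run.

module Assembly where

  open Prelude
  open Counting
  open Greedy
  open Freshness
  open Graph
  open Connector
  open Absorber
  open Zigzag using (pick-all)
  open Cover
  open Blowup using () renaming (⊗-nonempty to ⊗>0)
  open import Data.Nat.Divisibility using (_∣_; divides; ∣m+n∣m⇒∣n; n∣m*n)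
  open import Data.List.Properties using (length-filter; ∷-injective)
  open import Data.List.Relation.Binary.Permutation.Propositional.Properties using (↭-map-inv; map⁺)

  unique-full : ∀ {n} {xs : List (Fin n)} → Unique xs → (∀ v → v ∈ xs) → xs ↭ allFin n
  unique-full {n} {xs} u all with pick-all {ws = xs} (UniqueP.allFin⁺ n) (λ _ → all _)
  ... | []       , p = ↭-trans p (↭-reflexive (++-identityʳ _))
  ... | v ∷ rest , p = ⊥-elim (<⇒≱ (s≤s (m≤m+n n (length rest)))
      (≤-trans (≤-reflexive (sym (trans (↭-length p) (trans (length-++ (allFin n)) (trans (cong (_+ suc (length rest)) (length-allFin n)) (+-suc n _))))))
        (unique-length u)))

  module AssemblySizes (a b w : ℕ) where

    open Sizes a b

    t₁ t₂ κ m₁ m₂ used spare : ℕ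
    t₁    = absD + suc absD
    t₂    = connD + suc connD
    κ     = suc (h + t₂ * 2 * connSize)
    m₁    = t₁ * (κ * w + κ * w)
    m₂    = t₂ * (w + w)
    used  = m₁ * absSize + m₂ * connSize
    spare = k + (d + absSize) + (connSize + (ℓ + ℓ))

  module Segments (a b : ℕ) {n : ℕ} (S : System n) where

    open Graphs a b S
    open Connect a b S
    open Absorb a b S
    open Perm using (_⊕_; _⊜_; id) renaming (solve to permute)

    Place : Set
    Place = Block × Vec V ℓ

    absV : List AbsV → List V
    absV []       = []
    absV (y ∷ us) = absVerts y ++ absV us

    length-absV : ∀ us → length (absV us) ≡ length us * absSize
    length-absV []       = refl
    length-absV (y ∷ us) = trans (length-++ (absVerts y)) (cong₂ _+_ (length-absVerts y) (length-absV us))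

    resV : List ConnV → List V
    resV []       = []
    resV (y ∷ us) = connVerts y ++ resV us

    resV-++ : ∀ xs ys → resV (xs ++ ys) ≡ resV xs ++ resV ys
    resV-++ []       ys = refl
    resV-++ (x ∷ xs) ys = trans (cong (connVerts x ++_) (resV-++ xs ys)) (sym (++-assoc (connVerts x) _ _))

    length-resV : ∀ us → length (resV us) ≡ length us * connSize
    length-resV []       = refl
    length-resV (y ∷ us) = trans (length-++ (connVerts y)) (cong₂ _+_ (length-connVerts y) (length-resV us))

    resV-↭ : ∀ {xs ys} → xs ↭ ys → resV xs ↭ resV ys
    resV-↭ P.refl = ↭-refl
    resV-↭ (P.prep x p) = ++⁺ˡ (connVerts x) (resV-↭ p)
    resV-↭ (P.swap {ys = ys} x y p) = ↭-trans (++⁺ˡ (connVerts x) (++⁺ˡ (connVerts y) (resV-↭ p)))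
      (permute 3 (λ x y z → x ⊕ (y ⊕ z) ⊜ y ⊕ (x ⊕ z)) ↭-refl (connVerts x) (connVerts y) (resV ys))
    resV-↭ (P.trans p p′) = ↭-trans (resV-↭ p) (resV-↭ p′)

    tupV : List (Vec V d) → List V
    tupV []       = []
    tupV (z ∷ zs) = toList z ++ tupV zs

    tupV-↭ : ∀ {xs ys} → xs ↭ ys → tupV xs ↭ tupV ys
    tupV-↭ P.refl = ↭-refl
    tupV-↭ (P.prep x p) = ++⁺ˡ (toList x) (tupV-↭ p)
    tupV-↭ (P.swap {ys = ys} x y p) = ↭-trans (++⁺ˡ (toList x) (++⁺ˡ (toList y) (tupV-↭ p)))
      (permute 3 (λ x y z → x ⊕ (y ⊕ z) ⊜ y ⊕ (x ⊕ z)) ↭-refl (toList x) (toList y) (tupV ys))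
    tupV-↭ (P.trans p p′) = ↭-trans (tupV-↭ p) (tupV-↭ p′)

    chunk : ∀ m (xs : List V) → length xs ≡ m * d → ∃ λ zs → tupV zs ≡ xs × length zs ≡ m
    chunk zero    []       len = [] , refl , refl
    chunk (suc m) xs       len with list→vec xs len
    ... | v , refl with VecB.splitAt d v
    ...   | z , w , refl =
      let zs , eq , len′ = chunk m (toList w) (length-toList w)
      in z ∷ zs , trans (cong (toList z ++_) eq) (sym (toList-++ z w)) , cong suc len′

    -- A tile prepared for joining: no edge belongs to its first block, so the site of that block
    -- becomes the entry, and its h remaining vertices are given up.
    Seg : Set
    Seg = Vec V ℓ × Block × List Block

    SegOK : Seg → Set
    SegOK (s , b , bs) = Run (at s) (b ∷ bs)

    segEnd : Vec V ℓ → Block → List Block → Place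
    segEnd s b []        = b , s
    segEnd s b (b′ ∷ bs) = segEnd (site b) b′ bs

    end-seg : ∀ {c p} s b bs → site c ≡ s → end (on c p) (b ∷ bs) ≡ uncurry on (segEnd s b bs)
    end-seg s b []        refl = refl
    end-seg s b (b′ ∷ bs) refl = end-seg {b} {s} (site b) b′ bs refl

    segV : List Seg → List V
    segV []                   = []
    segV ((s , b , bs) ∷ sgs) = (toList s ++ verts (b ∷ bs)) ++ segV sgs

    segV-++ : ∀ xs ys → segV (xs ++ ys) ≡ segV xs ++ segV ys
    segV-++ []                  ys = refl
    segV-++ ((s , b , bs) ∷ xs) ys = trans (cong ((toList s ++ verts (b ∷ bs)) ++_) (segV-++ xs ys)) (sym (++-assoc (toList s ++ verts (b ∷ bs)) _ _))

    Demand : Set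
    Demand = Place × Place

    demands : Place → List Seg → List Demand
    demands q []                   = []
    demands q ((s , b , bs) ∷ sgs) = (q , b , s) ∷ demands (segEnd s b bs) sgs

    length-demands : ∀ q sgs → length (demands q sgs) ≡ length sgs
    length-demands q []                   = refl
    length-demands q ((s , b , bs) ∷ sgs) = cong suc (length-demands (segEnd s b bs) sgs)

    final : Place → List Seg → Place
    final q []                   = q
    final q ((s , b , bs) ∷ sgs) = final (segEnd s b bs) sgs

    final-++ : ∀ q sgs s b → final q (sgs ++ (s , b , []) ∷ []) ≡ (b , s)
    final-++ q []                    s b = refl
    final-++ q ((s′ , b′ , bs) ∷ sgs) s b = final-++ (segEnd s′ b′ bs) sgs s b

    Valid : Demand → Set
    Valid ((c , p) , (b , s)) = E (ed c p) × E (ed b s)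

    valid? : Decidable Valid
    valid? ((c , p) , (b , s)) = E? (ed c p) ×-dec E? (ed b s)

    seg-edge : ∀ s b bs → Run (at s) (b ∷ bs) → E (uncurry ed (segEnd s b bs))
    seg-edge s b []        (e , _)             = e
    seg-edge s b (b′ ∷ bs) (e , (e′ , _) , r) = seg-edge (site b) b′ bs (e′ , r)

    demands-valid : ∀ q sgs → E (uncurry ed q) → All SegOK sgs → All Valid (demands q sgs)
    demands-valid q []                   e []       = []
    demands-valid q ((s , b , bs) ∷ sgs) e (r ∷ rs) = (e , proj₁ r) ∷ demands-valid (segEnd s b bs) sgs (seg-edge s b bs r) rs

    Serves : Demand → List V → ConnV → Set
    Serves ((c , p) , (b , s)) F y = ConnOK c p s (col (ed b s)) (col (ed b s)) F y

    serves? : ∀ x F → Decidable (Serves x F)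
    serves? ((c , p) , (b , s)) F y = ConnOK? c p s (col (ed b s)) (col (ed b s)) F y

    join : ∀ q sgs (ps : List (Demand × ConnV)) → demands q sgs ≡ map proj₁ ps → All SegOK sgs →
           All (λ p → ∃ λ F → Serves (proj₁ p) F (proj₂ p)) ps →
           ∃ λ bs → Run (uncurry on q) bs × end (uncurry on q) bs ≡ uncurry on (final q sgs) × verts bs ↭ segV sgs ++ resV (map proj₂ ps)
    join q [] []       eq rs ok = [] , tt , refl , ↭-refl
    join q [] (_ ∷ _)  () rs ok
    join q (_ ∷ _) []  () rs ok
    join q ((s , b , bs) ∷ sgs) ((x , y@(T₁ , M₁ , T₂ , M₂ , M₃)) ∷ ps) eq (r ∷ rs) ((F , rc , (ne , _) , fr) ∷ ok) with refl ← proj₁ (∷-injective eq) =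
      let path , run , fin , vs = join (segEnd s b bs) sgs ps (proj₂ (∷-injective eq)) rs ok
          cb = connBlocks s y
          ends : end (on (s , M₃) T₂) (b ∷ bs) ≡ uncurry on (segEnd s b bs)
          ends = end-seg {s , M₃} {T₂} s b bs refl
      in cb ++ (b ∷ bs) ++ path ,
         run-++⁺ {uncurry on q} cb {(b ∷ bs) ++ path} rc (run-++⁺ {on (s , M₃) T₂} (b ∷ bs) (run-on (s , M₃) T₂ b bs r ne) (subst (λ st → Run st path) (sym ends) run)) ,
         trans (end-++ {uncurry on q} cb {(b ∷ bs) ++ path}) (trans (end-++ {on (s , M₃) T₂} (b ∷ bs) {path}) (trans (cong (λ st → end st path) ends) fin)) ,
         ↭-trans (↭-reflexive (trans (verts-++ cb ((b ∷ bs) ++ path)) (cong (verts cb ++_) (verts-++ (b ∷ bs) path))))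
           (↭-trans (++⁺ (conn-verts s y) (++⁺ˡ (verts (b ∷ bs)) vs))
             (permute 5 (λ s c v sg rv → (s ⊕ c) ⊕ (v ⊕ (sg ⊕ rv)) ⊜ ((s ⊕ v) ⊕ sg) ⊕ (c ⊕ rv)) ↭-refl (toList s) (connVerts y) (verts (b ∷ bs)) (segV sgs) (resV (map proj₂ ps))))

    record HamiltonRun : Set where
      field
        start  : Place
        blocks : List Block
        run    : Run (uncurry on start) blocks
        closed : end (uncurry on start) blocks ≡ uncurry on start
        spans  : verts blocks ↭ allFin n

  module Assemble (a b : ℕ) {n : ℕ} (S : System n) (g′ q′ G′ w : ℕ) where

    open Graphs a b S
    open Connect a b S
    open Absorb a b S
    open Segments a b S
    open CoverSizes a b g′ q′ G′ (suc G′) using (g; coverN; coverC; τ; q; G)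
    open Covering a b S g′ q′ G′ (suc G′)
    open Perm using (_⊕_; _⊜_; id) renaming (solve to permute)

    open AssemblySizes a b w

    module _ {C : ℕ} (deg : Degrees) (cod : Codegrees) (sp : Sparse C) (n>0 : 0 < n) (d∣n : d ∣ n)
             (C₁ : 5 * connD ≤ C) (C₂ : 2 * exD ≤ C) (C₃ : 3 * mainD ≤ C)
             (bigC : coverC ≤ C) (bigN : coverN ≤ n) (bigq : 8 * g ≤ q′)
             (room₁ : D₀ * (spare + used) ≤ n) (room₂ : 8 * g * (spare + used) ≤ n)
             (expo : n ^ (k + k) < 2 ^ w) (n<W : n < suc G′ * suc w) where

      room-within : ∀ {m F} → m + length F ≤ spare + used → Room m F
      room-within le = mkRoom (≤-trans (*-monoʳ-≤ D₀ le) room₁)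

      abstract
        -- The cycle is cut open at this edge: the run starts behind it and returns to it as its
        -- last edge.
        start-edge : ∃ λ (q : Place) → E (uncurry ed q)
        start-edge =
          let v , _ , e , _ = dense-find (close deg (a + d) [] [] [] (λ i → i) (+-identityʳ k)
                (room-within (≤-trans (≤-reflexive (+-identityʳ k)) (≤-trans (≤-trans (m≤m+n k (d + absSize)) (m≤m+n _ (connSize + (ℓ + ℓ)))) (m≤m+n spare used)))))
                (tup-nonempty k n>0)
              p , v₁ , eq₁ = VecB.splitAt ℓ v
              s , m , eq₂  = VecB.splitAt ℓ v₁
          in ((s , m) , p) , subst E (trans (++-identityʳ (toList v)) (trans (cong toList eq₁) (trans (toList-++ p v₁)
               (cong (toList p ++_) (trans (cong toList eq₂) (toList-++ s m)))))) e

      private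
        q₀ : Place
        q₀ = proj₁ start-edge
        c₀ = proj₁ q₀
        p₀ = proj₂ q₀
        F₀ : List V
        F₀ = uncurry ed q₀
        E₀ : E F₀
        E₀ = proj₂ start-edge

      length-ed : ∀ c p → length (ed c p) ≡ k
      length-ed (s , m) p = trans (length-++ (toList p)) (cong₂ _+_ (length-toList p) (length-++-toList s m))

      edge-anchor : ∀ c p → E (ed c p) → Unique (toList (site c))
      edge-anchor (s , m) p e = unique-++⁻ˡ (toList s) (unique-++⁻ʳ (toList p) (E-unique e))

      edge-unique-p : ∀ c p → E (ed c p) → Unique (toList p)
      edge-unique-p (s , m) p e = unique-++⁻ˡ (toList p) (E-unique e)

      absQ : List AbsV → Place
      absQ []       = q₀
      absQ (y ∷ us) = absEnd y

      -- Each absorber is attached to the end of its predecessor, so a chain of samples is already a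
      -- path.
      Good₁ : List AbsV → Vec V d → AbsV → Set
      Good₁ us x y = AbsOK (absQ us) x (absV us ++ F₀) y

      good₁? : ∀ us x y → Dec (Good₁ us x y)
      good₁? us x y = AbsOK? (absQ us) x (absV us ++ F₀) y

      module G₁ = Sampling (tup d) absorbers Good₁ good₁?

      abs-chain-fresh : ∀ {us} → G₁.Chain us → Fresh F₀ (absV us)
      abs-chain-fresh G₁.[] = fresh-[]
      abs-chain-fresh {y ∷ us} (G₁._∷_ {x = x} ok c) = fresh-resp (++-comm (absV us) (absVerts y)) (fresh-++ (abs-chain-fresh c) (abs-fresh (absQ us) x (absV us ++ F₀) y ok))

      abs-chain-anchor : ∀ {us} → G₁.Chain us → Anchor (proj₁ (absQ us)) (absV us ++ F₀)
      abs-chain-anchor G₁.[] = edge-anchor c₀ p₀ E₀ , λ i → ∈-++⁺ʳ (toList p₀) (∈-++⁺ˡ i)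
      abs-chain-anchor {y ∷ us} (G₁._∷_ {x = x} ok c) =
        let u , s = abs-anchor {F = absV us ++ F₀} y (proj₁ (abs-fresh (absQ us) x (absV us ++ F₀) y ok))
        in u , λ i → subst (_ ∈_) (sym (++-assoc (absVerts y) (absV us) F₀)) (s i)

      abs-chain-edge : ∀ {us} → G₁.Chain us → E (uncurry ed (absQ us))
      abs-chain-edge G₁.[] = E₀
      abs-chain-edge {y ∷ us} (G₁._∷_ {x = x} ok c) = proj₁ (proj₁ (proj₂ (proj₁ (proj₁ ok))))

      -- An absorber that receives no tuple stays on the path in its before version; the x₀ recorded
      -- in the chain proves that this version runs.
      absorb : ∀ {us} zs → G₁.Chain us → (∀ x → x ∈ zs → length zs ≤ G₁.hits x us) →
               ∃ λ bs → Run (uncurry on q₀) bs × end (uncurry on q₀) bs ≡ uncurry on (absQ us) × verts bs ↭ tupV zs ++ absV us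
      absorb []       G₁.[] dem = [] , tt , refl , ↭-refl
      absorb (z ∷ zs) G₁.[] dem = contradiction (dem z (here refl)) λ ()
      absorb {y ∷ us} zs (G₁._∷_ {x = x₀} ok c) dem = by (G₁.choose y us zs dem)
        where
        Goal : Set
        Goal = ∃ λ bs → Run (uncurry on q₀) bs × end (uncurry on q₀) bs ≡ uncurry on (absEnd y) × verts bs ↭ tupV zs ++ (absVerts y ++ absV us)
        extend-by : ∀ zs′ new {x} → (∃ λ bs → Run (uncurry on q₀) bs × end (uncurry on q₀) bs ≡ uncurry on (absQ us) × verts bs ↭ tupV zs′ ++ absV us) →
                    Run (uncurry on (absQ us)) new → (∀ st → end st new ≡ uncurry on (absEnd y)) → verts new ↭ x ++ absVerts y → tupV zs ↭ x ++ tupV zs′ → Goal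
        extend-by zs′ new {x} (bs , r , e , p) rn en pn pz =
          bs ++ new , run-++⁺ bs r (subst (λ st → Run st new) (sym e) rn) , trans (end-++ bs) (en _) ,
          ↭-trans (↭-reflexive (verts-++ bs new)) (↭-trans (++⁺ p pn)
            (↭-trans (permute 4 (λ t v x y → (t ⊕ v) ⊕ (x ⊕ y) ⊜ (x ⊕ t) ⊕ (y ⊕ v)) ↭-refl (tupV zs′) (absV us) x (absVerts y))
              (++⁺ʳ (absVerts y ++ absV us) (↭-sym pz))))
        by : _ → Goal
        by (inj₁ (x , zs′ , p , g , dem′)) = extend-by zs′ (absAfter x y) (absorb zs′ c dem′) (abs-run-after (absQ us) x (absV us ++ F₀) y g) (λ st → end-absAfter st x y) (absAfter-verts x y) (tupV-↭ p)
        by (inj₂ dem′) = extend-by zs (absBefore y) {[]} (absorb zs c dem′) (abs-run-before (absQ us) x₀ (absV us ++ F₀) y ok) (λ st → end-absBefore st y) (absBefore-verts y) ↭-refl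

      tup-small : length (tup d) < 2 ^ (κ * w)
      tup-small = begin-strict
        length (tup d)   ≡⟨ length-tup d ⟩
        n ^ d            ≤⟨ ^-monoʳ-≤ n {{>-nonZero n>0}} (≤-trans (m≤n+m d ℓ) (m≤m+n k k)) ⟩
        n ^ (k + k)      <⟨ expo ⟩
        2 ^ w            ≤⟨ ^-monoʳ-≤ 2 (m≤m+n w _) ⟩
        2 ^ (κ * w)      ∎
        where open ≤-Reasoning

      conns-nonempty : 0 < length conns
      conns-nonempty = ⊗>0 t (⊗>0 t (⊗>0 t (⊗>0 t t)))
        where
        t : ∀ {r} → 0 < length (tup r)
        t {r} = tup-nonempty r n>0

      absorbers-nonempty : 0 < length absorbers
      absorbers-nonempty = ⊗>0 (⊗>0 t (⊗>0 t (⊗>0 t (⊗>0 t (⊗>0 t (⊗>0 t t)))))) (⊗>0 (pow-nonempty d (⊗>0 (⊗>0 t (⊗>0 t (⊗>0 t (⊗>0 v (⊗>0 v (⊗>0 t t)))))) conns-nonempty)) conns-nonempty)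
        where
        t : ∀ {r} → 0 < length (tup r)
        t {r} = tup-nonempty r n>0
        v : 0 < length (allFin n)
        v = subst (0 <_) (sym (length-allFin n)) n>0

      abstract
        sample₁ : ∃ λ us → G₁.Chain us × length us ≤ m₁ × (∀ x → x ∈ tup d → κ * w < G₁.hits x us)
        sample₁ = G₁.Run.greedy {absD} absorbers-nonempty (κ * w) tup-small λ us c lt x _ →
          dense-≤ (n≤1+n absD) (abs-dense n>0 deg sp C₁ C₂ C₃ (absQ us) x (absV us ++ F₀) (abs-chain-anchor c)
            (room-within (≤-trans (≤-reflexive (cong (d + absSize +_) (trans (length-++ (absV us)) (cong₂ _+_ (length-absV us) (length-ed c₀ p₀)))))
              (≤-trans (≤-reflexive (r₁ (d + absSize) (length us * absSize) k))
                (+-mono-≤ (m≤m+n (k + (d + absSize)) (connSize + (ℓ + ℓ))) (≤-trans (*-monoˡ-≤ absSize (<⇒≤ lt)) (m≤m+n (m₁ * absSize) (m₂ * connSize))))))))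
          where r₁ : ∀ x y k → x + (y + k) ≡ k + x + y
                r₁ = solve-∀

      private
        us₁ = proj₁ sample₁
        ch₁ = proj₁ (proj₂ sample₁)
        Z₁ : List V
        Z₁ = absV us₁ ++ F₀

      Z₁-length : length Z₁ ≤ k + m₁ * absSize
      Z₁-length = ≤-trans (≤-reflexive (trans (length-++ (absV us₁)) (trans (cong₂ _+_ (length-absV us₁) (length-ed c₀ p₀)) (+-comm _ k))))
        (+-monoʳ-≤ k (*-monoˡ-≤ absSize (proj₁ (proj₂ (proj₂ sample₁)))))

      Z₁-unique : Unique Z₁
      Z₁-unique = fresh-unique (E-unique E₀) (abs-chain-fresh ch₁)

      around : Demand → List ConnV → List V
      around ((c , p) , (b , s)) us = toList (site c) ++ toList s ++ resV us ++ Z₁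

      Good₂ : List ConnV → Demand → ConnV → Set
      Good₂ us x y = Serves x (around x us) y

      good₂? : ∀ us x y → Dec (Good₂ us x y)
      good₂? us x y = serves? x (around x us) y

      places : List Place
      places = (tup ℓ ⊗ tup h) ⊗ tup ℓ

      -- The reservoir is sampled before the tiles exist, so it must serve every conceivable pair of
      -- edges. There are at most n^(2k) of them, below 2^w.
      pairs : List Demand
      pairs = filter valid? (places ⊗ places)

      ∈-pairs : ∀ x → Valid x → x ∈ pairs
      ∈-pairs ((c , p) , (b , s)) v = ∈-filter⁺ valid? (∈-⊗⁺ (∈-⊗⁺ (∈-⊗⁺ (∈-tup _) (∈-tup _)) (∈-tup _)) (∈-⊗⁺ (∈-⊗⁺ (∈-tup _) (∈-tup _)) (∈-tup _))) v

      module G₂ = Sampling pairs conns Good₂ good₂?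

      pairs-small : length pairs < 2 ^ w
      pairs-small = begin-strict
        length pairs                      ≤⟨ length-filter valid? (places ⊗ places) ⟩
        length (places ⊗ places)          ≡⟨ length-⊗ places places ⟩
        length places * length places     ≡⟨ cong₂ _*_ lp lp ⟩
        n ^ k * n ^ k                     ≡⟨ ^-distribˡ-+-* n k k ⟨
        n ^ (k + k)                       <⟨ expo ⟩
        2 ^ w                             ∎
        where
        open ≤-Reasoning
        lp : length places ≡ n ^ k
        lp = trans (length-⊗ (tup ℓ ⊗ tup h) (tup ℓ)) (trans (cong₂ _*_ (trans (length-⊗ (tup ℓ) (tup h)) (cong₂ _*_ (length-tup ℓ) (length-tup h))) (length-tup ℓ))
          (trans (*-comm (n ^ ℓ * n ^ h) (n ^ ℓ)) (trans (cong (n ^ ℓ *_) (sym (^-distribˡ-+-* n ℓ h))) (sym (^-distribˡ-+-* n ℓ d)))))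

      abstract
        sample₂ : ∃ λ us → G₂.Chain us × length us ≤ m₂ × (∀ x → x ∈ pairs → w < G₂.hits x us)
        sample₂ = G₂.Run.greedy {connD} conns-nonempty w pairs-small λ us c lt x x∈ →
          dense-≤ (n≤1+n connD) (serve us lt x (proj₂ (∈-filter⁻ valid? {xs = places ⊗ places} x∈)))
          where
          serve : ∀ us → length us < m₂ → ∀ x → Valid x → Dense connD conns (good₂? us x)
          serve us lt x@((c , p) , (b , s)) (e , e′) =
            conn-dense n>0 deg sp c p s (col (ed b s)) (col (ed b s)) (around x us) C₁ (edge-anchor c p e) (λ i → ∈-++⁺ˡ i)
              (edge-unique-p b s e′) (λ i → ∈-++⁺ʳ (toList (site c)) (∈-++⁺ˡ i))
              (room-within (begin
                connSize + length (around x us)                                    ≡⟨ cong (connSize +_) (trans (length-++ (toList (site c))) (cong₂ _+_ (length-toList (site c)) (trans (length-++ (toList s)) (cong₂ _+_ (length-toList s) (trans (length-++ (resV us)) (cong (_+ length Z₁) (length-resV us))))))) ⟩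
                connSize + (ℓ + (ℓ + (length us * connSize + length Z₁)))          ≤⟨ +-monoʳ-≤ connSize (+-monoʳ-≤ ℓ (+-monoʳ-≤ ℓ (+-mono-≤ (*-monoˡ-≤ connSize (<⇒≤ lt)) Z₁-length))) ⟩
                connSize + (ℓ + (ℓ + (m₂ * connSize + (k + m₁ * absSize))))        ≡⟨ r₁ connSize ℓ (m₂ * connSize) k (m₁ * absSize) ⟩
                k + 0 + (connSize + (ℓ + ℓ)) + used                                ≤⟨ +-monoˡ-≤ used (+-monoˡ-≤ (connSize + (ℓ + ℓ)) (+-monoʳ-≤ k (z≤n {d + absSize}))) ⟩
                spare + used                                                       ∎))
            where
            open ≤-Reasoning
            r₁ : ∀ x y z k m → x + (y + (y + (z + (k + m)))) ≡ k + 0 + (x + (y + y)) + (m + z)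
            r₁ = solve-∀

      private
        us₂ = proj₁ sample₂
        ch₂ = proj₁ (proj₂ sample₂)
        Z : List V
        Z = resV us₂ ++ Z₁

      res-chain-fresh : ∀ {us} → G₂.Chain us → Fresh Z₁ (resV us)
      res-chain-fresh G₂.[] = fresh-[]
      res-chain-fresh {y ∷ us} (G₂._∷_ {x = (c , p) , (b , s)} (_ , _ , f) ch) = fresh-resp (++-comm (resV us) (connVerts y))
        (fresh-++ (res-chain-fresh ch) (fresh-⊆ (λ i → ∈-++⁺ʳ (toList (site c)) (∈-++⁺ʳ (toList s) i)) f))

      Z-unique : Unique Z
      Z-unique = fresh-unique Z₁-unique (res-chain-fresh ch₂)

      Z-length : length Z ≤ spare + used
      Z-length = begin
        length Z                                   ≡⟨ trans (length-++ (resV us₂)) (cong (_+ length Z₁) (length-resV us₂)) ⟩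
        length us₂ * connSize + length Z₁          ≤⟨ +-mono-≤ (*-monoˡ-≤ connSize (proj₁ (proj₂ (proj₂ sample₂)))) Z₁-length ⟩
        m₂ * connSize + (k + m₁ * absSize)         ≡⟨ r₁ (m₂ * connSize) k (m₁ * absSize) ⟩
        k + used                                   ≤⟨ +-monoˡ-≤ used (≤-trans (m≤m+n k (d + absSize)) (m≤m+n _ (connSize + (ℓ + ℓ)))) ⟩
        spare + used                               ∎
        where
        open ≤-Reasoning
        r₁ : ∀ x k y → x + (k + y) ≡ k + (y + x)
        r₁ = solve-∀

      abstract
        covered : ∃ λ (F : Family Z) → suc G′ * length (uncovered F) < n
        covered = cover cod sp n>0 (s≤s z≤n) bigC bigN bigq (≤-trans (*-monoʳ-≤ (8 * g) Z-length) room₂)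

      private
        fam = proj₁ covered
        U = uncovered fam

      below-w : ∀ {x} → suc G′ * x ≤ n → x ≤ w
      below-w le = s≤s⁻¹ (*-cancelˡ-< (suc G′) _ _ (≤-<-trans le n<W))

      U≤w : length U ≤ w
      U≤w = below-w (<⇒≤ (proj₂ covered))

      T≤w : length (tiles fam) ≤ w
      T≤w = below-w (begin
        suc G′ * length (tiles fam)            ≡⟨ *-comm (suc G′) _ ⟩
        length (tiles fam) * suc G′            ≤⟨ *-monoʳ-≤ (length (tiles fam)) G≤ ⟩
        length (tiles fam) * (τ * d)           ≡⟨ length-tv (tiles fam) ⟨
        length (tv (tiles fam))                ≤⟨ unique-length (proj₁ (fresh fam)) ⟩
        n                                      ∎)
        where
        open ≤-Reasoning
        G≤ : suc G′ ≤ τ * d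
        G≤ = ≤-trans (≤-trans (m≤n*m (suc G′) q) (m≤n*m (q * suc G′) 2)) (m≤m*n τ d)

      cut : ∀ ts → All (λ t → Run none (toList t)) ts →
            ∃ λ sgs → ∃ λ mids → All SegOK sgs × length sgs ≡ length ts × tv ts ↭ segV sgs ++ mids × length mids ≡ length ts * h
      cut []       []       = [] , [] , [] , refl , ↭-refl , refl
      cut (t ∷ ts) (r ∷ rs) =
        let (s₁ , M₁) , b₂ , rest , eq = two (toList t) (subst (2 ≤_) (sym (length-toList t)) 2≤τ)
            sgs , mids , oks , len , p , lm = cut ts rs
        in (s₁ , b₂ , rest) ∷ sgs , toList M₁ ++ mids ,
           proj₂ (subst (Run none) eq r) ∷ oks , cong suc len ,
           ↭-trans (++⁺ (↭-reflexive (trans (toList-vverts t) (cong verts eq))) p)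
             (permute 5 (λ s m v sg ms → ((s ⊕ m) ⊕ v) ⊕ (sg ⊕ ms) ⊜ ((s ⊕ v) ⊕ sg) ⊕ (m ⊕ ms)) ↭-refl
               (toList s₁) (toList M₁) (verts (b₂ ∷ rest)) (segV sgs) mids) ,
           trans (length-++ (toList M₁)) (cong₂ _+_ (length-toList M₁) lm)
        where
        two : ∀ (bs : List Block) → 2 ≤ length bs → ∃ λ b₁ → ∃ λ b₂ → ∃ λ rest → bs ≡ b₁ ∷ b₂ ∷ rest
        two (b₁ ∷ b₂ ∷ rest) le = b₁ , b₂ , rest , refl
        two (b₁ ∷ [])        (s≤s ())
        two []               ()
        2≤τ : 2 ≤ τ
        2≤τ = *-monoʳ-≤ 2 (s≤s {0} z≤n)

      hamilton : HamiltonRun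
      hamilton = finish (cut (tiles fam) (runs fam))
        where
        finish : _ → HamiltonRun
        finish (sgs₀ , mids , oks , len , pt , lm) = go₁ (G₂.assign us₂ dem short)
          where
          -- The starting edge is appended as a last segment; connecting to it closes the cycle.
          sgs : List Seg
          sgs = sgs₀ ++ (p₀ , c₀ , []) ∷ []
          q₁ = absQ us₁
          dem = demands q₁ sgs
          oks′ : All SegOK sgs
          oks′ = AllP.++⁺ oks ((E₀ , tt) ∷ [])
          -- The closing segment makes T + 1 demands, and every valid pair has more than w ≥ T hits.
          short : ∀ x → x ∈ dem → length dem ≤ G₂.hits x us₂
          short x i = ≤-trans (≤-reflexive (trans (length-demands q₁ sgs) (trans (length-++ sgs₀) (trans (+-comm _ 1) (cong suc len)))))
            (≤-trans (s≤s T≤w) (proj₂ (proj₂ (proj₂ sample₂)) x (∈-pairs x (AllB.lookup (demands-valid q₁ sgs (abs-chain-edge ch₁) oks′) i))))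
          go₁ : _ → HamiltonRun
          go₁ (ps , rest , p₁ , p₂ , ok) = go₂ (↭-map-inv proj₁ (↭-sym p₁))
            where
            go₂ : _ → HamiltonRun
            go₂ (ps′ , eq , pp) = go₃ (join q₁ sgs ps′ eq oks′ (AllB.map (λ (us , o) → _ , o) (All-resp-↭ pp ok)))
              where
              go₃ : _ → HamiltonRun
              go₃ (bs₂ , run₂ , end₂ , v₂) = go₄ (absorb [] ch₁ (λ _ ()))
                where
                L : List V
                L = U ++ mids ++ resV rest
                res-split : resV us₂ ↭ resV (map proj₂ ps′) ++ resV rest
                res-split = ↭-trans (resV-↭ p₂) (↭-trans (↭-reflexive (resV-++ (map proj₂ ps) rest)) (++⁺ʳ (resV rest) (resV-↭ (map⁺ proj₂ pp))))
                all-verts : (L ++ absV us₁) ++ verts bs₂ ↭ allFin n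
                all-verts = ↭-trans
                  (↭-trans (++⁺ˡ (L ++ absV us₁) (↭-trans v₂ (++⁺ʳ (resV (map proj₂ ps′)) (↭-reflexive (segV-++ sgs₀ ((p₀ , c₀ , []) ∷ []))))))
                    (permute 8 (λ u m r av sg f₀ f₁ rv → ((u ⊕ (m ⊕ r)) ⊕ av) ⊕ ((sg ⊕ ((f₀ ⊕ (f₁ ⊕ id)) ⊕ id)) ⊕ rv) ⊜ u ⊕ (((rv ⊕ r) ⊕ (av ⊕ (f₀ ⊕ f₁))) ⊕ (sg ⊕ m))) ↭-refl
                      U mids (resV rest) (absV us₁) (segV sgs₀) (toList p₀) (bverts c₀) (resV (map proj₂ ps′))))
                  (↭-trans (++⁺ˡ U (++⁺ (++⁺ʳ Z₁ (↭-sym res-split)) (↭-sym pt)))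
                    (unique-full (UniqueP.++⁺ (UniqueP.filter⁺ _ (UniqueP.allFin⁺ n)) (Unique-resp-↭ (++-comm (tv (tiles fam)) Z) (fresh-unique Z-unique (fresh fam)))
                        (λ (i , j) → proj₂ (∈-filter⁻ (λ v → ¬? (v ∈? (Z ++ tv (tiles fam)))) {xs = allFin n} i) j))
                      everywhere))
                  where
                  everywhere : ∀ v → v ∈ U ++ (Z ++ tv (tiles fam))
                  everywhere v = by (v ∈? (Z ++ tv (tiles fam)))
                    where
                    by : Dec (v ∈ Z ++ tv (tiles fam)) → v ∈ U ++ (Z ++ tv (tiles fam))
                    by (yes i) = ∈-++⁺ʳ U i
                    by (no ¬i) = ∈-++⁺ˡ (∈-filter⁺ (λ v → ¬? (v ∈? (Z ++ tv (tiles fam)))) (∈-allFin v) ¬i)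

                L-small : length L ≤ κ * w
                L-small = begin
                  length L                                        ≡⟨ trans (length-++ U) (cong (length U +_) (trans (length-++ mids) (cong₂ _+_ lm (length-resV rest)))) ⟩
                  length U + (length (tiles fam) * h + length rest * connSize) ≤⟨ +-mono-≤ U≤w (+-mono-≤ (*-monoˡ-≤ h T≤w) (*-monoˡ-≤ connSize rest≤)) ⟩
                  w + (w * h + m₂ * connSize)                     ≡⟨ r₁ w h t₂ connSize ⟩
                  κ * w                                           ∎
                  where
                  open ≤-Reasoning
                  r₁ : ∀ w h t c → w + (w * h + t * (w + w) * c) ≡ suc (h + t * 2 * c) * w
                  r₁ = solve-∀
                  rest≤ : length rest ≤ m₂
                  rest≤ = ≤-trans (≤-trans (m≤n+m (length rest) (length (map proj₂ ps))) (≤-reflexive (sym (trans (↭-length p₂) (length-++ (map proj₂ ps)))))) (proj₁ (proj₂ (proj₂ sample₂)))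

                go₄ : _ → HamiltonRun
                go₄ (bs₀ , _ , _ , v₀) = go₅ d∣L
                  where
                  -- With nothing absorbed, the two paths consist of whole blocks of d vertices and
                  -- miss exactly L, so d ∣ n forces d ∣ |L|.
                  d∣L : d ∣ length L
                  d∣L = ∣m+n∣m⇒∣n (subst (d ∣_) (sym total) d∣n) (n∣m*n (length bs₀ + length bs₂))
                    where
                    total : (length bs₀ + length bs₂) * d + length L ≡ n
                    total = begin
                      (length bs₀ + length bs₂) * d + length L                ≡⟨ r₁ (length bs₀) (length bs₂) d (length L) ⟩
                      length L + length bs₀ * d + length bs₂ * d              ≡⟨ cong₂ (λ x y → length L + x + y) (sym (length-verts bs₀)) (sym (length-verts bs₂)) ⟩
                      length L + length (verts bs₀) + length (verts bs₂)      ≡⟨ cong (λ z → length L + z + length (verts bs₂)) (↭-length v₀) ⟩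
                      length L + length (absV us₁) + length (verts bs₂)       ≡⟨ trans (length-++ (L ++ absV us₁)) (cong (_+ length (verts bs₂)) (length-++ L)) ⟨
                      length ((L ++ absV us₁) ++ verts bs₂)                   ≡⟨ trans (↭-length all-verts) (length-allFin n) ⟩
                      n                                                       ∎
                      where
                      open ≡-Reasoning
                      r₁ : ∀ x y d l → (x + y) * d + l ≡ l + x * d + y * d
                      r₁ = solve-∀
                  go₅ : d ∣ length L → HamiltonRun
                  go₅ (divides m eqL) = go₆ (chunk m L eqL)
                    where
                    go₆ : _ → HamiltonRun
                    go₆ (zs , zs≡ , lz) = go₇ (absorb zs ch₁ (λ x i → ≤-trans
                        (≤-trans (≤-reflexive lz) (≤-trans (m≤m*n m d) (≤-trans (≤-reflexive (sym eqL)) L-small))) (<⇒≤ (proj₂ (proj₂ (proj₂ sample₁)) x (∈-tup x)))))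
                      where
                      go₇ : _ → HamiltonRun
                      go₇ (bs₁ , run₁ , end₁ , v₁) = record
                        { start  = q₀
                        ; blocks = bs₁ ++ bs₂
                        ; run    = run-++⁺ bs₁ run₁ (subst (λ st → Run st bs₂) (sym end₁) run₂)
                        ; closed = trans (end-++ bs₁) (trans (cong (λ st → end st bs₂) end₁) (trans end₂ (cong (uncurry on) (final-++ q₁ sgs₀ p₀ c₀))))
                        ; spans  = ↭-trans (↭-reflexive (verts-++ bs₁ bs₂)) (↭-trans (++⁺ʳ (verts bs₂) (↭-trans v₁ (↭-reflexive (cong (_++ absV us₁) zs≡)))) all-verts)
                        }

-- From a closed run to a cyclic ordering.

module Cycle where

  open Prelude
  open Counting
  open Freshness
  open Graph
  open Cover using (list→vec; lookup-unique)
  open Assembly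
  open import Data.Nat.DivMod using (_mod_; _%_; [m+n]%n≡m%n; m<n⇒m%n≡m)
  open import Data.Fin using (toℕ)
  open import Data.Fin.Properties using (toℕ-fromℕ<; toℕ<n; toℕ-injective)
  open import Data.List.Relation.Binary.Permutation.Propositional.Properties using (drop-∷)
  import Data.Vec.Relation.Unary.Any as VAny
  import Data.Vec.Relation.Unary.Any.Properties as VAnyP
  import Data.Vec.Membership.Propositional as VMem′
  open import Relation.Binary.Definitions using (tri<; tri≈; tri>)
  open import Function.Bundles using (_↔_; mk↔ₛ′; Inverse)

  ++-cancelˡ-↭ : {A : Set} (zs : List A) {xs ys : List A} → zs ++ xs ↭ zs ++ ys → xs ↭ ys
  ++-cancelˡ-↭ []       p = p
  ++-cancelˡ-↭ (z ∷ zs) p = ++-cancelˡ-↭ zs (drop-∷ p)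

  data At {A : Set} : List A → ℕ → A → Set where
    here  : ∀ {x xs} → At (x ∷ xs) 0 x
    there : ∀ {x xs i v} → At xs i v → At (x ∷ xs) (suc i) v

  module _ {A : Set} where

    at-++ˡ : {xs ys : List A} {i : ℕ} {v : A} → At xs i v → At (xs ++ ys) i v
    at-++ˡ here      = here
    at-++ˡ (there p) = there (at-++ˡ p)

    at-++ʳ : (xs : List A) {ys : List A} {i : ℕ} {v : A} → At ys i v → At (xs ++ ys) (length xs + i) v
    at-++ʳ []       p = p
    at-++ʳ (x ∷ xs) p = there (at-++ʳ xs p)

    at-++⁻ : (xs : List A) {ys : List A} {i : ℕ} {v : A} → At (xs ++ ys) i v → At xs i v ⊎ ∃ λ j → i ≡ length xs + j × At ys j v
    at-++⁻ []       p    = inj₂ (_ , refl , p)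
    at-++⁻ (x ∷ xs) here = inj₁ here
    at-++⁻ (x ∷ xs) (there p) with at-++⁻ xs p
    ... | inj₁ q            = inj₁ (there q)
    ... | inj₂ (j , eq , q) = inj₂ (j , cong suc eq , q)

    at-< : {xs : List A} {i : ℕ} {v : A} → At xs i v → i < length xs
    at-< here      = s≤s z≤n
    at-< (there p) = s≤s (at-< p)

    at-∈ : {xs : List A} {i : ℕ} {v : A} → At xs i v → v ∈ xs
    at-∈ here      = here refl
    at-∈ (there p) = there (at-∈ p)

    ∈-at : {xs : List A} {v : A} → v ∈ xs → ∃ λ i → At xs i v
    ∈-at (here refl) = 0 , here
    ∈-at (there m)   = let i , p = ∈-at m in suc i , there p

    at-total : (xs : List A) {i : ℕ} → i < length xs → ∃ λ v → At xs i v
    at-total (x ∷ xs) {zero}  lt       = x , here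
    at-total (x ∷ xs) {suc i} (s≤s lt) = let v , p = at-total xs lt in v , there p

    at-unique : {xs : List A} → Unique xs → ∀ {i j v} → At xs i v → At xs j v → i ≡ j
    at-unique u       here      here      = refl
    at-unique (a ∷ u) here      (there q) = ⊥-elim (AllB.lookup a (at-∈ q) refl)
    at-unique (a ∷ u) (there p) here      = ⊥-elim (AllB.lookup a (at-∈ p) refl)
    at-unique (a ∷ u) (there p) (there q) = cong suc (at-unique u p q)

    at-lookup : ∀ {m} (w : Vec A m) (j : Fin m) {v} → At (toList w) (toℕ j) v → lookup w j ≡ v
    at-lookup (x ∷ w) zero    here      = refl
    at-lookup (x ∷ w) (suc j) (there p) = at-lookup w j p

  module Closing (a b : ℕ) {n′ : ℕ} (S : System (suc n′)) where

    open Graphs a b S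
    open Segments a b S
    open Perm using (_⊕_; _⊜_) renaming (solve to permute)

    private n = suc n′

    -- A block stores its outgoing overlap, whereas the cyclic order lists the incoming one first.
    -- After this shift by one overlap, edge j occupies the k positions from jd on.
    lay : Vec V ℓ → List Block → List V
    lay s []             = []
    lay s ((t , m) ∷ bs) = (toList s ++ toList m) ++ lay t bs

    lastSite : Vec V ℓ → List Block → Vec V ℓ
    lastSite s []       = s
    lastSite s (b ∷ bs) = lastSite (site b) bs

    lay-verts : ∀ s bs → lay s bs ++ toList (lastSite s bs) ↭ toList s ++ verts bs
    lay-verts s []             = permute 1 (λ x → x ⊜ x ⊕ Perm.id) ↭-refl (toList s)
    lay-verts s ((t , m) ∷ bs) = ↭-trans (↭-reflexive (++-assoc (toList s ++ toList m) (lay t bs) _))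
      (↭-trans (++⁺ˡ (toList s ++ toList m) (lay-verts t bs))
        (permute 4 (λ s m t v → (s ⊕ m) ⊕ (t ⊕ v) ⊜ s ⊕ ((t ⊕ m) ⊕ v)) ↭-refl (toList s) (toList m) (toList t) (verts bs)))

    lay-prefix : ∀ s bs → ∃ λ rest → lay s bs ++ toList (lastSite s bs) ≡ toList s ++ rest
    lay-prefix s []             = [] , sym (++-identityʳ (toList s))
    lay-prefix s ((t , m) ∷ bs) = toList m ++ (lay t bs ++ toList (lastSite t bs)) ,
      trans (++-assoc (toList s ++ toList m) (lay t bs) _) (++-assoc (toList s) (toList m) _)

    edgeAt : Vec V ℓ → (bs : List Block) → Fin (length bs) → Place
    edgeAt s (b ∷ bs) zero    = b , s
    edgeAt s (b ∷ bs) (suc j) = edgeAt (site b) bs j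

    -- The vertices of an edge in their order along the cycle.
    ordered : Place → List V
    ordered ((t , m) , s) = (toList s ++ toList m) ++ toList t

    length-ordered : ∀ e → length (ordered e) ≡ k
    length-ordered ((t , m) , s) = trans (length-++ (toList s ++ toList m)) (trans (cong₂ _+_ (length-++-toList s m) (length-toList t)) (+-comm d ℓ))

    ordered-↭ : ∀ e → ordered e ↭ uncurry ed e
    ordered-↭ ((t , m) , s) = permute 3 (λ s m t → (s ⊕ m) ⊕ t ⊜ s ⊕ (t ⊕ m)) ↭-refl (toList s) (toList m) (toList t)

    lay-edge : ∀ s bs (j : Fin (length bs)) {t v} → At (ordered (edgeAt s bs j)) t v →
               At (lay s bs ++ toList (lastSite s bs)) (toℕ j * d + t) v
    lay-edge s ((t , m) ∷ bs) zero p with lay-prefix t bs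
    ... | rest , eq = subst (λ z → At z _ _) (sym (trans (++-assoc (toList s ++ toList m) (lay t bs) _)
            (trans (cong ((toList s ++ toList m) ++_) eq) (sym (++-assoc (toList s ++ toList m) (toList t) rest))))) (at-++ˡ p)
    lay-edge s ((t , m) ∷ bs) (suc j) {x} {v} p = subst₂ (λ z i → At z i v) (sym (++-assoc (toList s ++ toList m) (lay t bs) _))
      (trans (cong (_+ (toℕ j * d + x)) (length-++-toList s m)) (sym (+-assoc d (toℕ j * d) x)))
      (at-++ʳ (toList s ++ toList m) (lay-edge t bs j p))

    run-edge : ∀ c p bs → Run (on c p) bs → ∀ j → E (uncurry ed (edgeAt (site c) bs j))
    run-edge c p (b ∷ bs) ((e , _) , r) zero    = e
    run-edge c p (b ∷ bs) ((e , _) , r) (suc j) = run-edge b (site c) bs r j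

    run-colours : ∀ c p bs → Run (on c p) bs → (i j : Fin (length bs)) → toℕ j ≡ suc (toℕ i) →
                  col (uncurry ed (edgeAt (site c) bs j)) ≢ col (uncurry ed (edgeAt (site c) bs i))
    run-colours c p (b ∷ b′ ∷ bs) (_ , (_ , ne) , r) zero    (suc zero) eq = ne
    run-colours c p (b ∷ bs)      (_ , r)            (suc i) (suc j)    eq = run-colours b (site c) bs r i j (suc-injective eq)

    first-colour : ∀ c p bs → Run (on c p) bs → (i : Fin (length bs)) → toℕ i ≡ 0 → col (uncurry ed (edgeAt (site c) bs i)) ≢ col (ed c p)
    first-colour c p (b ∷ bs) ((_ , ne) , _) zero eq = ne

    end-edge : ∀ c p bs (j : Fin (length bs)) → suc (toℕ j) ≡ length bs → end (on c p) bs ≡ uncurry on (edgeAt (site c) bs j)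
    end-edge c p (b ∷ [])      zero    eq = refl
    end-edge c p (b ∷ b′ ∷ bs) (suc j) eq = end-edge b (site c) (b′ ∷ bs) j (suc-injective eq)

    end-site : ∀ c p bs {q} → end (on c p) bs ≡ uncurry on q → lastSite (site c) bs ≡ site (proj₁ q)
    end-site c p []       refl = refl
    end-site c p (b ∷ bs) eq   = end-site b (site c) bs eq

    on-injective : ∀ {q q′ : Place} → uncurry on q ≡ uncurry on q′ → q ≡ q′
    on-injective refl = refl

    module _ (H : HamiltonRun) where

      open HamiltonRun H

      private
        c  = proj₁ start
        s₀ = site c
        bs = blocks
        m  = length bs

      order : List V
      order = lay s₀ bs

      last≡ : lastSite s₀ bs ≡ s₀
      last≡ = end-site c (proj₂ start) bs closed

      -- `lay` starts with an overlap that `verts` omits and omits the one at the end. In a closed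
      -- run these are equal and cancel.
      order-↭ : order ↭ allFin n
      order-↭ = ↭-trans (++-cancelˡ-↭ (toList s₀) (↭-trans (++-comm (toList s₀) order)
        (subst (λ z → order ++ toList z ↭ toList s₀ ++ verts bs) last≡ (lay-verts s₀ bs)))) spans

      order-unique : Unique order
      order-unique = Unique-resp-↭ (↭-sym order-↭) (UniqueP.allFin⁺ n)

      length-order : length order ≡ n
      length-order = trans (↭-length order-↭) (length-allFin n)

      m*d≡n : m * d ≡ n
      m*d≡n = trans (sym (length-verts bs)) (trans (↭-length spans) (length-allFin n))

      edge-place : Fin m → Place
      edge-place = edgeAt s₀ bs

      order-prefix : ∀ {i v} → At (toList s₀) i v → At order i v
      order-prefix = go bs (λ e → contradiction (trans (sym m*d≡n) (cong (λ z → length z * d) e)) λ ())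
        where
        go : ∀ bs → bs ≢ [] → ∀ {i v} → At (toList s₀) i v → At (lay s₀ bs) i v
        go []             ne p = ⊥-elim (ne refl)
        go ((t , m) ∷ bs) ne p = at-++ˡ (at-++ˡ p)

      -- Positions beyond n lie in the copy of the first overlap appended to `order`, so they wrap
      -- around to its beginning.
      located : ∀ j {t v} → At (ordered (edge-place j)) t v → ∃ λ i → At order i v × (toℕ j * d + t ≡ i ⊎ toℕ j * d + t ≡ n + i)
      located j {t} p with at-++⁻ order (subst (λ z → At (order ++ toList z) (toℕ j * d + t) _) last≡ (lay-edge s₀ bs j p))
      ... | inj₁ q            = _ , q , inj₁ refl
      ... | inj₂ (i , eq , q) = i , order-prefix q , inj₂ (trans eq (cong (_+ i) length-order))

      abstract
        vec : ∃ λ (w : Vec V n) → toList w ≡ order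
        vec = list→vec order length-order

      private
        w = proj₁ vec
        w∈ : ∀ v → v VMem′.∈ w
        w∈ v = VMem.∈-toList⁻ (subst (v ∈_) (sym (proj₂ vec)) (∈-resp-↭ (↭-sym order-↭) (∈-allFin v)))

      σ : Fin n ↔ Fin n
      σ = mk↔ₛ′ (lookup w) (λ v → VAny.index (w∈ v)) (λ v → sym (VAnyP.lookup-index (w∈ v)))
            (λ i → lookup-unique w (subst Unique (sym (proj₂ vec)) order-unique) (sym (VAnyP.lookup-index (w∈ (lookup w i)))))

      on-cycle : ∀ j {t v} → At (ordered (edge-place j)) t v → v ≡ Inverse.to σ ((toℕ j * d + t) mod n)
      on-cycle j {t} {v} p = let i , q , eq = located j p in sym (at-lookup w ((toℕ j * d + t) mod n)
        (subst₂ (λ z x → At z x v) (sym (proj₂ vec)) (sym (trans (toℕ-fromℕ< _) (reduce eq (subst (i <_) length-order (at-< q))))) q))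
        where
        reduce : ∀ {x i} → x ≡ i ⊎ x ≡ n + i → i < n → x % n ≡ i
        reduce (inj₁ refl) lt = m<n⇒m%n≡m lt
        reduce {i = i} (inj₂ refl) lt = trans (trans (cong (_% n) (+-comm n i)) ([m+n]%n≡m%n i n)) (m<n⇒m%n≡m lt)

      edge-vertices : ∀ j v → (v ∈ uncurry ed (edge-place j) → ∃ λ t → t < k × v ≡ Inverse.to σ ((toℕ j * d + t) mod n))
                            × ((∃ λ t → t < k × v ≡ Inverse.to σ ((toℕ j * d + t) mod n)) → v ∈ uncurry ed (edge-place j))
      edge-vertices j v = forth , back
        where
        forth : v ∈ uncurry ed (edge-place j) → ∃ λ t → t < k × v ≡ Inverse.to σ ((toℕ j * d + t) mod n)
        forth i = let t , p = ∈-at (∈-resp-↭ (↭-sym (ordered-↭ (edge-place j))) i)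
                  in t , subst (t <_) (length-ordered (edge-place j)) (at-< p) , on-cycle j p
        back : (∃ λ t → t < k × v ≡ Inverse.to σ ((toℕ j * d + t) mod n)) → v ∈ uncurry ed (edge-place j)
        back (t , lt , eq) = let u , p = at-total (ordered (edge-place j)) (subst (t <_) (sym (length-ordered (edge-place j))) lt)
          in subst (_∈ uncurry ed (edge-place j)) (trans (on-cycle j p) (sym eq)) (∈-resp-↭ (ordered-↭ (edge-place j)) (at-∈ p))

      private
        k<2d : k < d + d
        k<2d = +-monoˡ-< d (m<m+n ℓ (s≤s z≤n))

        -- Edges start d apart and have k < 2d vertices (here h > 0 enters), so only consecutive
        -- ones can share a position.
        next : ∀ {i j t t′} → i < j → t < k → i * d + t ≡ j * d + t′ → j ≡ suc i
        next {i} {j} {t} {t′} lt t<k eq = ≤-antisym (s≤s⁻¹ (*-cancelʳ-< d j (suc (suc i)) (begin-strict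
          j * d              ≤⟨ m≤m+n (j * d) t′ ⟩
          j * d + t′         ≡⟨ eq ⟨
          i * d + t          <⟨ +-monoʳ-< (i * d) (<-trans t<k k<2d) ⟩
          i * d + (d + d)    ≡⟨ r i d ⟩
          suc (suc i) * d    ∎))) lt
          where
          open ≤-Reasoning
          r : ∀ i d → i * d + (d + d) ≡ suc (suc i) * d
          r = solve-∀

        -- A position past the end belongs to the last edge, and there only to its final ℓ vertices.
        wrapped : ∀ {j t i} → j < m → t < k → j * d + t ≡ n + i → suc j ≡ m × i < d
        wrapped {j} {t} {i} lt t<k eq = last , +-cancelˡ-< n i d (subst (_< n + d) eq (begin-strict
            j * d + t        <⟨ +-monoʳ-< (j * d) (<-trans t<k k<2d) ⟩
            j * d + (d + d)  ≡⟨ r j d ⟩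
            suc j * d + d    ≡⟨ cong (λ z → z * d + d) last ⟩
            m * d + d        ≡⟨ cong (_+ d) m*d≡n ⟩
            n + d            ∎))
          where
          open ≤-Reasoning
          r : ∀ i d → i * d + (d + d) ≡ suc i * d + d
          r = solve-∀
          r′ : ∀ i d → i * d + (d + d) ≡ suc (suc i) * d
          r′ = solve-∀
          last : suc j ≡ m
          last = ≤-antisym lt (s≤s⁻¹ (*-cancelʳ-< d m (suc (suc j)) (begin-strict
            m * d            ≡⟨ m*d≡n ⟩
            n                ≤⟨ m≤m+n n i ⟩
            n + i            ≡⟨ eq ⟨
            j * d + t        <⟨ +-monoʳ-< (j * d) (<-trans t<k k<2d) ⟩
            j * d + (d + d)  ≡⟨ r′ j d ⟩
            suc (suc j) * d  ∎)))

        zero-block : ∀ {j t i} → j * d + t ≡ i → i < d → j ≡ 0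
        zero-block {zero}  eq lt = refl
        zero-block {suc j} {t} refl lt = ⊥-elim (<⇒≱ lt (≤-trans (m≤m+n d (j * d)) (m≤m+n (d + j * d) t)))

      adjacent : ∀ (i j : Fin m) → toℕ i < toℕ j → ∀ {v} → v ∈ uncurry ed (edge-place i) → v ∈ uncurry ed (edge-place j) →
                 toℕ j ≡ suc (toℕ i) ⊎ (toℕ i ≡ 0 × suc (toℕ j) ≡ m)
      adjacent i j lt vi vj =
        let t , p    = ∈-at (∈-resp-↭ (↭-sym (ordered-↭ (edge-place i))) vi)
            t′ , p′  = ∈-at (∈-resp-↭ (↭-sym (ordered-↭ (edge-place j))) vj)
            x , q , e   = located i p
            x′ , q′ , e′ = located j p′
            t<k = subst (t <_) (length-ordered (edge-place i)) (at-< p)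
            t′<k = subst (t′ <_) (length-ordered (edge-place j)) (at-< p′)
        in by t<k t′<k e (subst (λ z → toℕ j * d + t′ ≡ z ⊎ toℕ j * d + t′ ≡ n + z) (at-unique order-unique q′ q) e′)
        where
        by : ∀ {t t′ x} → t < k → t′ < k → toℕ i * d + t ≡ x ⊎ toℕ i * d + t ≡ n + x → toℕ j * d + t′ ≡ x ⊎ toℕ j * d + t′ ≡ n + x →
             toℕ j ≡ suc (toℕ i) ⊎ (toℕ i ≡ 0 × suc (toℕ j) ≡ m)
        by t<k t′<k (inj₁ e) (inj₁ e′) = inj₁ (next lt t<k (trans e (sym e′)))
        by t<k t′<k (inj₂ e) (inj₂ e′) = inj₁ (next lt t<k (trans e (sym e′)))
        by t<k t′<k (inj₁ e) (inj₂ e′) = let l , x<d = wrapped (toℕ<n j) t′<k e′ in inj₂ (zero-block e x<d , l)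
        by t<k t′<k (inj₂ e) (inj₁ e′) = let l , x<d = wrapped (toℕ<n i) t<k e in ⊥-elim (n≮0 (subst (toℕ i <_) (zero-block e′ x<d) lt))

      proper-< : ∀ (i j : Fin m) → toℕ i < toℕ j → ∀ {v} → v ∈ uncurry ed (edge-place i) → v ∈ uncurry ed (edge-place j) →
                 col (uncurry ed (edge-place i)) ≢ col (uncurry ed (edge-place j))
      proper-< i j lt vi vj = by (adjacent i j lt vi vj)
        where
        by : toℕ j ≡ suc (toℕ i) ⊎ (toℕ i ≡ 0 × suc (toℕ j) ≡ m) → col (uncurry ed (edge-place i)) ≢ col (uncurry ed (edge-place j))
        by (inj₁ eq)       z = run-colours c (proj₂ start) bs run i j eq (sym z)
        by (inj₂ (e , e′)) = subst (λ q → col (uncurry ed (edge-place i)) ≢ col (uncurry ed q))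
          (on-injective (trans (sym closed) (end-edge c (proj₂ start) bs j e′))) (first-colour c (proj₂ start) bs run i e)

      proper-cycle : ∀ (i j : Fin m) → i ≢ j → ∀ {v} → v ∈ uncurry ed (edge-place i) → v ∈ uncurry ed (edge-place j) →
                     col (uncurry ed (edge-place i)) ≢ col (uncurry ed (edge-place j))
      proper-cycle i j ne vi vj with <-cmp (toℕ i) (toℕ j)
      ... | tri< lt _ _ = proper-< i j lt vi vj
      ... | tri≈ _ eq _ = ⊥-elim (ne (toℕ-injective eq))
      ... | tri> _ _ gt = λ z → proper-< j i gt vj vi (sym z)

      edges-in : ∀ j → E (uncurry ed (edge-place j))
      edges-in = run-edge c (proj₂ start) bs run

-- Subsets, rational hypotheses, and the choice of constants.

module Bridge where

  open Prelude
  open Counting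
  open import Defs
  open Freshness
  open Graph
  open Zigzag using (pick-all)
  open Cover using (length-filter-cnt; module CoverSizes; module Covering)
  open Assembly
  open Cycle
  open import Data.Bool as Bool using ()
  open import Data.Nat.Divisibility using (_∣_)
  open import Data.Nat.DivMod using (_/_; _mod_; m≡m%n+[m/n]*n; m%n<n; m/n*n≤m; m/n/o≡m/[n*o]; /-monoˡ-≤; m*n/n≡m)
  open import Data.Integer as ℤ using (ℤ; +_; -[1+_])
  import Data.Integer.Properties as ℤP
  open import Data.Rational as ℚ using (ℚ; 0ℚ; mkℚ)
  import Data.Rational.Properties as ℚP
  open import Data.Rational.Unnormalised as ℚᵘ using (ℚᵘ; mkℚᵘ; *<*)
  import Data.Rational.Unnormalised.Properties as ℚᵘP
  open import Data.Fin.Subset as Sub using (Subset; ∣_∣; ⁅_⁆; _∪_; inside; outside; _⊆_) renaming (⊥ to ∅; _∈_ to _∈ₛ_; _∉_ to _∉ₛ_)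
  open import Data.Fin.Subset.Properties as SubP using (x∈⁅x⁆; x∈⁅y⁆⇒x≡y; x∈p∪q⁺; x∈p∪q⁻; ∉⊥; ∣⊥∣≡0; ⊆-antisym; drop-∷-⊆; ∪-identityˡ; x∈p∩q⁻; _⊆?_) renaming (_∈?_ to _∈ₛ?_)
  open import Data.List.Properties using (length-map)
  open import Data.Vec.Properties using (≡-dec)
  open import Data.Vec using (here; there)
  open import Function.Bundles using (_⇔_; mk⇔; Inverse)

  module _ {n : ℕ} where

    fromL : List (Fin n) → Subset n
    fromL []       = ∅
    fromL (v ∷ vs) = ⁅ v ⁆ ∪ fromL vs

    ∈-fromL⁺ : ∀ {v} {xs : List (Fin n)} → v ∈ xs → v ∈ₛ fromL xs
    ∈-fromL⁺ {xs = x ∷ xs} (here refl) = x∈p∪q⁺ (inj₁ (x∈⁅x⁆ x))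
    ∈-fromL⁺ {xs = x ∷ xs} (there i)   = x∈p∪q⁺ (inj₂ (∈-fromL⁺ i))

    ∈-fromL⁻ : ∀ {v} (xs : List (Fin n)) → v ∈ₛ fromL xs → v ∈ xs
    ∈-fromL⁻ []       i = ⊥-elim (∉⊥ i)
    ∈-fromL⁻ (x ∷ xs) i = [ (λ j → here (x∈⁅y⁆⇒x≡y x j)) , (λ j → there (∈-fromL⁻ xs j)) ]′ (x∈p∪q⁻ ⁅ x ⁆ (fromL xs) i)

    fromL-cong : ∀ {xs ys : List (Fin n)} → (∀ {v} → v ∈ xs → v ∈ ys) → (∀ {v} → v ∈ ys → v ∈ xs) → fromL xs ≡ fromL ys
    fromL-cong {xs} {ys} f g = ⊆-antisym (λ i → ∈-fromL⁺ (f (∈-fromL⁻ xs i))) (λ i → ∈-fromL⁺ (g (∈-fromL⁻ ys i)))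

  ∣insert∣ : ∀ {n} (v : Fin n) (p : Subset n) → v ∉ₛ p → ∣ ⁅ v ⁆ ∪ p ∣ ≡ suc ∣ p ∣
  ∣insert∣ zero    (inside  ∷ p) v∉ = ⊥-elim (v∉ here)
  ∣insert∣ zero    (outside ∷ p) v∉ = cong (λ q → suc ∣ q ∣) (∪-identityˡ p)
  ∣insert∣ (suc v) (inside  ∷ p) v∉ = cong suc (∣insert∣ v p (λ i → v∉ (there i)))
  ∣insert∣ (suc v) (outside ∷ p) v∉ = ∣insert∣ v p (λ i → v∉ (there i))

  ∣fromL∣ : ∀ {n} {xs : List (Fin n)} → Unique xs → ∣ fromL xs ∣ ≡ length xs
  ∣fromL∣ {n}      []      = ∣⊥∣≡0 n
  ∣fromL∣ {xs = x ∷ xs} (a ∷ u) = trans (∣insert∣ x (fromL xs) (λ i → AllB.lookup a (∈-fromL⁻ xs i) refl)) (cong suc (∣fromL∣ u))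

  ⊆-∣≡∣ : ∀ {n} (p q : Subset n) → p ⊆ q → ∣ p ∣ ≡ ∣ q ∣ → p ≡ q
  ⊆-∣≡∣ []            []            sub eq = refl
  ⊆-∣≡∣ (inside  ∷ p) (inside  ∷ q) sub eq = cong (inside ∷_) (⊆-∣≡∣ p q (drop-∷-⊆ sub) (suc-injective eq))
  ⊆-∣≡∣ (outside ∷ p) (outside ∷ q) sub eq = cong (outside ∷_) (⊆-∣≡∣ p q (drop-∷-⊆ sub) eq)
  ⊆-∣≡∣ (inside  ∷ p) (outside ∷ q) sub eq with sub here
  ... | ()
  ⊆-∣≡∣ (outside ∷ p) (inside  ∷ q) sub eq = ⊥-elim (<⇒≱ (≤-reflexive (sym eq)) (SubP.p⊆q⇒∣p∣≤∣q∣ (drop-∷-⊆ sub)))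

  one-more : ∀ {n} (p q : Subset n) → p ⊆ q → ∣ q ∣ ≡ suc ∣ p ∣ → ∃ λ v → v ∉ₛ p × q ≡ ⁅ v ⁆ ∪ p
  one-more (inside  ∷ p) (inside  ∷ q) sub eq = let v , v∉ , e = one-more p q (drop-∷-⊆ sub) (suc-injective eq) in suc v , (λ { (there i) → v∉ i }) , cong (inside ∷_) e
  one-more (outside ∷ p) (outside ∷ q) sub eq = let v , v∉ , e = one-more p q (drop-∷-⊆ sub) eq in suc v , (λ { (there i) → v∉ i }) , cong (outside ∷_) e
  one-more (inside  ∷ p) (outside ∷ q) sub eq with sub here
  ... | ()
  one-more (outside ∷ p) (inside  ∷ q) sub eq =
    zero , (λ ()) , cong (inside ∷_) (trans (sym (⊆-∣≡∣ p q (drop-∷-⊆ sub) (sym (suc-injective eq)))) (sym (∪-identityˡ p)))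

  cnt-∈ₛ : ∀ {n} (e : Subset n) → cnt (allFin n) (_∈ₛ? e) ≡ ∣ e ∣
  cnt-∈ₛ {n} e = trans (sym (length-filter-cnt (_∈ₛ? e) (allFin n))) (trans (sym (∣fromL∣ (UniqueP.filter⁺ (_∈ₛ? e) (UniqueP.allFin⁺ n)))) (cong ∣_∣ same))
    where
    same : fromL (filter (_∈ₛ? e) (allFin n)) ≡ e
    same = ⊆-antisym (λ i → proj₂ (∈-filter⁻ (_∈ₛ? e) {xs = allFin n} (∈-fromL⁻ _ i))) (λ i → ∈-fromL⁺ (∈-filter⁺ (_∈ₛ? e) (∈-allFin _) i))

  cnt-pow : {A : Set} {P : A → Set} (P? : Decidable P) (xs : List A) (r : ℕ) → cnt (pow r xs) (VAllB.all? P?) ≤ cnt xs P? ^ r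
  cnt-pow P? xs zero    = ≤-trans (≤-reflexive (∑-pow-0 xs _)) (ind-≤1 (VAllB.all? P? []))
  cnt-pow P? xs (suc r) = begin
    cnt (pow (suc r) xs) (VAllB.all? P?)                                    ≡⟨ ∑-pow-suc r xs _ ⟩
    ∑ xs (λ x → ∑ (pow r xs) (λ w → ind (VAllB.all? P? (x ∷ w))))           ≤⟨ ∑-mono xs bound ⟩
    ∑ xs (λ x → ind (P? x) * cnt xs P? ^ r)                                ≡⟨ ∑-*ʳ (cnt xs P? ^ r) xs _ ⟩
    cnt xs P? * cnt xs P? ^ r                                              ∎
    where
    open ≤-Reasoning
    bound : ∀ x → ∑ (pow r xs) (λ w → ind (VAllB.all? P? (x ∷ w))) ≤ ind (P? x) * cnt xs P? ^ r
    bound x = by (P? x)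
      where
      by : (p : Dec _) → ∑ (pow r xs) (λ w → ind (VAllB.all? P? (x ∷ w))) ≤ ind p * cnt xs P? ^ r
      by (yes _) = ≤-trans (∑-mono (pow r xs) (λ w → ind-mono (VAllB.all? P? (x ∷ w)) (VAllB.all? P? w) (λ { (_ ∷ ps) → ps })))
                           (≤-trans (cnt-pow P? xs r) (≤-reflexive (sym (*-identityˡ _))))
      by (no ¬p) = ≤-reflexive (trans (∑-cong (pow r xs) (λ w → ind-no (VAllB.all? P? (x ∷ w)) (λ { (p ∷ _) → ¬p p }))) (trans (∑-const 0 (pow r xs)) (*-zeroʳ (length (pow r xs)))))

  _≟ₛ_ : ∀ {n} (p q : Subset n) → Dec (p ≡ q)
  _≟ₛ_ = ≡-dec Bool._≟_

  module _ {k n : ℕ} (H : ColoredKGraph k n) where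

    -- Uniqueness is demanded separately because `fromL` forgets repetitions.
    system : System n
    system = record
      { E        = λ xs → Unique xs × fromL xs ∈ edges H
      ; E?       = λ xs → unique? xs ×-dec any? (fromL xs ≟ₛ_) (edges H)
      ; E-unique = proj₁
      ; E-resp   = λ p (u , i) → Unique-resp-↭ p u , subst (_∈ edges H) (fromL-↭ p) i
      ; col      = λ xs → colour H (fromL xs)
      ; col-resp = λ p → cong (colour H) (fromL-↭ p)
      }
      where
      fromL-↭ : ∀ {xs ys : List (Fin n)} → xs ↭ ys → fromL xs ≡ fromL ys
      fromL-↭ p = fromL-cong (∈-resp-↭ p) (∈-resp-↭ (↭-sym p))

    open System system

    -- By uniformity an edge containing L has exactly one further vertex, so distinct edges come
    -- from distinct v.
    degree-count : ∀ L → Unique L → suc (length L) ≡ k → deg H (fromL L) ≤ cnt (allFin n) (λ v → E? (v ∷ L))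
    degree-count L u len = begin
      length es                                     ≤⟨ le ⟩
      length (map (λ v → fromL (v ∷ L)) vs)         ≡⟨ length-map _ vs ⟩
      length vs                                     ≡⟨ length-filter-cnt (λ v → E? (v ∷ L)) (allFin n) ⟩
      cnt (allFin n) (λ v → E? (v ∷ L))             ∎
      where
      open ≤-Reasoning
      es = filter (fromL L ⊆?_) (edges H)
      vs = filter (λ v → E? (v ∷ L)) (allFin n)
      extends : ∀ {e} → e ∈ es → e ∈ map (λ v → fromL (v ∷ L)) vs
      extends {e} i =
        let e∈ , sub = ∈-filter⁻ (fromL L ⊆?_) {xs = edges H} i
            v , v∉ , eq = one-more (fromL L) e sub (trans (AllB.lookup (uniform H) e∈) (trans (sym len) (cong suc (sym (∣fromL∣ u)))))
            ok : E (v ∷ L)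
            ok = AllB.tabulate (λ { j refl → v∉ (∈-fromL⁺ j) }) ∷ u , subst (_∈ edges H) eq e∈
        in subst (_∈ map (λ v → fromL (v ∷ L)) vs) (sym eq) (∈-map⁺ (λ v → fromL (v ∷ L)) (∈-filter⁺ (λ v → E? (v ∷ L)) (∈-allFin v) ok))
      le : length es ≤ length (map (λ v → fromL (v ∷ L)) vs)
      le = let rest , p = pick-all {ys = es} (UniqueP.filter⁺ (fromL L ⊆?_) (unique H)) extends
           in ≤-trans (m≤m+n (length es) (length rest)) (≤-reflexive (sym (trans (↭-length p) (length-++ es))))

    -- An edge contains at most k^r ordered r-tuples, whence the factor k^d in the final choice of
    -- c.
    colour-count : ∀ i {ℓ r} (s : Vec (Fin n) ℓ) →
      cnt (pow r (allFin n)) (λ w → E? (toList s ++ toList w) ×-dec (col (toList s ++ toList w) ≟ i)) ≤ degCol H i (fromL (toList s)) * k ^ r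
    colour-count i {r = r} s = begin
      cnt (pow r (allFin n)) (λ w → E? (toList s ++ toList w) ×-dec (col (toList s ++ toList w) ≟ i))  ≤⟨ ∑-mono (pow r (allFin n)) bound ⟩
      ∑ (pow r (allFin n)) (λ w → ∑ es (λ e → ind (VAllB.all? (_∈ₛ? e) w)))                               ≡⟨ ∑-swap (pow r (allFin n)) es _ ⟩
      ∑ es (λ e → cnt (pow r (allFin n)) (VAllB.all? (_∈ₛ? e)))                                           ≤⟨ ∑-mono-∈ es each ⟩
      ∑ es (λ _ → k ^ r)                                                                                 ≡⟨ ∑-const (k ^ r) es ⟩
      degCol H i (fromL (toList s)) * k ^ r                                                              ∎
      where
      open ≤-Reasoning
      sel? = λ e → (fromL (toList s) ⊆? e) ×-dec (colour H e ≟ i)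
      es = filter sel? (edges H)
      each : ∀ e → e ∈ es → cnt (pow r (allFin n)) (VAllB.all? (_∈ₛ? e)) ≤ k ^ r
      each e e∈ = ≤-trans (cnt-pow (_∈ₛ? e) (allFin n) r) (≤-reflexive (cong (_^ r) (trans (cnt-∈ₛ e) (AllB.lookup (uniform H) (proj₁ (∈-filter⁻ sel? {xs = edges H} e∈))))))
      inside-edge : ∀ {m} (w : Vec (Fin n) m) {e} → (∀ {v} → v ∈ toList w → v ∈ₛ e) → VAll (_∈ₛ e) w
      inside-edge []      f = []
      inside-edge (x ∷ w) f = f (here refl) ∷ inside-edge w (λ j → f (there j))
      bound : ∀ w → ind (E? (toList s ++ toList w) ×-dec (col (toList s ++ toList w) ≟ i)) ≤ ∑ es (λ e → ind (VAllB.all? (_∈ₛ? e) w))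
      bound w = by (E? (toList s ++ toList w) ×-dec (col (toList s ++ toList w) ≟ i))
        where
        by : (p : Dec (E (toList s ++ toList w) × col (toList s ++ toList w) ≡ i)) → ind p ≤ ∑ es (λ e → ind (VAllB.all? (_∈ₛ? e) w))
        by (no _) = z≤n
        by (yes ((_ , e∈) , c)) = ≤-trans
          (≤-reflexive (sym (ind-yes (VAllB.all? (_∈ₛ? fromL (toList s ++ toList w)) w) (inside-edge w (λ j → ∈-fromL⁺ (∈-++⁺ʳ (toList s) j))))))
          (∑-∈ (λ e → ind (VAllB.all? (_∈ₛ? e) w)) (∈-filter⁺ sel? e∈ ((λ j → ∈-fromL⁺ (∈-++⁺ˡ (∈-fromL⁻ (toList s) j))) , c)))

  cycle-from-run : ∀ (a b n′ : ℕ) → let open Sizes a b in (H : ColoredKGraph k (suc n′)) →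
                   Segments.HamiltonRun a b (system H) → ProperHamCycle k ℓ n′ H
  cycle-from-run a b n′ H R = record
    { σ        = σ R
    ; m        = length (Segments.HamiltonRun.blocks R)
    ; m-def    = trans (cong (length (Segments.HamiltonRun.blocks R) *_) k∸ℓ) (m*d≡n R)
    ; edge     = λ j → fromL (uncurry ed (edge-place R j))
    ; edge-def = λ j v → subst (λ x → (v ∈ₛ fromL (uncurry ed (edge-place R j))) ⇔
                   (∃[ t ] (t < k × v ≡ Inverse.to (σ R) ((FinB.toℕ j * x + t) mod suc n′)))) (sym k∸ℓ)
                   (mk⇔ (λ i → proj₁ (edge-vertices R j v) (∈-fromL⁻ _ i)) (λ q → ∈-fromL⁺ (proj₂ (edge-vertices R j v) q)))
    ; edge-in  = λ j → proj₂ (edges-in R j)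
    ; proper   = λ i j ne (v , v∈) → let p , q = x∈p∩q⁻ (fromL (uncurry ed (edge-place R i))) (fromL (uncurry ed (edge-place R j))) v∈
                   in proper-cycle R i j ne (∈-fromL⁻ _ p) (∈-fromL⁻ _ q)
    }
    where
    open Graphs a b (system H)
    open Closing a b (system H)
    k∸ℓ : k ∸ ℓ ≡ d
    k∸ℓ = m+n∸m≡n ℓ d

  -- The numerator of a positive γ is at least 1, so γ ≥ 1/g for its denominator g, and 1/2d + 1/g =
  -- (g + 2d)/2dg. Zero and negative numerators contradict 0 < γ.
  codegree-bound : ∀ d′ (γ : ℚ) → 0ℚ ℚ.< γ → ∀ n D → (invTwice (suc d′) ℚ.+ γ) ℚ.* ℕtoℚ n ℚ.≤ ℕtoℚ D →
                   (suc (ℚ.denominator-1 γ) + 2 * suc d′) * n ≤ 2 * suc d′ * suc (ℚ.denominator-1 γ) * D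
  codegree-bound d′ (mkℚ (+ zero)  g′ cop) (ℚ.*<* lt) n D le = ⊥-elim (ℤP.<-irrefl refl lt)
  codegree-bound d′ (mkℚ -[1+ p ]  g′ cop) (ℚ.*<* ()) n D le
  codegree-bound d′ γ@(mkℚ (+ suc p) g′ cop) γ>0 n D le = begin
    (suc g′ + 2 * suc d′) * n                          ≤⟨ *-monoˡ-≤ n (+-monoʳ-≤ (suc g′) (m≤n*m (suc M) (suc p))) ⟩
    (suc g′ + suc p * suc M) * n                       ≡⟨ r₁ g′ p M n ⟩
    (1 * suc g′ + suc p * suc M) * n * 1               ≤⟨ ℤP.drop‿+≤+ (subst₂ ℤ._≤_ eqL eqR (ℚᵘP.drop-*≤* ineq)) ⟩
    D * (suc M * suc g′ * 1)                           ≡⟨ r₂ D M g′ ⟩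
    suc M * suc g′ * D                                 ∎
    where
    open ≤-Reasoning
    -- `suc M` is what `2 * suc d′`, the denominator in `invTwice`, computes to.
    M = d′ + 1 * suc d′
    r₁ : ∀ g p m n → (suc g + suc p * suc m) * n ≡ (1 * suc g + suc p * suc m) * n * 1
    r₁ = solve-∀
    r₂ : ∀ D m g → D * (suc m * suc g * 1) ≡ suc m * suc g * D
    r₂ = solve-∀
    ineq : (mkℚᵘ (+ 1) M ℚᵘ.+ mkℚᵘ (+ suc p) g′) ℚᵘ.* mkℚᵘ (+ n) 0 ℚᵘ.≤ mkℚᵘ (+ D) 0
    ineq = ℚᵘP.≤-respˡ-≃ (ℚᵘP.≃-trans (ℚP.toℚᵘ-homo-* (invTwice (suc d′) ℚ.+ γ) (ℕtoℚ n))
             (ℚᵘP.*-cong (ℚᵘP.≃-trans (ℚP.toℚᵘ-homo-+ (invTwice (suc d′)) γ) (ℚᵘP.+-cong (ℚP.toℚᵘ-fromℚᵘ (mkℚᵘ (+ 1) M)) ℚᵘP.≃-refl))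
               (ℚP.toℚᵘ-fromℚᵘ (mkℚᵘ (+ n) 0))))
           (ℚᵘP.≤-respʳ-≃ (ℚP.toℚᵘ-fromℚᵘ (mkℚᵘ (+ D) 0)) (ℚP.toℚᵘ-mono-≤ le))
    eqL : (+ 1 ℤ.* + suc g′ ℤ.+ + suc p ℤ.* + suc M) ℤ.* + n ℤ.* + 1 ≡ + ((1 * suc g′ + suc p * suc M) * n * 1)
    eqL = trans (cong (λ z → z ℤ.* + n ℤ.* + 1) (cong₂ ℤ._+_ (sym (ℤP.pos-* 1 (suc g′))) (sym (ℤP.pos-* (suc p) (suc M)))))
            (trans (cong (ℤ._* + 1) (sym (ℤP.pos-* (1 * suc g′ + suc p * suc M) n))) (sym (ℤP.pos-* ((1 * suc g′ + suc p * suc M) * n) 1)))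
    eqR : + D ℤ.* + (suc M * suc g′ * 1) ≡ + (D * (suc M * suc g′ * 1))
    eqR = sym (ℤP.pos-* D (suc M * suc g′ * 1))

  colour-bound : ∀ M D X → ℕtoℚ D ℚ.≤ (+ 1 ℚ./ suc M) ℚ.* ℕtoℚ X → suc M * D ≤ X
  colour-bound M D X le = begin
    suc M * D            ≡⟨ r₁ M D ⟩
    D * (suc M * 1)      ≤⟨ ℤP.drop‿+≤+ (subst₂ ℤ._≤_ (sym (ℤP.pos-* D (suc M * 1))) eqR (ℚᵘP.drop-*≤* ineq)) ⟩
    1 * X * 1            ≡⟨ r₂ X ⟩
    X                    ∎
    where
    open ≤-Reasoning
    r₁ : ∀ m D → suc m * D ≡ D * (suc m * 1)
    r₁ = solve-∀
    r₂ : ∀ X → 1 * X * 1 ≡ X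
    r₂ = solve-∀
    ineq : mkℚᵘ (+ D) 0 ℚᵘ.≤ mkℚᵘ (+ 1) M ℚᵘ.* mkℚᵘ (+ X) 0
    ineq = ℚᵘP.≤-respˡ-≃ (ℚP.toℚᵘ-fromℚᵘ (mkℚᵘ (+ D) 0)) (ℚᵘP.≤-respʳ-≃ (ℚᵘP.≃-trans (ℚP.toℚᵘ-homo-* (+ 1 ℚ./ suc M) (ℕtoℚ X))
             (ℚᵘP.*-cong (ℚP.toℚᵘ-fromℚᵘ (mkℚᵘ (+ 1) M)) (ℚP.toℚᵘ-fromℚᵘ (mkℚᵘ (+ X) 0)))) (ℚP.toℚᵘ-mono-≤ le))
    eqR : + 1 ℤ.* + X ℤ.* + 1 ≡ + (1 * X * 1)
    eqR = trans (cong (ℤ._* + 1) (sym (ℤP.pos-* 1 X))) (sym (ℤP.pos-* (1 * X) 1))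

  reciprocal-positive : ∀ M → 0ℚ ℚ.< + 1 ℚ./ suc M
  reciprocal-positive M = ℚP.toℚᵘ-cancel-< (ℚᵘP.<-respʳ-≃ (ℚᵘP.≃-sym (ℚP.toℚᵘ-fromℚᵘ (mkℚᵘ (+ 1) M))) (*<* (ℤ.+<+ (s≤s z≤n))))

  suc≤2^ : ∀ v → suc v ≤ 2 ^ v
  suc≤2^ zero    = ≤-refl
  suc≤2^ (suc v) = +-mono-≤ (≤-trans (s≤s z≤n) (suc≤2^ v)) (≤-trans (suc≤2^ v) (≤-reflexive (sym (+-identityʳ (2 ^ v)))))

  below-next-multiple : ∀ n m → .{{_ : NonZero m}} → n < m * suc (n / m)
  below-next-multiple n m = subst (_< m * suc (n / m)) (sym (m≡m%n+[m/n]*n n m))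
    (<-≤-trans (+-monoˡ-< (n / m * m) (m%n<n n m)) (≤-reflexive (*-comm (suc (n / m)) m)))

  -- Write v = n/(2PW), rounded down; the size of n gives 2PW ≤ v. Hence n < 2PW(v + 1) ≤ (v + 1)² ≤
  -- 4^v, and n^P < 2^(2Pv) ≤ 2^(n/W).
  power<exponential : ∀ W′ P′ n → (suc W′ * (suc P′ + suc P′)) * (suc W′ * (suc P′ + suc P′)) ≤ n → n ^ suc P′ < 2 ^ (n / suc W′)
  power<exponential W′ P′ n big = begin-strict
    n ^ P                                <⟨ ^-monoˡ-< P (below-next-multiple n WQ) ⟩
    (WQ * suc v) ^ P                     ≤⟨ ^-monoˡ-≤ P (*-monoˡ-≤ (suc v) (≤-trans WQ≤v (n≤1+n v))) ⟩
    (suc v * suc v) ^ P                  ≤⟨ ^-monoˡ-≤ P (*-mono-≤ (suc≤2^ v) (suc≤2^ v)) ⟩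
    (2 ^ v * 2 ^ v) ^ P                  ≡⟨ cong (_^ P) (^-distribˡ-+-* 2 v v) ⟨
    (2 ^ (v + v)) ^ P                    ≡⟨ ^-*-assoc 2 (v + v) P ⟩
    2 ^ ((v + v) * P)                    ≡⟨ cong (2 ^_) (r v P) ⟩
    2 ^ (v * (P + P))                    ≤⟨ ^-monoʳ-≤ 2 (≤-trans (≤-reflexive (cong (_* (P + P)) (sym (m/n/o≡m/[n*o] n W (P + P))))) (m/n*n≤m (n / W) (P + P))) ⟩
    2 ^ (n / W)                          ∎
    where
    open ≤-Reasoning
    W = suc W′
    P = suc P′
    WQ = W * (P + P)
    v = n / WQ
    WQ≤v : WQ ≤ v
    WQ≤v = ≤-trans (≤-reflexive (sym (m*n/n≡m WQ WQ))) (/-monoˡ-≤ WQ big)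
    r : ∀ v P → (v + v) * P ≡ v * (P + P)
    r = solve-∀

  -- `used` equals K₁w, and `t₁`, `t₂`, `κ` and `spare` do not depend on w, so they can be read off
  -- at w = 0. G′ is chosen such that (D₀ + 8g)K₁w ≤ n/2; the other half of n accommodates `spare`.
  -- The square in `n₁` is the requirement of `power<exponential`.
  module Constants (a b g′ : ℕ) where

    open Sizes a b

    K₁ G′ : ℕ
    K₁ = t₁ * (κ + κ) * absSize + t₂ * 2 * connSize
      where open AssemblySizes a b 0
    G′ = 2 * ((D₀ + 8 * suc g′) * K₁)

    C₀ n₁ : ℕ
    C₀ = 5 * connD + (2 * exD + (3 * mainD + CoverSizes.coverC a b g′ (8 * suc g′) G′ (suc G′)))
    n₁ = suc (CoverSizes.coverN a b g′ (8 * suc g′) G′ (suc G′)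
           + (2 * ((D₀ + 8 * suc g′) * AssemblySizes.spare a b 0) + (suc G′ * (k + k + (k + k))) * (suc G′ * (k + k + (k + k)))))

  module _ (a b g′ : ℕ) where

    open Sizes a b
    open Constants a b g′

    hamilton-cycle : ∀ n (H : ColoredKGraph k n) → d ∣ n → n₁ ≤ n →
      (∀ S → ∣ S ∣ ≡ a + d → (suc g′ + 2 * d) * n ≤ 2 * d * suc g′ * deg H S) →
      (∀ i S → ∣ S ∣ ≡ ℓ → C₀ * k ^ d * degCol H i S ≤ n ^ d) → HasProperHamCycle k ℓ n H
    hamilton-cycle (suc n′) H d∣n n₁≤n codeg sparse = cycle-from-run a b n′ H
      (Assemble.hamilton a b (system H) g′ (8 * g) G′ w degs cods sp (s≤s z≤n) d∣n
        (m≤m+n (5 * connD) _) (≤-trans (m≤m+n (2 * exD) _) (m≤n+m _ (5 * connD)))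
        (≤-trans (m≤m+n (3 * mainD) _) (≤-trans (m≤n+m _ (2 * exD)) (m≤n+m _ (5 * connD))))
        (≤-trans (m≤n+m _ (3 * mainD)) (≤-trans (m≤n+m _ (2 * exD)) (m≤n+m _ (5 * connD))))
        (≤-trans (m≤m+n _ _) rest≤n) ≤-refl
        (≤-trans (*-monoˡ-≤ (spare + used) (m≤m+n D₀ (8 * g))) room)
        (≤-trans (*-monoˡ-≤ (spare + used) (m≤n+m (8 * g) D₀)) room)
        -- The exponent `suc (a + d + k)` computes to `k + k`, the size of a pair of edges.
        (power<exponential G′ (a + d + k) n (≤-trans (≤-trans (m≤n+m _ (2 * ((D₀ + 8 * g) * spare))) (m≤n+m _ (CoverSizes.coverN a b g′ (8 * g) G′ (suc G′)))) rest≤n))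
        (below-next-multiple n (suc G′)))
      where
      n g w : ℕ
      n = suc n′
      g = suc g′
      w = n / suc G′
      open AssemblySizes a b w
      open Graphs a b (system H) using (Degrees; Sparse; E?; E-unique; Mono?; tup; length-tup)
      open Covering a b (system H) g′ (8 * g) G′ (suc G′) using (Codegrees)
      rest≤n : pred n₁ ≤ n
      rest≤n = ≤-trans (n≤1+n _) n₁≤n
      cods : Codegrees
      cods L u len = ≤-trans (codeg (fromL L) (trans (∣fromL∣ u) len)) (*-monoʳ-≤ (2 * d * g) (degree-count H L u (cong suc len)))
      degs : Degrees
      degs L u len = mkDense (≤-trans (≤-reflexive (length-allFin n)) (*-cancelˡ-≤ g (≤-trans (*-monoˡ-≤ n (m≤m+n g (2 * d))) (≤-trans (cods L u len) (≤-reflexive (r (2 * d) g _))))))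
        where r : ∀ x g c → x * g * c ≡ g * (x * c)
              r = solve-∀
      sp : Sparse C₀
      sp i s = mkRare (by (unique? (toList s)))
        where
        by : Dec (Unique (toList s)) → C₀ * cnt (tup d) (λ x → Mono? i (toList s ++ toList x)) ≤ 1 * length (tup d)
        by (yes u) = begin
          C₀ * cnt (tup d) (λ x → Mono? i (toList s ++ toList x))   ≤⟨ *-monoʳ-≤ C₀ (colour-count H i s) ⟩
          C₀ * (degCol H i (fromL (toList s)) * k ^ d)              ≡⟨ r C₀ (degCol H i (fromL (toList s))) (k ^ d) ⟩
          C₀ * k ^ d * degCol H i (fromL (toList s))                ≤⟨ sparse i (fromL (toList s)) (trans (∣fromL∣ u) (length-toList s)) ⟩
          n ^ d                                                     ≡⟨ trans (*-identityˡ _) (length-tup d) ⟨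
          1 * length (tup d)                                        ∎
          where
          open ≤-Reasoning
          r : ∀ x y z → x * (y * z) ≡ x * z * y
          r = solve-∀
        by (no ¬u) = ≤-trans (≤-reflexive (trans (cong (C₀ *_) (trans (∑-cong (tup d) (λ x → ind-no (Mono? i (toList s ++ toList x)) (λ (e , _) → ¬u (unique-++⁻ˡ (toList s) (E-unique e)))))
          (trans (∑-const 0 (tup d)) (*-zeroʳ (length (tup d)))))) (*-zeroʳ C₀))) z≤n
      room : (D₀ + 8 * g) * (spare + used) ≤ n
      room = *-cancelˡ-≤ 2 (begin
        2 * ((D₀ + 8 * g) * (spare + used))                     ≡⟨ cong (λ z → 2 * ((D₀ + 8 * g) * (spare + z))) (r₁ t₁ κ absSize t₂ connSize w) ⟩
        2 * ((D₀ + 8 * g) * (spare + K₁ * w))                   ≡⟨ r₂ (D₀ + 8 * g) spare K₁ w ⟩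
        2 * ((D₀ + 8 * g) * spare) + w * G′                     ≤⟨ +-mono-≤ (≤-trans (≤-trans (m≤m+n _ _) (m≤n+m _ (CoverSizes.coverN a b g′ (8 * g) G′ (suc G′)))) rest≤n)
                                                                     (≤-trans (*-monoʳ-≤ w (n≤1+n G′)) (m/n*n≤m n (suc G′))) ⟩
        n + n                                                   ≡⟨ cong (λ z → n + z) (sym (+-identityʳ n)) ⟩
        2 * n                                                   ∎)
        where
        open ≤-Reasoning
        r₁ : ∀ t κ A t′ c w → t * (κ * w + κ * w) * A + t′ * (w + w) * c ≡ (t * (κ + κ) * A + t′ * 2 * c) * w
        r₁ = solve-∀
        r₂ : ∀ x s K w → 2 * (x * (s + K * w)) ≡ 2 * (x * s) + w * (2 * (x * K))
        r₂ = solve-∀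

  abstract
    integral-version : ∀ a b g′ → let open Sizes a b in ∃ λ C → ∃ λ n₀ → 0 < n₀ × (∀ n (H : ColoredKGraph k n) → d ∣ n → n₀ ≤ n →
      (∀ S → ∣ S ∣ ≡ a + d → (suc g′ + 2 * d) * n ≤ 2 * d * suc g′ * deg H S) →
      (∀ i S → ∣ S ∣ ≡ ℓ → C * k ^ d * degCol H i S ≤ n ^ d) → HasProperHamCycle k ℓ n H)
    integral-version a b g′ = Constants.C₀ a b g′ , Constants.n₁ a b g′ , s≤s z≤n , hamilton-cycle a b g′

  rational-version : ∀ a b → let open Sizes a b in (γ : ℚ) → 0ℚ ℚ.< γ →
    ∃[ c ] (0ℚ ℚ.< c × ∃[ n₀ ] (0 < n₀ ×
      ((n : ℕ) (H : ColoredKGraph k n) → (k ∸ ℓ) ∣ n → n₀ ≤ n →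
        (∀ (S : Subset n) → ∣ S ∣ ≡ k ∸ 1 → (invTwice (k ∸ ℓ) ℚ.+ γ) ℚ.* ℕtoℚ n ℚ.≤ ℕtoℚ (deg H S)) →
        (∀ (i : ℕ) (S : Subset n) → ∣ S ∣ ≡ ℓ → ℕtoℚ (degCol H i S) ℚ.≤ c ℚ.* ℕtoℚ (n ^ (k ∸ ℓ))) →
        HasProperHamCycle k ℓ n H)))
  rational-version a b γ γ>0 = from-integral (integral-version a b (ℚ.denominator-1 γ))
    where
    open Sizes a b
    k∸ℓ : k ∸ ℓ ≡ d
    k∸ℓ = m+n∸m≡n ℓ d
    from-integral : _ → _
    -- c = 1/(C k^d + 1): the factor k^d comes from `colour-count`, and the added 1 keeps the
    -- denominator positive.
    from-integral (C , n₀ , n₀>0 , main) = + 1 ℚ./ suc M , reciprocal-positive M , n₀ , n₀>0 , λ n H d∣n n₀≤n codeg sparse →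
      main n H (subst (_∣ n) k∸ℓ d∣n) n₀≤n
        (λ S e → codegree-bound (a + suc b) γ γ>0 n (deg H S)
          (subst (λ x → (invTwice x ℚ.+ γ) ℚ.* ℕtoℚ n ℚ.≤ ℕtoℚ (deg H S)) k∸ℓ (codeg S e)))
        (λ i S e → ≤-trans (*-monoˡ-≤ (degCol H i S) (n≤1+n M)) (colour-bound M (degCol H i S) (n ^ d)
          (subst (λ x → ℕtoℚ (degCol H i S) ℚ.≤ (+ 1 ℚ./ suc M) ℚ.* ℕtoℚ (n ^ x)) k∸ℓ (sparse i S e))))
      where M = C * k ^ d

  split-sizes : ∀ k ℓ → 1 ≤ ℓ → 2 * ℓ < k → ∃ λ a → ∃ λ b → ℓ ≡ Sizes.ℓ a b × k ≡ Sizes.k a b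
  split-sizes k (suc a) _ lt = let b , eq = m≤n⇒∃[o]m+o≡n lt in a , b , refl , trans (sym eq) (r a b)
    where r : ∀ a b → suc (2 * suc a) + b ≡ suc a + (suc a + suc b)
          r = solve-∀

open import Defs
open import Data.Nat using (ℕ; _∸_; _*_; _≤_; _<_; _^_)
open import Data.Nat.Divisibility using (_∣_)
open import Data.Rational using (ℚ; 0ℚ; _+_) renaming (_*_ to _*ℚ_; _≤_ to _≤ℚ_; _<_ to _<ℚ_)
open import Data.Fin.Subset using (Subset; ∣_∣)
open import Data.Product using (∃-syntax; _×_; _,_)
open import Relation.Binary.PropositionalEquality using (_≡_; refl)

theorem1p3 : (k ℓ : ℕ) → 3 ≤ k → 1 ≤ ℓ → 2 * ℓ < k →
  (γ : ℚ) → 0ℚ <ℚ γ →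
  ∃[ c ] (0ℚ <ℚ c × ∃[ n₀ ] (0 < n₀ ×
    ((n : ℕ) (H : ColoredKGraph k n) →
      (k ∸ ℓ) ∣ n → n₀ ≤ n →
      (∀ (S : Subset n) → ∣ S ∣ ≡ k ∸ 1 →
        (invTwice (k ∸ ℓ) + γ) *ℚ ℕtoℚ n ≤ℚ ℕtoℚ (deg H S)) →
      (∀ (i : ℕ) (S : Subset n) → ∣ S ∣ ≡ ℓ →
        ℕtoℚ (degCol H i S) ≤ℚ c *ℚ ℕtoℚ (n ^ (k ∸ ℓ))) →
      HasProperHamCycle k ℓ n H)))
theorem1p3 k ℓ _ 1≤ℓ 2ℓ<k γ γ>0 with Bridge.split-sizes k ℓ 1≤ℓ 2ℓ<k
... | a , b , refl , refl = Bridge.rational-version a b γ γ>0
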